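{- The countable models of set theory are linearly pre-ordered by embeddability: if $\langle M,\in^M\rangle$ and $\langle N,\in^N\rangle$ are countable models of set theory, then either $M$ is isomorphic to a submodel of $N$ or $N$ is isomorphic to a submodel of $M$. Indeed, the countable models of set theory are pre-well-ordered by embeddability in order type exactly $\omega_1+1$; that is, the bi-embeddability classes of countable models of set theory, ordered by embeddability, form a well-order of order type exactly $\omega_1+1$.
   Context: A model of set theory is a first-order structure $\langle M,\in^M\rangle$ in the language with one binary relation symbol that satisfies at least the axioms of Kripke–Platek set theory KP; it need not be well-founded or transitive. A submodel of $\langle N,\in^N\rangle$ is an arbitrary subset of $N$ with the restriction of $\in^N$ (an induced substructure, not required to satisfy any axioms). $M$ is embeddable into $N$ if $M$ is isomorphic to a submodel of $N$, i.e. there is an injective $j:M\to N$ with $x\in^M y\iff j(x)\in^N j(y)$. Two models are bi-embeddable if each is embeddable into the other. -}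

module Defs where

open import Level using (0ℓ)
open import Data.Empty using (⊥)
open import Data.Fin using (Fin; zero; suc)
open import Data.Nat using (ℕ; suc)
open import Data.Product using (Σ; ∃; ∃-syntax; _×_)
open import Data.Sum using (_⊎_)
open import Data.Vec using (Vec; _∷_; lookup)
open import Function.Bundles using (_⇔_; _↣_)
open import Function.Definitions using (Injective)
open import Induction.WellFounded using (WellFounded)
open import Relation.Binary.Core using (Rel)
open import Relation.Binary.Structures using (IsStrictTotalOrder)
open import Relation.Binary.Morphism.Structures using (IsOrderIsomorphism)
open import Relation.Binary.PropositionalEquality using (_≡_)
open import Relation.Binary.Construct.Interior.Symmetric using (SymInterior)
import Relation.Binary.Construct.NonStrictToStrict as NonStrictToStrict
open import Relation.Nullary.Construct.Add.Supremum using (_⁺)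
import Relation.Binary.Construct.Add.Supremum.Equality as SupremumEquality
import Relation.Binary.Construct.Add.Supremum.NonStrict as SupremumNonStrict

------------------------------------------------------------------------
-- The first-order language of set theory

infix  8 _∈̇_ _≐_
infixr 7 _∧̇_
infixr 6 _∨̇_
infixr 5 _⇒̇_

-- Well-scoped de Bruijn syntax: the free variables of a Formula n are among
-- Fin n, and a quantifier binds variable zero of its body.
data Formula (n : ℕ) : Set where
  _∈̇_ _≐_       : Fin n → Fin n → Formula n
  ⊥̇             : Formula n
  _∧̇_ _∨̇_ _⇒̇_ : Formula n → Formula n → Formula n
  ∀̇ ∃̇          : Formula (suc n) → Formula n

-- In a bounded quantifier the bound is suc x, so it is never the bound
-- variable itself.
data Δ₀ {n : ℕ} : Formula n → Set where
  mem  : ∀ x y → Δ₀ (x ∈̇ y)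
  eq   : ∀ x y → Δ₀ (x ≐ y)
  bot  : Δ₀ ⊥̇
  and  : ∀ {φ ψ} → Δ₀ φ → Δ₀ ψ → Δ₀ (φ ∧̇ ψ)
  or   : ∀ {φ ψ} → Δ₀ φ → Δ₀ ψ → Δ₀ (φ ∨̇ ψ)
  imp  : ∀ {φ ψ} → Δ₀ φ → Δ₀ ψ → Δ₀ (φ ⇒̇ ψ)
  ball : ∀ x {φ : Formula (suc n)} → Δ₀ φ → Δ₀ (∀̇ (zero ∈̇ suc x ⇒̇ φ))
  bex  : ∀ x {φ : Formula (suc n)} → Δ₀ φ → Δ₀ (∃̇ (zero ∈̇ suc x ∧̇ φ))

record Structure : Set₁ where
  infix 4 _∈_
  field
    Carrier : Set
    _∈_     : Rel Carrier 0ℓ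

open Structure using (Carrier)

_⊨_[_] : (M : Structure) {n : ℕ} → Formula n → Vec (Carrier M) n → Set
M ⊨ x ∈̇ y  [ ρ ] = Structure._∈_ M (lookup ρ x) (lookup ρ y)
M ⊨ x ≐ y   [ ρ ] = lookup ρ x ≡ lookup ρ y
M ⊨ ⊥̇      [ ρ ] = ⊥
M ⊨ φ ∧̇ ψ  [ ρ ] = M ⊨ φ [ ρ ] × M ⊨ ψ [ ρ ]
M ⊨ φ ∨̇ ψ  [ ρ ] = M ⊨ φ [ ρ ] ⊎ M ⊨ ψ [ ρ ]
M ⊨ φ ⇒̇ ψ  [ ρ ] = M ⊨ φ [ ρ ] → M ⊨ ψ [ ρ ]
M ⊨ ∀̇ φ    [ ρ ] = (a : Carrier M) → M ⊨ φ [ a ∷ ρ ]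
M ⊨ ∃̇ φ    [ ρ ] = Σ (Carrier M) λ a → M ⊨ φ [ a ∷ ρ ]

------------------------------------------------------------------------
-- Kripke–Platek set theory

-- KP without the axiom of infinity and with induction for all formulas.
-- In the schemes ρ assigns the parameters of φ.
record IsModelOfKP (M : Structure) : Set where
  open Structure M using (_∈_) renaming (Carrier to A)
  field
    -- First-order structures are nonempty.
    inhabitant : A

    extensionality : ∀ x y → (∀ z → (z ∈ x) ⇔ (z ∈ y)) → x ≡ y

    pairing : ∀ x y → ∃[ p ] ∀ z → (z ∈ p) ⇔ (z ≡ x ⊎ z ≡ y)

    union : ∀ x → ∃[ u ] ∀ z → (z ∈ u) ⇔ (∃[ y ] y ∈ x × z ∈ y)

    ∈-induction : ∀ {n} (φ : Formula (suc n)) (ρ : Vec A n) →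
      (∀ x → (∀ y → y ∈ x → M ⊨ φ [ y ∷ ρ ]) → M ⊨ φ [ x ∷ ρ ]) →
      ∀ x → M ⊨ φ [ x ∷ ρ ]

    Δ₀-separation : ∀ {n} (φ : Formula (suc n)) → Δ₀ φ → (ρ : Vec A n) →
      ∀ a → ∃[ b ] ∀ x → (x ∈ b) ⇔ (x ∈ a × M ⊨ φ [ x ∷ ρ ])

    Δ₀-collection : ∀ {n} (φ : Formula (suc (suc n))) → Δ₀ φ → (ρ : Vec A n) →
      ∀ a → (∀ x → x ∈ a → ∃[ y ] M ⊨ φ [ y ∷ x ∷ ρ ]) →
      ∃[ b ] ∀ x → x ∈ a → ∃[ y ] y ∈ b × M ⊨ φ [ y ∷ x ∷ ρ ]

Countable : Set → Set
Countable A = A ↣ ℕ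

record CountableModel : Set₁ where
  field
    structure   : Structure
    isModelOfKP : IsModelOfKP structure
    countable   : Countable (Carrier structure)

  open Structure structure public

------------------------------------------------------------------------
-- Embeddability

infix 4 _≲_ _≋_ _⋦_

record _≲_ (M N : CountableModel) : Set where
  private
    module M = CountableModel M
    module N = CountableModel N
  field
    embed     : M.Carrier → N.Carrier
    injective : Injective _≡_ _≡_ embed
    ∈⇔∈       : ∀ x y → (x M.∈ y) ⇔ (embed x N.∈ embed y)

-- Bi-embeddability. Quotients are rendered as setoids: the poset of
-- bi-embeddability classes is CountableModel with equality _≋_ and order _≲_.
_≋_ : Rel CountableModel 0ℓ
_≋_ = SymInterior _≲_

_⋦_ : Rel CountableModel 0ℓ
_⋦_ = NonStrictToStrict._<_ _≋_ _≲_

------------------------------------------------------------------------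
-- The ordinal ω₁ + 1

-- ω₁ is the set of countable ordinals, i.e. of order types of countable
-- well-orders: it is rendered as CountableWellOrder with equality _≅_ and
-- order _≤_.
record CountableWellOrder : Set₁ where
  infix 4 _<_
  field
    Carrier            : Set
    _<_                : Rel Carrier 0ℓ
    isStrictTotalOrder : IsStrictTotalOrder _≡_ _<_
    wellFounded        : WellFounded _<_
    countable          : Countable Carrier

infix 4 _≅_ _≤_

_≅_ : Rel CountableWellOrder 0ℓ
α ≅ β = ∃ (IsOrderIsomorphism _≡_ _≡_ α._<_ β._<_)
  where
  module α = CountableWellOrder α
  module β = CountableWellOrder β

-- α ≤ β when α is isomorphic to an initial segment of β, possibly all of β.
record _≤_ (α β : CountableWellOrder) : Set where
  private
    module α = CountableWellOrder α
    module β = CountableWellOrder β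
  field
    embed          : α.Carrier → β.Carrier
    monotone       : ∀ {x y} → x α.< y → embed x β.< embed y
    initialSegment : ∀ x {b} → b β.< embed x → ∃[ a ] embed a ≡ b

ω₁+1 : Set₁
ω₁+1 = CountableWellOrder ⁺

open SupremumEquality _≅_ public using (_≈⁺_)
open SupremumNonStrict _≤_ public using (_≤⁺_)

{-# OPTIONS --safe #-}

-- Inside every model N of KP one defines by recursion sets H(c, p) ∋ p that are closed enough to
-- contain, above each element p, a whole hierarchy of levels indexed by c.  A countable M embeds into N as
-- soon as its elements can be assigned levels S x in such a way that x ∈ y makes S y lie infinitely many
-- steps above S x: enumerating M, one sends x to {u ∈ S x : κ ∈ u} with finitely many elements adjoined,
-- where the set κ reserved for x is put, later on, exactly into the images of the elements of x.  If N is
-- ill-founded, its levels contain a dense order, so that every M embeds into N; if M and N are well-founded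
-- (and N is not V_ω, an easy case) the levels exist precisely when height M ≤ height N.  Hence the embeddability
-- type of M is its height, or ∞ if M is ill-founded.  Skolem hulls in the universe of well-founded trees give
-- well-founded models of arbitrarily large countable height, and a countable ultrapower gives an ill-founded one.

module Submission where

open import Defs
open import Axiom.ExcludedMiddle using (ExcludedMiddle)
open import Data.Bool.Base using (Bool; true; false)
open import Data.Bool.Properties using (T-irrelevant)
open import Data.Empty using (⊥; ⊥-elim)
open import Data.Fin using (Fin; zero; suc; toℕ)
open import Data.List.Base using (List; []; _∷_; map; _++_; foldr)
open import Data.List.Membership.Propositional using () renaming (_∈_ to _∈ₗ_)
open import Data.List.Membership.Propositional.Properties using (∈-map⁺; ∈-map⁻; ∈-++⁺ˡ; ∈-++⁺ʳ)
open import Data.List.Relation.Unary.Any using (here; there)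
open import Data.Maybe.Base as Maybe using (Maybe; just; nothing; from-just)
open import Data.Nat.Base as ℕ using (ℕ; zero; suc; s≤s)
import Data.Nat.Properties as ℕ
open import Data.Nat.Binary.Base as ℕᵇ using (ℕᵇ; 2[1+_]; 1+[2_])
import Data.Nat.Binary.Properties as ℕᵇ
open import Data.Nat.Induction using (<-wellFounded)
open import Data.Product using (Σ; ∃; ∃-syntax; _×_; _,_; proj₁; proj₂)
open import Data.Sum using (_⊎_; inj₁; inj₂; [_,_]′)
open import Data.Unit.Base using (⊤; tt)
open import Data.Vec as Vec using (Vec; []; _∷_; lookup)
open import Function.Base using (_∘_; id)
open import Function.Bundles using (_⇔_; Equivalence; Injection; mk⇔)
open import Induction.WellFounded using (WellFounded; Acc; acc)
open import Level using (Level; 0ℓ; Lift; lift; lower)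
open import Relation.Binary.Construct.Add.Supremum.Equality using (⊤⁺≈⊤⁺; [_])
open import Relation.Binary.Construct.Add.Supremum.NonStrict using (_≤⊤⁺; [_])
open import Relation.Binary.Construct.Interior.Symmetric using (lhs≤rhs) renaming (_,_ to _,,_)
open import Relation.Binary.Core using (Rel)
open import Relation.Binary.Definitions using (tri<; tri≈; tri>)
open import Relation.Binary.Morphism.Structures using (IsOrderIsomorphism)
open import Relation.Binary.PropositionalEquality using (_≡_; _≢_; refl; sym; trans; cong; cong₂; subst)
open import Relation.Binary.PropositionalEquality.Properties using (isEquivalence)
open import Relation.Binary.Structures using (IsTotalOrder; IsStrictTotalOrder)
open import Relation.Nullary using (¬_; Dec; yes; no)
open import Relation.Nullary.Construct.Add.Supremum using ([_]; ⊤⁺)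
open import Relation.Nullary.Decidable using (True; toWitness; fromWitness)

-- KP has no power sets, so the levels cannot be taken from the cumulative hierarchy. The step from
-- `K c p` to `H c p` adds only what the construction of one image consumes: the set itself, its
-- cuts and single adjunctions. The recursion applies `H c′` twice for every c′ ∈ c, so the stretch
-- from p to `H c p` contains two consecutive stretches of each smaller index, much as 2^(c′+1) is
-- twice 2^c′. In the well-founded case the first receives the cut and the second the adjunctions;
-- in the ill-founded case they give the two halves into which an interval is split, and along a
-- descending sequence of indices the splitting never comes to an end. The recursion runs over
-- arbitrary sets c instead of ordinals. For this reason H also serves on the side of M: comparing
-- `H x ∅` with `K y ∅` gives a strict order extending membership even where M has no external rank
-- function. Heights of models of KP leave gaps among the countable ordinals, so M is not sent to
-- its height but to the order type of the heights below it. Surjectivity then only requires that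
-- any countably many heights be attained as ranks in one well-founded countable model.

module Classical (em : ∀ {ℓ} → ExcludedMiddle ℓ) where

  private variable
    a ℓ : Level

  decidable-stable : {P : Set ℓ} → ¬ ¬ P → P
  decidable-stable {P = P} ¬¬p with em {P = P}
  ... | yes p = p
  ... | no ¬p = ⊥-elim (¬¬p ¬p)

  ¬∀⟶∃¬ : {A : Set a} {P : A → Set ℓ} → ¬ (∀ x → P x) → ∃[ x ] ¬ P x
  ¬∀⟶∃¬ ¬∀ = decidable-stable λ ¬∃ → ¬∀ λ x → decidable-stable λ ¬p → ¬∃ (x , ¬p)

  -- A proof-irrelevant copy of P in the lowest universe.
  ∥_∥ : Set ℓ → Set
  ∥ P ∥ = True (em {P = P})

  squash : {P : Set ℓ} → P → ∥ P ∥
  squash = fromWitness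

  unsquash : {P : Set ℓ} → ∥ P ∥ → P
  unsquash = toWitness

  ∥∥-irrelevant : {P : Set ℓ} (p q : ∥ P ∥) → p ≡ q
  ∥∥-irrelevant = T-irrelevant

  squashed-≡ : {A : Set a} {P : A → Set ℓ} {x y : Σ A (λ x → ∥ P x ∥)} → proj₁ x ≡ proj₁ y → x ≡ y
  squashed-≡ {x = x , p} {y = .x , q} refl = cong (x ,_) (∥∥-irrelevant p q)

  least : (P : ℕ → Set ℓ) → ∃ P → ∃[ n ] P n × (∀ m → P m → n ℕ.≤ m)
  least P (n , p) = go n (<-wellFounded n) p
    where
    go : ∀ n → Acc ℕ._<_ n → P n → ∃[ n ] P n × (∀ m → P m → n ℕ.≤ m)
    go n (acc rs) p with em {P = ∃[ m ] m ℕ.< n × P m}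
    ... | yes (m , m<n , q) = go m (rs m<n) q
    ... | no ¬q = n , p , λ m q → ℕ.≮⇒≥ λ m<n → ¬q (m , m<n , q)

  least-of : {A : Set a} (f : A → ℕ) (P : A → Set ℓ) → ∃ P →
    ∃[ x ] P x × (∀ y → P y → f x ℕ.≤ f y)
  least-of f P (x , p) with least (λ n → ∃[ x ] P x × f x ≡ n) (f x , x , p , refl)
  ... | _ , (x , p , refl) , min = x , p , λ y q → min (f y) (y , q , refl)

  ill-founded⇒descending : {A : Set a} {_<_ : Rel A ℓ} → ¬ WellFounded _<_ →
    Σ (ℕ → A) λ c → ∀ n → c (suc n) < c n
  ill-founded⇒descending {A = A} {_<_} ¬wf = (λ n → proj₁ (chain n)) , λ n → proj₁ (proj₂ (step (chain n)))
    where
    step : (x : Σ A λ x → ¬ Acc _<_ x) → ∃[ y ] y < proj₁ x × ¬ Acc _<_ y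
    step (x , ¬a) = decidable-stable λ ¬∃ → ¬a (acc λ {y} y<x → decidable-stable λ ¬b → ¬∃ (y , y<x , ¬b))
    chain : ℕ → Σ A λ x → ¬ Acc _<_ x
    chain zero = ¬∀⟶∃¬ ¬wf
    chain (suc n) with step (chain n)
    ... | y , _ , ¬b = y , ¬b

-- Ordinals as trees, and ranks in well-founded relations

-- Trees serve both as ordinals, compared by _≤ᵗ_, and as sets.
data Tree : Set₁ where
  sup : (A : Set) → (A → Tree) → Tree

infix 4 _≤ᵗ_ _<ᵗ_ _≃ᵗ_

_≤ᵗ_ _<ᵗ_ _≃ᵗ_ : Tree → Tree → Set
sup A f ≤ᵗ v = ∀ a → f a <ᵗ v
u <ᵗ sup B g = ∃[ b ] u ≤ᵗ g b
u ≃ᵗ v = u ≤ᵗ v × v ≤ᵗ u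

≤ᵗ-refl : ∀ u → u ≤ᵗ u
≤ᵗ-refl (sup A f) a = a , ≤ᵗ-refl (f a)

≤ᵗ-trans : ∀ {u v w} → u ≤ᵗ v → v ≤ᵗ w → u ≤ᵗ w
<-≤ᵗ-trans : ∀ {u v w} → u <ᵗ v → v ≤ᵗ w → u <ᵗ w
≤ᵗ-trans {sup A f} p q a = <-≤ᵗ-trans (p a) q
<-≤ᵗ-trans {v = sup B g} {sup C h} (b , p) q with q b
... | c , r = c , ≤ᵗ-trans p r

≤-<ᵗ-trans : ∀ {u v w} → u ≤ᵗ v → v <ᵗ w → u <ᵗ w
≤-<ᵗ-trans {w = sup C h} p (c , q) = c , ≤ᵗ-trans p q

<ᵗ⇒≤ᵗ : ∀ {u v} → u <ᵗ v → u ≤ᵗ v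
<ᵗ⇒≤ᵗ {sup A f} {sup B g} (b , p) a = b , <ᵗ⇒≤ᵗ (p a)

<ᵗ-trans : ∀ {u v w} → u <ᵗ v → v <ᵗ w → u <ᵗ w
<ᵗ-trans p q = <-≤ᵗ-trans p (<ᵗ⇒≤ᵗ q)

≤ᵗ⇒acc : ∀ u {v} → v ≤ᵗ u → Acc _<ᵗ_ v
≤ᵗ⇒acc (sup A f) v≤u = acc λ w<v → ≤ᵗ⇒acc _ (proj₂ (<-≤ᵗ-trans w<v v≤u))

<ᵗ-wellFounded : WellFounded _<ᵗ_
<ᵗ-wellFounded u = ≤ᵗ⇒acc u (≤ᵗ-refl u)

<ᵗ-irrefl : ∀ {u} → ¬ u <ᵗ u
<ᵗ-irrefl {u} = go (<ᵗ-wellFounded u)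
  where
  go : ∀ {u} → Acc _<ᵗ_ u → ¬ u <ᵗ u
  go (acc rs) p = go (rs p) p

≃ᵗ-refl : ∀ {u} → u ≃ᵗ u
≃ᵗ-refl {u} = ≤ᵗ-refl u , ≤ᵗ-refl u

≃ᵗ-sym : ∀ {u v} → u ≃ᵗ v → v ≃ᵗ u
≃ᵗ-sym (p , q) = q , p

≃ᵗ-trans : ∀ {u v w} → u ≃ᵗ v → v ≃ᵗ w → u ≃ᵗ w
≃ᵗ-trans (p , q) (r , s) = ≤ᵗ-trans p r , ≤ᵗ-trans s q

module TreeOrder (em : ∀ {ℓ} → ExcludedMiddle ℓ) where
  open Classical em

  ≤ᵗ-total : ∀ u v → u ≤ᵗ v ⊎ v <ᵗ u
  ≤ᵗ-total (sup A f) v with em {P = ∃[ a ] v ≤ᵗ f a}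
  ... | yes p = inj₂ p
  ... | no ¬p = inj₁ λ a → go v a (λ q → ¬p (a , q))
    where
    go : ∀ v a → ¬ v ≤ᵗ f a → f a <ᵗ v
    go (sup B g) a ¬q with ¬∀⟶∃¬ ¬q
    ... | b , ¬r with ≤ᵗ-total (f a) (g b)
    ... | inj₁ s = b , s
    ... | inj₂ s = ⊥-elim (¬r s)

  <ᵗ⊎≥ᵗ : ∀ u v → u <ᵗ v ⊎ v ≤ᵗ u
  <ᵗ⊎≥ᵗ u v with ≤ᵗ-total v u
  ... | inj₁ p = inj₂ p
  ... | inj₂ p = inj₁ p

module Rank {A : Set} {_<_ : Rel A 0ℓ} where

  rankAcc : ∀ {x} → Acc _<_ x → Tree
  rankAcc {x} (acc rs) = sup (∃[ y ] y < x) λ (_ , y<x) → rankAcc (rs y<x)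

  rankAcc-irrelevant : ∀ {x} (p q : Acc _<_ x) → rankAcc p ≤ᵗ rankAcc q
  rankAcc-irrelevant (acc rs) (acc rs′) (y , y<x) = (y , y<x) , rankAcc-irrelevant (rs y<x) (rs′ y<x)

  module _ (wf : WellFounded _<_) where

    rank : A → Tree
    rank x = rankAcc (wf x)

    rank-mono : ∀ {x y} → x < y → rank x <ᵗ rank y
    rank-mono {x} {y} x<y with wf y
    ... | acc rs = (x , x<y) , rankAcc-irrelevant (wf x) (rs x<y)

    rank-below : ∀ {v} x → v <ᵗ rank x → ∃[ y ] y < x × v ≤ᵗ rank y
    rank-below x v<x with wf x
    rank-below x ((y , y<x) , p) | acc rs = y , y<x , ≤ᵗ-trans p (rankAcc-irrelevant (rs y<x) (wf y))

    rank-least : ∀ {v} x → (∀ {y} → y < x → rank y <ᵗ v) → rank x ≤ᵗ v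
    rank-least x h with wf x
    ... | acc rs = λ (y , y<x) → ≤-<ᵗ-trans (rankAcc-irrelevant (rs y<x) (wf y)) (h y<x)

    module _ (em : ∀ {ℓ} → ExcludedMiddle ℓ) where
      open TreeOrder em

      -- A descent from `x` through elements of rank at least `v` must stop, and it can stop only at
      -- rank `v`: the values of `rank` have no gaps.
      rank-attains : ∀ {v} x → v ≤ᵗ rank x → ∃[ y ] rank y ≃ᵗ v
      rank-attains {v} x = go (wf x)
        where
        go : ∀ {x} → Acc _<_ x → v ≤ᵗ rank x → ∃[ y ] rank y ≃ᵗ v
        go {x} (acc rs) v≤x with ≤ᵗ-total (rank x) v
        ... | inj₁ x≤v = x , x≤v , v≤x
        ... | inj₂ v<x with rank-below x v<x
        ... | y , y<x , v≤y = go (rs y<x) v≤y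

-- Bounded formulas for the recursion that defines H

module _ where
  private variable
    n : ℕ

  -- Serves to find the `Δ₀` derivations of concrete formulas by evaluation.
  Δ₀? : (φ : Formula n) → Maybe (Δ₀ φ)
  Δ₀? (x ∈̇ y) = just (mem x y)
  Δ₀? (x ≐ y) = just (eq x y)
  Δ₀? ⊥̇ = just bot
  Δ₀? (φ ∧̇ ψ) with Δ₀? φ | Δ₀? ψ
  ... | just p | just q = just (and p q)
  ... | _ | _ = nothing
  Δ₀? (φ ∨̇ ψ) with Δ₀? φ | Δ₀? ψ
  ... | just p | just q = just (or p q)
  ... | _ | _ = nothing
  Δ₀? (φ ⇒̇ ψ) with Δ₀? φ | Δ₀? ψ
  ... | just p | just q = just (imp p q)
  ... | _ | _ = nothing
  Δ₀? (∀̇ (zero ∈̇ suc x ⇒̇ φ)) with Δ₀? φ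
  ... | just p = just (ball x p)
  ... | nothing = nothing
  Δ₀? (∃̇ (zero ∈̇ suc x ∧̇ φ)) with Δ₀? φ
  ... | just p = just (bex x p)
  ... | nothing = nothing
  Δ₀? _ = nothing

  pattern 1# = suc zero
  pattern 2# = suc 1#
  pattern 3# = suc 2#
  pattern 4# = suc 3#
  pattern 5# = suc 4#

  ↑ : Fin n → Fin (suc n)
  ↑ = suc
  ↑² : Fin n → Fin (suc (suc n))
  ↑² x = suc (suc x)
  ↑³ : Fin n → Fin (suc (suc (suc n)))
  ↑³ x = suc (↑² x)

  infixr 4 ∀̇∈_∙_ ∃̇∈_∙_

  ∀̇∈_∙_ ∃̇∈_∙_ : Fin n → Formula (suc n) → Formula n
  ∀̇∈ x ∙ φ = ∀̇ (zero ∈̇ suc x ⇒̇ φ)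
  ∃̇∈ x ∙ φ = ∃̇ (zero ∈̇ suc x ∧̇ φ)

  upairF : (u a b : Fin n) → Formula n
  upairF u a b = a ∈̇ u ∧̇ b ∈̇ u ∧̇ (∀̇∈ u ∙ (zero ≐ ↑ a ∨̇ zero ≐ ↑ b))

  -- Kuratowski's t = {{a}, {a, b}}.
  pairF : (t a b : Fin n) → Formula n
  pairF t a b = ∃̇∈ t ∙ ∃̇∈ ↑ t ∙ upairF 1# (↑² a) (↑² a) ∧̇ upairF zero (↑² a) (↑² b) ∧̇ upairF (↑² t) 1# zero

  -- ⟨c, ⟨p, h⟩⟩ ∈ g
  tripleF : (g c p h : Fin n) → Formula n
  tripleF g c p h = ∃̇∈ g ∙ ∃̇∈ zero ∙ ∃̇∈ zero ∙ pairF 2# (↑³ c) zero ∧̇ pairF zero (↑³ p) (↑³ h)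

  -- z = {u ∈ C : k ∈ u}
  cutF : (z C k : Fin n) → Formula n
  cutF z C k = (∀̇∈ z ∙ (zero ∈̇ ↑ C ∧̇ ↑ k ∈̇ zero)) ∧̇ (∀̇∈ C ∙ (↑ k ∈̇ zero ⇒̇ zero ∈̇ ↑ z))

  -- z = x ∪ {y}
  adjF : (z x y : Fin n) → Formula n
  adjF z x y = (∀̇∈ z ∙ (zero ∈̇ ↑ x ∨̇ zero ≐ ↑ y)) ∧̇ (∀̇∈ x ∙ zero ∈̇ ↑ z) ∧̇ y ∈̇ z

  -- The disjunct `z ≐ C` puts C into the next set h. This keeps `justifiedF` bounded: the base can
  -- be sought among the elements of h.
  newF : (z C : Fin n) → Formula n
  newF z C = z ∈̇ C ∨̇ z ≐ C ∨̇ (∃̇∈ C ∙ cutF (↑ z) (↑ C) zero) ∨̇ (∃̇∈ C ∙ ∃̇∈ ↑ C ∙ adjF (↑² z) 1# zero)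

  -- h = C ∪ {C} ∪ {{u ∈ C : k ∈ u} : k ∈ C} ∪ {x ∪ {y} : x, y ∈ C}
  nextF : (C h : Fin n) → Formula n
  nextF C h = (∀̇∈ h ∙ newF zero (↑ C)) ∧̇ (∀̇∈ C ∙ zero ∈̇ ↑ h) ∧̇ C ∈̇ h ∧̇
    (∀̇∈ C ∙ ∃̇∈ ↑ h ∙ cutF zero (↑² C) 1#) ∧̇
    (∀̇∈ C ∙ ∀̇∈ ↑ C ∙ ∃̇∈ ↑² h ∙ adjF zero 2# 1#)

  -- ⟨c, p, q⟩ and ⟨c, q, h⟩ both belong to g.
  twiceF : (g c p q h : Fin n) → Formula n
  twiceF g c p q h = tripleF g c p q ∧̇ tripleF g c q h

  -- E only bounds the intermediate values. It is the base itself in `baseF`, and a set given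
  -- beforehand in `separateBase`, where the base is still to be formed.
  baseElemF : (z g c p E : Fin n) → Formula n
  baseElemF z g c p E = z ≐ p ∨̇ z ∈̇ p ∨̇
    (∃̇∈ c ∙ ∃̇∈ ↑ E ∙ ∃̇∈ ↑² E ∙ twiceF (↑³ g) 2# (↑³ p) 1# zero ∧̇ (↑³ z ≐ zero ∨̇ ↑³ z ∈̇ zero))

  baseF : (g c p C : Fin n) → Formula n
  baseF g c p C = p ∈̇ C ∧̇ (∀̇∈ p ∙ zero ∈̇ ↑ C) ∧̇
    (∀̇∈ c ∙ ∃̇∈ ↑ C ∙ ∃̇∈ ↑² C ∙ twiceF (↑³ g) 2# (↑³ p) 1# zero ∧̇ (∀̇∈ zero ∙ zero ∈̇ ↑ (↑³ C))) ∧̇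
    (∀̇∈ C ∙ baseElemF zero (↑ g) (↑ c) (↑ p) (↑ C))

  justifiedF : (g c p h : Fin n) → Formula n
  justifiedF g c p h = ∃̇∈ h ∙ baseF (↑ g) (↑ c) (↑ p) zero ∧̇ nextF zero (↑ h)

  -- Every element of g is a triple ⟨c, ⟨p, h⟩⟩ that obeys, relative to g, the recursion defining h = H(c, p):
  -- h is obtained by nextF from K(c, p) = {p} ∪ p ∪ ⋃ {{h′} ∪ h′ : h′ = H(c′, H(c′, p)), c′ ∈ c}.
  derivationF : (g : Fin n) → Formula n
  derivationF g = ∀̇∈ g ∙ ∃̇∈ zero ∙ ∃̇∈ zero ∙ ∃̇∈ 1# ∙ ∃̇∈ zero ∙ ∃̇∈ zero ∙ ∃̇∈ 1# ∙
    pairF (suc 5#) 4# 3# ∧̇ pairF 3# 1# zero ∧̇ justifiedF (↑ (↑³ (↑³ g))) 4# 1# zero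

  -- y contains a derivation of the two steps from p to h.
  packedF : (y c p : Fin n) → Formula n
  packedF y c p = ∃̇∈ y ∙ ∃̇∈ ↑ y ∙ ∃̇∈ ↑² y ∙ derivationF 2# ∧̇ twiceF 2# (↑³ c) (↑³ p) 1# zero

  derivationΔ : Δ₀ (derivationF {1} zero)
  derivationΔ = from-just (Δ₀? (derivationF {1} zero))

  baseElemΔ : Δ₀ (baseElemF {5} zero 1# 2# 3# 4#)
  baseElemΔ = from-just (Δ₀? (baseElemF {5} zero 1# 2# 3# 4#))

  packedΔ : Δ₀ (packedF {3} zero 1# 2#)
  packedΔ = from-just (Δ₀? (packedF {3} zero 1# 2#))

-- Set operations in a model of KP

module KP {M : Structure} (kp : IsModelOfKP M) where
  open Structure M renaming (Carrier to A)
  open IsModelOfKP kp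

  _⊆_ : A → A → Set
  x ⊆ y = ∀ z → z ∈ x → z ∈ y

  separate : ∀ {n} (φ : Formula (suc n)) → Δ₀ φ → (ρ : Vec A n) → A → A
  separate φ δ ρ a = proj₁ (Δ₀-separation φ δ ρ a)

  separate-∈ : ∀ {n} (φ : Formula (suc n)) (δ : Δ₀ φ) (ρ : Vec A n) (a : A) {x} →
    x ∈ a → M ⊨ φ [ x ∷ ρ ] → x ∈ separate φ δ ρ a
  separate-∈ φ δ ρ a p q = Equivalence.from (proj₂ (Δ₀-separation φ δ ρ a) _) (p , q)

  ∈-separate : ∀ {n} (φ : Formula (suc n)) (δ : Δ₀ φ) (ρ : Vec A n) (a : A) {x} →
    x ∈ separate φ δ ρ a → x ∈ a × M ⊨ φ [ x ∷ ρ ]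
  ∈-separate φ δ ρ a = Equivalence.to (proj₂ (Δ₀-separation φ δ ρ a) _)

  ext : ∀ {x y} → x ⊆ y → y ⊆ x → x ≡ y
  ext p q = extensionality _ _ λ z → mk⇔ (p z) (q z)

  ∈-irrefl : ∀ x → ¬ x ∈ x
  ∈-irrefl = ∈-induction (zero ∈̇ zero ⇒̇ ⊥̇) [] λ x ih p → ih x p p

  ∅ : A
  ∅ = separate ⊥̇ bot [] inhabitant

  ∉∅ : ∀ {x} → ¬ x ∈ ∅
  ∉∅ p = proj₂ (∈-separate ⊥̇ bot [] inhabitant p)

  upair : A → A → A
  upair x y = proj₁ (pairing x y)

  ∈-upair : ∀ {x y z} → z ∈ upair x y → z ≡ x ⊎ z ≡ y
  ∈-upair {x} {y} = Equivalence.to (proj₂ (pairing x y) _)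

  upair-ˡ : ∀ {x y} → x ∈ upair x y
  upair-ˡ {x} {y} = Equivalence.from (proj₂ (pairing x y) _) (inj₁ refl)

  upair-ʳ : ∀ {x y} → y ∈ upair x y
  upair-ʳ {x} {y} = Equivalence.from (proj₂ (pairing x y) _) (inj₂ refl)

  ⋃ : A → A
  ⋃ x = proj₁ (union x)

  ∈-⋃ : ∀ {x z} → z ∈ ⋃ x → ∃[ y ] y ∈ x × z ∈ y
  ∈-⋃ {x} = Equivalence.to (proj₂ (union x) _)

  ⋃-∈ : ∀ {x y z} → y ∈ x → z ∈ y → z ∈ ⋃ x
  ⋃-∈ {x} p q = Equivalence.from (proj₂ (union x) _) (_ , p , q)

  infixl 6 _∪_

  _∪_ : A → A → A
  x ∪ y = ⋃ (upair x y)

  ∈-∪ : ∀ {x y z} → z ∈ x ∪ y → z ∈ x ⊎ z ∈ y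
  ∈-∪ p with ∈-⋃ p
  ... | _ , q , r with ∈-upair q
  ... | inj₁ refl = inj₁ r
  ... | inj₂ refl = inj₂ r

  ∪-ˡ : ∀ {x y z} → z ∈ x → z ∈ x ∪ y
  ∪-ˡ = ⋃-∈ upair-ˡ

  ∪-ʳ : ∀ {x y z} → z ∈ y → z ∈ x ∪ y
  ∪-ʳ = ⋃-∈ upair-ʳ

  adjoin : A → A → A
  adjoin x y = x ∪ upair y y

  ∈-adjoin : ∀ {x y z} → z ∈ adjoin x y → z ∈ x ⊎ z ≡ y
  ∈-adjoin p with ∈-∪ p
  ... | inj₁ q = inj₁ q
  ... | inj₂ q with ∈-upair q
  ... | inj₁ r = inj₂ r
  ... | inj₂ r = inj₂ r

  adjoin-ˡ : ∀ {x y z} → z ∈ x → z ∈ adjoin x y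
  adjoin-ˡ = ∪-ˡ

  adjoin-ʳ : ∀ {x y} → y ∈ adjoin x y
  adjoin-ʳ = ∪-ʳ upair-ˡ

  cut : A → A → A
  cut C k = separate (1# ∈̇ zero) (mem _ _) (k ∷ []) C

  cut-∈ : ∀ {C k u} → u ∈ C → k ∈ u → u ∈ cut C k
  cut-∈ {C} {k} = separate-∈ (1# ∈̇ zero) (mem _ _) (k ∷ []) C

  ∈-cut : ∀ {C k u} → u ∈ cut C k → u ∈ C × k ∈ u
  ∈-cut {C} {k} = ∈-separate (1# ∈̇ zero) (mem _ _) (k ∷ []) C

  ⟨_,_⟩ : A → A → A
  ⟨ a , b ⟩ = upair (upair a a) (upair a b)

  ∈-upair-≡ : ∀ {a b c} → upair a b ≡ upair c c → a ≡ c × b ≡ c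
  ∈-upair-≡ {a} {b} {c} e = go upair-ˡ , go upair-ʳ
    where
    go : ∀ {x} → x ∈ upair a b → x ≡ c
    go {x} m = [ (λ p → p) , (λ p → p) ]′ (∈-upair (subst (x ∈_) e m))

  upair-cancel : ∀ {a b c} → upair a b ≡ upair a c → b ≡ c
  upair-cancel {a} {b} {c} e with ∈-upair (subst (b ∈_) e upair-ʳ)
  ... | inj₂ p = p
  ... | inj₁ refl = sym (proj₂ (∈-upair-≡ (sym e)))

  ⟨,⟩-injective : ∀ {a b c d} → ⟨ a , b ⟩ ≡ ⟨ c , d ⟩ → a ≡ c × b ≡ d
  ⟨,⟩-injective {a} {b} {c} {d} e = p , upair-cancel (upair-cancel e′)
    where
    p : a ≡ c
    p with ∈-upair (subst (upair a a ∈_) e upair-ˡ)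
    ... | inj₁ q = proj₁ (∈-upair-≡ q)
    ... | inj₂ q = sym (proj₁ (∈-upair-≡ (sym q)))
    e′ : upair (upair a a) (upair a b) ≡ upair (upair a a) (upair a d)
    e′ = trans e (cong₂ (λ x y → upair (upair x x) (upair y d)) (sym p) (sym p))

  Twice : A → A → A → A → A → Set
  Twice g c p q h = ⟨ c , ⟨ p , q ⟩ ⟩ ∈ g × ⟨ c , ⟨ q , h ⟩ ⟩ ∈ g

  New Next : A → A → Set
  New z C = z ∈ C ⊎ z ≡ C ⊎ (∃[ k ] k ∈ C × z ≡ cut C k) ⊎ ∃[ x ] x ∈ C × ∃[ y ] y ∈ C × z ≡ adjoin x y
  Next C h = ∀ z → z ∈ h ⇔ New z C

  BaseElem : A → A → A → A → A → Set
  BaseElem z g c p E = z ≡ p ⊎ z ∈ p ⊎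
    ∃[ c′ ] c′ ∈ c × ∃[ q ] q ∈ E × ∃[ h ] h ∈ E × Twice g c′ p q h × (z ≡ h ⊎ z ∈ h)

  record Base (g c p C : A) : Set where
    constructor base
    field
      start∈ : p ∈ C
      start⊆ : p ⊆ C
      total  : ∀ c′ → c′ ∈ c → ∃[ q ] q ∈ C × ∃[ h ] h ∈ C × Twice g c′ p q h × h ⊆ C
      exact  : ∀ z → z ∈ C → BaseElem z g c p C

  record Justified (g c p h : A) : Set where
    constructor justified
    field
      C      : A
      isBase : Base g c p C
      isNext : Next C h

  Derivation : A → Set
  Derivation g = ∀ t → t ∈ g → ∃[ c ] ∃[ p ] ∃[ h ] t ≡ ⟨ c , ⟨ p , h ⟩ ⟩ × Justified g c p h

  -- The meaning of the formulas in a model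

  module _ {n : ℕ} (ρ : Vec A n) where

    private
      ⟦_⟧ : Fin n → A
      ⟦ x ⟧ = lookup ρ x

    toUpair : ∀ u a b → M ⊨ upairF u a b [ ρ ] → ⟦ u ⟧ ≡ upair ⟦ a ⟧ ⟦ b ⟧
    toUpair u a b (p , q , r) = ext (λ w m → [ (λ { refl → upair-ˡ }) , (λ { refl → upair-ʳ }) ]′ (r w m))
      λ w m → [ (λ { refl → p }) , (λ { refl → q }) ]′ (∈-upair m)

    fromUpair : ∀ u a b → ⟦ u ⟧ ≡ upair ⟦ a ⟧ ⟦ b ⟧ → M ⊨ upairF u a b [ ρ ]
    fromUpair u a b e = subst (⟦ a ⟧ ∈_) (sym e) upair-ˡ , subst (⟦ b ⟧ ∈_) (sym e) upair-ʳ ,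
      λ w m → ∈-upair (subst (w ∈_) e m)

    toCut : ∀ z C k → M ⊨ cutF z C k [ ρ ] → ⟦ z ⟧ ≡ cut ⟦ C ⟧ ⟦ k ⟧
    toCut z C k (p , q) = ext (λ u m → cut-∈ (proj₁ (p u m)) (proj₂ (p u m)))
      λ u m → q u (proj₁ (∈-cut m)) (proj₂ (∈-cut m))

    fromCut : ∀ z C k → ⟦ z ⟧ ≡ cut ⟦ C ⟧ ⟦ k ⟧ → M ⊨ cutF z C k [ ρ ]
    fromCut z C k e = (λ u m → ∈-cut (subst (u ∈_) e m)) , λ u m m′ → subst (u ∈_) (sym e) (cut-∈ m m′)

    toAdj : ∀ z x y → M ⊨ adjF z x y [ ρ ] → ⟦ z ⟧ ≡ adjoin ⟦ x ⟧ ⟦ y ⟧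
    toAdj z x y (p , q , r) = ext (λ u m → [ adjoin-ˡ , (λ { refl → adjoin-ʳ }) ]′ (p u m))
      λ u m → [ q u , (λ { refl → r }) ]′ (∈-adjoin m)

    fromAdj : ∀ z x y → ⟦ z ⟧ ≡ adjoin ⟦ x ⟧ ⟦ y ⟧ → M ⊨ adjF z x y [ ρ ]
    fromAdj z x y e = (λ u m → ∈-adjoin (subst (u ∈_) e m)) ,
      (λ u m → subst (u ∈_) (sym e) (adjoin-ˡ m)) , subst (⟦ y ⟧ ∈_) (sym e) adjoin-ʳ

  module _ {n : ℕ} (ρ : Vec A n) where

    private
      ⟦_⟧ : Fin n → A
      ⟦ x ⟧ = lookup ρ x

    toPair : ∀ t a b → M ⊨ pairF t a b [ ρ ] → ⟦ t ⟧ ≡ ⟨ ⟦ a ⟧ , ⟦ b ⟧ ⟩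
    toPair t a b (u , _ , v , _ , p , q , r) =
      trans (toUpair (v ∷ u ∷ ρ) (↑² t) 1# zero r)
        (cong₂ upair (toUpair (v ∷ u ∷ ρ) 1# (↑² a) (↑² a) p) (toUpair (v ∷ u ∷ ρ) zero (↑² a) (↑² b) q))

    fromPair : ∀ t a b → ⟦ t ⟧ ≡ ⟨ ⟦ a ⟧ , ⟦ b ⟧ ⟩ → M ⊨ pairF t a b [ ρ ]
    fromPair t a b e = u , subst (u ∈_) (sym e) upair-ˡ , v , subst (v ∈_) (sym e) upair-ʳ ,
      fromUpair (v ∷ u ∷ ρ) 1# (↑² a) (↑² a) refl , fromUpair (v ∷ u ∷ ρ) zero (↑² a) (↑² b) refl ,
      fromUpair (v ∷ u ∷ ρ) (↑² t) 1# zero e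
      where
      u = upair ⟦ a ⟧ ⟦ a ⟧
      v = upair ⟦ a ⟧ ⟦ b ⟧

    toNew : ∀ z C → M ⊨ newF z C [ ρ ] → New ⟦ z ⟧ ⟦ C ⟧
    toNew z C (inj₁ p) = inj₁ p
    toNew z C (inj₂ (inj₁ p)) = inj₂ (inj₁ p)
    toNew z C (inj₂ (inj₂ (inj₁ (k , m , p)))) =
      inj₂ (inj₂ (inj₁ (k , m , toCut (k ∷ ρ) (↑ z) (↑ C) zero p)))
    toNew z C (inj₂ (inj₂ (inj₂ (x , m , y , m′ , p)))) =
      inj₂ (inj₂ (inj₂ (x , m , y , m′ , toAdj (y ∷ x ∷ ρ) (↑² z) 1# zero p)))

    fromNew : ∀ z C → New ⟦ z ⟧ ⟦ C ⟧ → M ⊨ newF z C [ ρ ]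
    fromNew z C (inj₁ p) = inj₁ p
    fromNew z C (inj₂ (inj₁ p)) = inj₂ (inj₁ p)
    fromNew z C (inj₂ (inj₂ (inj₁ (k , m , p)))) =
      inj₂ (inj₂ (inj₁ (k , m , fromCut (k ∷ ρ) (↑ z) (↑ C) zero p)))
    fromNew z C (inj₂ (inj₂ (inj₂ (x , m , y , m′ , p)))) =
      inj₂ (inj₂ (inj₂ (x , m , y , m′ , fromAdj (y ∷ x ∷ ρ) (↑² z) 1# zero p)))

  module _ {n : ℕ} (ρ : Vec A n) where

    private
      ⟦_⟧ : Fin n → A
      ⟦ x ⟧ = lookup ρ x

    toTriple : ∀ g c p h → M ⊨ tripleF g c p h [ ρ ] → ⟨ ⟦ c ⟧ , ⟨ ⟦ p ⟧ , ⟦ h ⟧ ⟩ ⟩ ∈ ⟦ g ⟧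
    toTriple g c p h (t , m , u , _ , d , _ , e , e′) =
      subst (_∈ ⟦ g ⟧) (trans (toPair (d ∷ u ∷ t ∷ ρ) 2# (↑³ c) zero e)
        (cong ⟨ ⟦ c ⟧ ,_⟩ (toPair (d ∷ u ∷ t ∷ ρ) zero (↑³ p) (↑³ h) e′))) m

    fromTriple : ∀ g c p h → ⟨ ⟦ c ⟧ , ⟨ ⟦ p ⟧ , ⟦ h ⟧ ⟩ ⟩ ∈ ⟦ g ⟧ → M ⊨ tripleF g c p h [ ρ ]
    fromTriple g c p h m = t , m , u , upair-ʳ , d , upair-ʳ ,
      fromPair (d ∷ u ∷ t ∷ ρ) 2# (↑³ c) zero refl , fromPair (d ∷ u ∷ t ∷ ρ) zero (↑³ p) (↑³ h) refl
      where
      d = ⟨ ⟦ p ⟧ , ⟦ h ⟧ ⟩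
      u = upair ⟦ c ⟧ d
      t = ⟨ ⟦ c ⟧ , d ⟩

    toNext : ∀ C h → M ⊨ nextF C h [ ρ ] → Next ⟦ C ⟧ ⟦ h ⟧
    toNext C h (new , old , self , cuts , adjs) z = mk⇔ (λ m → toNew (z ∷ ρ) zero (↑ C) (new z m)) into
      where
      into : New z ⟦ C ⟧ → z ∈ ⟦ h ⟧
      into (inj₁ m) = old z m
      into (inj₂ (inj₁ refl)) = self
      into (inj₂ (inj₂ (inj₁ (k , m , refl)))) with cuts k m
      ... | z′ , m′ , e = subst (_∈ ⟦ h ⟧) (toCut (z′ ∷ k ∷ ρ) zero (↑² C) 1# e) m′
      into (inj₂ (inj₂ (inj₂ (x , m , y , m′ , refl)))) with adjs x m y m′
      ... | z′ , m″ , e = subst (_∈ ⟦ h ⟧) (toAdj (z′ ∷ y ∷ x ∷ ρ) zero 2# 1# e) m″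

    fromNext : ∀ C h → Next ⟦ C ⟧ ⟦ h ⟧ → M ⊨ nextF C h [ ρ ]
    fromNext C h nx = (λ z m → fromNew (z ∷ ρ) zero (↑ C) (Equivalence.to (nx z) m)) ,
      (λ z m → into (inj₁ m)) , into (inj₂ (inj₁ refl)) ,
      (λ k m → cut ⟦ C ⟧ k , into (inj₂ (inj₂ (inj₁ (k , m , refl)))) ,
        fromCut (cut ⟦ C ⟧ k ∷ k ∷ ρ) zero (↑² C) 1# refl) ,
      λ x m y m′ → adjoin x y , into (inj₂ (inj₂ (inj₂ (x , m , y , m′ , refl)))) ,
        fromAdj (adjoin x y ∷ y ∷ x ∷ ρ) zero 2# 1# refl
      where
      into : ∀ {z} → New z ⟦ C ⟧ → z ∈ ⟦ h ⟧
      into = Equivalence.from (nx _)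

    toTwice : ∀ g c p q h → M ⊨ twiceF g c p q h [ ρ ] → Twice ⟦ g ⟧ ⟦ c ⟧ ⟦ p ⟧ ⟦ q ⟧ ⟦ h ⟧
    toTwice g c p q h (t , t′) = toTriple g c p q t , toTriple g c q h t′

    fromTwice : ∀ g c p q h → Twice ⟦ g ⟧ ⟦ c ⟧ ⟦ p ⟧ ⟦ q ⟧ ⟦ h ⟧ → M ⊨ twiceF g c p q h [ ρ ]
    fromTwice g c p q h (t , t′) = fromTriple g c p q t , fromTriple g c q h t′

  module _ {n : ℕ} (ρ : Vec A n) where

    private
      ⟦_⟧ : Fin n → A
      ⟦ x ⟧ = lookup ρ x

    toBaseElem : ∀ z g c p E → M ⊨ baseElemF z g c p E [ ρ ] → BaseElem ⟦ z ⟧ ⟦ g ⟧ ⟦ c ⟧ ⟦ p ⟧ ⟦ E ⟧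
    toBaseElem z g c p E (inj₁ e) = inj₁ e
    toBaseElem z g c p E (inj₂ (inj₁ e)) = inj₂ (inj₁ e)
    toBaseElem z g c p E (inj₂ (inj₂ (c′ , m , q , m′ , h , m″ , t , e))) = inj₂ (inj₂ (c′ , m , q , m′ , h , m″ ,
      toTwice (h ∷ q ∷ c′ ∷ ρ) (↑³ g) 2# (↑³ p) 1# zero t , e))

    fromBaseElem : ∀ z g c p E → BaseElem ⟦ z ⟧ ⟦ g ⟧ ⟦ c ⟧ ⟦ p ⟧ ⟦ E ⟧ → M ⊨ baseElemF z g c p E [ ρ ]
    fromBaseElem z g c p E (inj₁ e) = inj₁ e
    fromBaseElem z g c p E (inj₂ (inj₁ e)) = inj₂ (inj₁ e)
    fromBaseElem z g c p E (inj₂ (inj₂ (c′ , m , q , m′ , h , m″ , t , e))) = inj₂ (inj₂ (c′ , m , q , m′ , h , m″ ,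
      fromTwice (h ∷ q ∷ c′ ∷ ρ) (↑³ g) 2# (↑³ p) 1# zero t , e))

  module _ {n : ℕ} (ρ : Vec A n) where

    private
      ⟦_⟧ : Fin n → A
      ⟦ x ⟧ = lookup ρ x

    toBase : ∀ g c p C → M ⊨ baseF g c p C [ ρ ] → Base ⟦ g ⟧ ⟦ c ⟧ ⟦ p ⟧ ⟦ C ⟧
    toBase g c p C (p∈ , p⊆ , into , out) = base p∈ p⊆
      (λ c′ m → let (q , q∈ , h , h∈ , t , s) = into c′ m
                in q , q∈ , h , h∈ , toTwice (h ∷ q ∷ c′ ∷ ρ) (↑³ g) 2# (↑³ p) 1# zero t , s)
      λ z m → toBaseElem (z ∷ ρ) zero (↑ g) (↑ c) (↑ p) (↑ C) (out z m)

    fromBase : ∀ g c p C → Base ⟦ g ⟧ ⟦ c ⟧ ⟦ p ⟧ ⟦ C ⟧ → M ⊨ baseF g c p C [ ρ ]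
    fromBase g c p C (base p∈ p⊆ into out) = p∈ , p⊆ ,
      (λ c′ m → let (q , q∈ , h , h∈ , t , s) = into c′ m
                in q , q∈ , h , h∈ , fromTwice (h ∷ q ∷ c′ ∷ ρ) (↑³ g) 2# (↑³ p) 1# zero t , s) ,
      λ z m → fromBaseElem (z ∷ ρ) zero (↑ g) (↑ c) (↑ p) (↑ C) (out z m)

  module _ {n : ℕ} (ρ : Vec A n) where

    private
      ⟦_⟧ : Fin n → A
      ⟦ x ⟧ = lookup ρ x

    toJustified : ∀ g c p h → M ⊨ justifiedF g c p h [ ρ ] → Justified ⟦ g ⟧ ⟦ c ⟧ ⟦ p ⟧ ⟦ h ⟧
    toJustified g c p h (C , _ , b , nx) =
      justified C (toBase (C ∷ ρ) (↑ g) (↑ c) (↑ p) zero b) (toNext (C ∷ ρ) zero (↑ h) nx)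

    fromJustified : ∀ g c p h → Justified ⟦ g ⟧ ⟦ c ⟧ ⟦ p ⟧ ⟦ h ⟧ → M ⊨ justifiedF g c p h [ ρ ]
    fromJustified g c p h (justified C b nx) = C , Equivalence.from (nx C) (inj₂ (inj₁ refl)) ,
      fromBase (C ∷ ρ) (↑ g) (↑ c) (↑ p) zero b , fromNext (C ∷ ρ) zero (↑ h) nx

  module _ {n : ℕ} (ρ : Vec A n) where

    private
      ⟦_⟧ : Fin n → A
      ⟦ x ⟧ = lookup ρ x

    toDerivation : ∀ g → M ⊨ derivationF g [ ρ ] → Derivation ⟦ g ⟧
    toDerivation g d t m with d t m
    ... | u , _ , c , _ , d′ , _ , v , _ , p , _ , h , _ , e₁ , e₂ , j = c , p , h ,
      trans (toPair ρ′ 5+ 4# 3# e₁) (cong ⟨ c ,_⟩ (toPair ρ′ 3# 1# zero e₂)) ,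
      toJustified ρ′ (↑ (↑³ (↑³ g))) 4# 1# zero j
      where
      ρ′ = h ∷ p ∷ v ∷ d′ ∷ c ∷ u ∷ t ∷ ρ
      5+ = suc 5#

    fromDerivation : ∀ g → Derivation ⟦ g ⟧ → M ⊨ derivationF g [ ρ ]
    fromDerivation g d t m with d t m
    ... | c , p , h , refl , j = _ , upair-ʳ , c , upair-ˡ , _ , upair-ʳ , _ , upair-ʳ , p , upair-ˡ , h , upair-ʳ ,
      fromPair ρ′ (suc 5#) 4# 3# refl , fromPair ρ′ 3# 1# zero refl , fromJustified ρ′ (↑ (↑³ (↑³ g))) 4# 1# zero j
      where
      ρ′ = h ∷ p ∷ upair p h ∷ ⟨ p , h ⟩ ∷ c ∷ upair c ⟨ p , h ⟩ ∷ ⟨ c , ⟨ p , h ⟩ ⟩ ∷ ρ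

  -- Existence and uniqueness of the values of H

  justified-mono : ∀ {g g′ c p h} → g ⊆ g′ → Justified g c p h → Justified g′ c p h
  justified-mono {g} {g′} s (justified C (base p∈ p⊆ into out) nx) = justified C
    (base p∈ p⊆
      (λ c′ m → let (q , q∈ , h , h∈ , (t₁ , t₂) , sub) = into c′ m
                in q , q∈ , h , h∈ , (s _ t₁ , s _ t₂) , sub)
      λ z m → elem (out z m)) nx
    where
    elem : ∀ {z c p E} → BaseElem z g c p E → BaseElem z g′ c p E
    elem (inj₁ e) = inj₁ e
    elem (inj₂ (inj₁ e)) = inj₂ (inj₁ e)
    elem (inj₂ (inj₂ (c′ , m , q , m′ , h , m″ , (t₁ , t₂) , e))) =
      inj₂ (inj₂ (c′ , m , q , m′ , h , m″ , (s _ t₁ , s _ t₂) , e))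

  derivation-justified : ∀ {g c p h} → Derivation g → ⟨ c , ⟨ p , h ⟩ ⟩ ∈ g → Justified g c p h
  derivation-justified d t with d _ t
  ... | c , p , h , e , j with ⟨,⟩-injective e
  ... | refl , e′ with ⟨,⟩-injective e′
  ... | refl , refl = j

  next-unique : ∀ {C h h′} → Next C h → Next C h′ → h ≡ h′
  next-unique p q = ext (λ z m → Equivalence.from (q z) (Equivalence.to (p z) m))
    λ z m → Equivalence.from (p z) (Equivalence.to (q z) m)

  opaque
    -- Collection bounds the cuts and the adjunctions, the latter in two rounds because they depend
    -- on two elements of C; separation then discards the surplus.
    next : ∀ C → ∃[ h ] Next C h
    next C = separate φ δ ρ E ,
      λ z → mk⇔ (λ m → toNew (z ∷ ρ) zero 1# (proj₂ (∈-separate φ δ ρ E m)))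
        λ new → separate-∈ φ δ ρ E (bound new) (fromNew (z ∷ ρ) zero 1# new)
      where
      adjs₁ : ∀ x → x ∈ C → ∃[ b ] ∀ y → y ∈ C → ∃[ z ] z ∈ b × M ⊨ adjF zero 2# 1# [ z ∷ y ∷ x ∷ [] ]
      adjs₁ x _ = Δ₀-collection (adjF zero 2# 1#) (from-just (Δ₀? {3} (adjF zero 2# 1#))) (x ∷ []) C
        λ y _ → adjoin x y , fromAdj (adjoin x y ∷ y ∷ x ∷ []) zero 2# 1# refl
      adjs : ∃[ B ] ∀ x → x ∈ C → ∃[ b ] b ∈ B ×
        (∀ y → y ∈ C → ∃[ z ] z ∈ b × M ⊨ adjF zero 3# 1# [ z ∷ y ∷ b ∷ x ∷ C ∷ [] ])
      adjs = Δ₀-collection (∀̇∈ 2# ∙ ∃̇∈ 1# ∙ adjF zero 3# 1#)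
        (from-just (Δ₀? {3} (∀̇∈ 2# ∙ ∃̇∈ 1# ∙ adjF zero 3# 1#))) (C ∷ []) C adjs₁
      cuts : ∃[ B ] ∀ k → k ∈ C → ∃[ z ] z ∈ B × M ⊨ cutF zero 2# 1# [ z ∷ k ∷ C ∷ [] ]
      cuts = Δ₀-collection (cutF zero 2# 1#) (from-just (Δ₀? {3} (cutF zero 2# 1#))) (C ∷ []) C
        λ k _ → cut C k , fromCut (cut C k ∷ k ∷ C ∷ []) zero 2# 1# refl
      E : A
      E = C ∪ upair C C ∪ (proj₁ cuts ∪ ⋃ (proj₁ adjs))
      φ : Formula 2
      φ = newF zero 1#
      δ : Δ₀ φ
      δ = from-just (Δ₀? {2} (newF zero 1#))
      ρ : Vec A 1
      ρ = C ∷ []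
      bound : ∀ {z} → New z C → z ∈ E
      bound (inj₁ m) = ∪-ˡ (∪-ˡ m)
      bound (inj₂ (inj₁ refl)) = ∪-ˡ (∪-ʳ upair-ˡ)
      bound (inj₂ (inj₂ (inj₁ (k , m , refl)))) with proj₂ cuts k m
      ... | z , m′ , e with toCut (z ∷ k ∷ C ∷ []) zero 2# 1# e
      ... | refl = ∪-ʳ (∪-ˡ m′)
      bound (inj₂ (inj₂ (inj₂ (x , m , y , m′ , refl)))) with proj₂ adjs x m
      ... | b , b∈ , all with all y m′
      ... | z , z∈b , e with toAdj (z ∷ y ∷ b ∷ x ∷ C ∷ []) zero 3# 1# e
      ... | refl = ∪-ʳ (∪-ʳ (⋃-∈ b∈ z∈b))

  Determined : A → Set
  Determined c = ∀ p h h′ g g′ → Derivation g → Derivation g′ →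
    ⟨ c , ⟨ p , h ⟩ ⟩ ∈ g → ⟨ c , ⟨ p , h′ ⟩ ⟩ ∈ g′ → h ≡ h′

  opaque
    -- By induction the values for c′ ∈ c agree, so both bases have the same elements. The start p
    -- is quantified inside the induction formula because the second of the two steps starts
    -- elsewhere.
    determined : ∀ c → Determined c
    determined c p h h′ g g′ d d′ t t′ = ∈-induction
      (∀̇ (∀̇ (∀̇ (∀̇ (∀̇ (derivationF 1# ⇒̇ derivationF zero ⇒̇ tripleF 1# 5# 4# 3# ⇒̇ tripleF zero 5# 4# 2# ⇒̇ 3# ≐ 2#))))))
      [] (λ c ih p h h′ g g′ d d′ t t′ → let ρ = g′ ∷ g ∷ h′ ∷ h ∷ p ∷ c ∷ [] in
        step c (λ c₁ m p₁ h₁ h₁′ g₁ g₁′ d₁ d₁′ t₁ t₁′ → let ρ₁ = g₁′ ∷ g₁ ∷ h₁′ ∷ h₁ ∷ p₁ ∷ c₁ ∷ [] in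
            ih c₁ m p₁ h₁ h₁′ g₁ g₁′ (fromDerivation ρ₁ 1# d₁) (fromDerivation ρ₁ zero d₁′)
              (fromTriple ρ₁ 1# 5# 4# 3# t₁) (fromTriple ρ₁ zero 5# 4# 2# t₁′))
          p h h′ g g′ (toDerivation ρ 1# d) (toDerivation ρ zero d′)
          (toTriple ρ 1# 5# 4# 3# t) (toTriple ρ zero 5# 4# 2# t′))
      c p h h′ g g′ (fromDerivation ρ₀ 1# d) (fromDerivation ρ₀ zero d′)
        (fromTriple ρ₀ 1# 5# 4# 3# t) (fromTriple ρ₀ zero 5# 4# 2# t′)
      where
      ρ₀ : Vec A 6
      ρ₀ = g′ ∷ g ∷ h′ ∷ h ∷ p ∷ c ∷ []
      base-⊆ : ∀ {c g g′ p C C′} → (∀ c′ → c′ ∈ c → Determined c′) → Derivation g → Derivation g′ →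
        Base g c p C → Base g′ c p C′ → C ⊆ C′
      base-⊆ ih d d′ (base _ _ _ out) (base p∈ p⊆ into _) z z∈C with out z z∈C
      ... | inj₁ refl = p∈
      ... | inj₂ (inj₁ z∈p) = p⊆ z z∈p
      ... | inj₂ (inj₂ (c′ , c′∈c , q , _ , h , _ , (t₁ , t₂) , e)) with into c′ c′∈c
      ... | q′ , _ , h′ , h′∈ , (t₁′ , t₂′) , sub
        with ih c′ c′∈c _ q q′ _ _ d d′ t₁ t₁′
      ... | refl with ih c′ c′∈c _ h h′ _ _ d d′ t₂ t₂′
      ... | refl with e
      ... | inj₁ refl = h′∈
      ... | inj₂ z∈h = sub z z∈h
      step : ∀ c → (∀ c′ → c′ ∈ c → Determined c′) → Determined c
      step c ih p h h′ g g′ d d′ t t′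
        with derivation-justified d t | derivation-justified d′ t′
      ... | justified C b n | justified C′ b′ n′
        with ext (base-⊆ ih d d′ b b′) (base-⊆ ih d′ d b′ b)
      ... | refl = next-unique n n′

  Derivable : A → A → A → Set
  Derivable c p h = ∃[ g ] Derivation g × ⟨ c , ⟨ p , h ⟩ ⟩ ∈ g

  -- Justification persists in larger sets, so derivations can be united without a check of
  -- compatibility.
  glue : ∀ {G} → (∀ g → g ∈ G → Derivation g) → Derivation (⋃ G)
  glue ds t t∈ with ∈-⋃ t∈
  ... | g , g∈G , t∈g with ds g g∈G t t∈g
  ... | c , p , h , e , j = c , p , h , e , justified-mono (λ _ → ⋃-∈ g∈G) j

  extend : ∀ {g c p h} → Derivation g → Justified g c p h → Derivation (adjoin g ⟨ c , ⟨ p , h ⟩ ⟩)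
  extend d j t t∈ with ∈-adjoin t∈
  ... | inj₂ e = _ , _ , _ , e , justified-mono (λ _ → adjoin-ˡ) j
  ... | inj₁ t∈g with d t t∈g
  ... | c , p , h , e , j′ = c , p , h , e , justified-mono (λ _ → adjoin-ˡ) j′

  -- Collection supplies a single witness for each c′, so the derivation and the two values are made
  -- elements of one set y.
  record Packed (y c p : A) : Set where
    constructor packed
    field
      {g q h} : A
      g∈      : g ∈ y
      q∈      : q ∈ y
      h∈      : h ∈ y
      der     : Derivation g
      twice   : Twice g c p q h

  toPacked : ∀ {y c p} → M ⊨ packedF zero 1# 2# [ y ∷ c ∷ p ∷ [] ] → Packed y c p
  toPacked {y} {c} {p} (g , g∈ , q , q∈ , h , h∈ , d , t) = packed g∈ q∈ h∈
    (toDerivation (h ∷ q ∷ g ∷ y ∷ c ∷ p ∷ []) 2# d)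
    (toTwice (h ∷ q ∷ g ∷ y ∷ c ∷ p ∷ []) 2# 4# 5# 1# zero t)

  fromPacked : ∀ {y c p} → Packed y c p → M ⊨ packedF zero 1# 2# [ y ∷ c ∷ p ∷ [] ]
  fromPacked {y} {c} {p} (packed {g} {q} {h} g∈ q∈ h∈ d t) = g , g∈ , q , q∈ , h , h∈ ,
    fromDerivation (h ∷ q ∷ g ∷ y ∷ c ∷ p ∷ []) 2# d ,
    fromTwice (h ∷ q ∷ g ∷ y ∷ c ∷ p ∷ []) 2# 4# 5# 1# zero t

  opaque
    collectPacked : ∀ c p → (∀ c′ → c′ ∈ c → ∃[ y ] Packed y c′ p) →
      ∃[ B ] ∀ c′ → c′ ∈ c → ∃[ y ] y ∈ B × Packed y c′ p
    collectPacked c p all = to (Δ₀-collection (packedF zero 1# 2#) packedΔ (p ∷ []) c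
        λ c′ m → proj₁ (all c′ m) , fromPacked (proj₂ (all c′ m)))
      where
      to : (∃[ B ] ∀ c′ → c′ ∈ c → ∃[ y ] y ∈ B × M ⊨ packedF zero 1# 2# [ y ∷ c′ ∷ p ∷ [] ]) →
        ∃[ B ] ∀ c′ → c′ ∈ c → ∃[ y ] y ∈ B × Packed y c′ p
      to (B , f) = B , λ c′ m → proj₁ (f c′ m) , proj₁ (proj₂ (f c′ m)) , toPacked (proj₂ (proj₂ (f c′ m)))

  opaque
    separateDerivations : ∀ B → ∃[ G ] ∀ g → g ∈ G ⇔ (g ∈ B × Derivation g)
    separateDerivations B = separate (derivationF zero) derivationΔ [] B ,
      λ g → mk⇔
        (λ m → proj₁ (∈-separate (derivationF zero) derivationΔ [] B m) ,
          toDerivation (g ∷ []) zero (proj₂ (∈-separate (derivationF zero) derivationΔ [] B m)))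
        λ (m , d) → separate-∈ (derivationF zero) derivationΔ [] B m (fromDerivation (g ∷ []) zero d)

  opaque
    separateBase : ∀ g c p B E → ∃[ C ] ∀ z → z ∈ C ⇔ (z ∈ E × BaseElem z g c p B)
    separateBase g c p B E = separate φ baseElemΔ ρ E ,
      λ z → mk⇔
        (λ m → proj₁ (∈-separate φ baseElemΔ ρ E m) ,
          toBaseElem (z ∷ ρ) zero 1# 2# 3# 4# (proj₂ (∈-separate φ baseElemΔ ρ E m)))
        λ (m , e) → separate-∈ φ baseElemΔ ρ E m (fromBaseElem (z ∷ ρ) zero 1# 2# 3# 4# e)
      where
      φ : Formula 5
      φ = baseElemF zero 1# 2# 3# 4#
      ρ : Vec A 4
      ρ = g ∷ c ∷ p ∷ B ∷ []

  opaque
    baseFrom : ∀ {g c p B} → Derivation g → (∀ c′ → c′ ∈ c → ∃[ q ] q ∈ B × ∃[ h ] h ∈ B × Twice g c′ p q h) →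
      ∃[ C ] Base g c p C
    baseFrom {g} {c} {p} {B} gDer twice = C ,
      base (into (∪-ˡ adjoin-ʳ) (inj₁ refl)) (λ z m → into (∪-ˡ (adjoin-ˡ m)) (inj₂ (inj₁ m)))
        (λ c′ m → let (q , q∈ , h , h∈ , t) = twice c′ m
                  in q , qC m q∈ h∈ t , h , hC m q∈ h∈ t , t , h⊆C m q∈ h∈ t)
        λ z m → restrict (proj₂ (Equivalence.to (spec z) m))
      where
      E C : A
      E = adjoin p p ∪ (B ∪ ⋃ B)
      C = proj₁ (separateBase g c p B E)
      spec : ∀ z → z ∈ C ⇔ (z ∈ E × BaseElem z g c p B)
      spec = proj₂ (separateBase g c p B E)
      into : ∀ {z} → z ∈ E → BaseElem z g c p B → z ∈ C
      into {z} m e = Equivalence.from (spec z) (m , e)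
      module _ {c′ q h} (m : c′ ∈ c) (q∈ : q ∈ B) (h∈ : h ∈ B) (t : Twice g c′ p q h) where
        hC : h ∈ C
        hC = into (∪-ʳ (∪-ˡ h∈)) (inj₂ (inj₂ (_ , m , _ , q∈ , _ , h∈ , t , inj₁ refl)))
        h⊆C : h ⊆ C
        h⊆C z z∈h = into (∪-ʳ (∪-ʳ (⋃-∈ h∈ z∈h))) (inj₂ (inj₂ (_ , m , _ , q∈ , _ , h∈ , t , inj₂ z∈h)))
        -- The value h contains its base, and the base contains its start q.
        qC : q ∈ C
        qC = from-start (derivation-justified gDer (proj₂ t))
          where
          from-start : Justified g c′ q h → q ∈ C
          from-start (justified _ b nx) = h⊆C q (Equivalence.from (nx q) (inj₁ (Base.start∈ b)))
      restrict : ∀ {z} → BaseElem z g c p B → BaseElem z g c p C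
      restrict (inj₁ e) = inj₁ e
      restrict (inj₂ (inj₁ e)) = inj₂ (inj₁ e)
      restrict (inj₂ (inj₂ (c′ , m , q , q∈ , h , h∈ , t , e))) =
        inj₂ (inj₂ (c′ , m , q , qC m q∈ h∈ t , h , hC m q∈ h∈ t , t , e))

  opaque
    derive-step : ∀ c p → (∀ c′ → c′ ∈ c → ∀ p → ∃[ h ] Derivable c′ p h) → ∃[ h ] Derivable c p h
    derive-step c p ih with collectPacked c p pack
      where
      pack : ∀ c′ → c′ ∈ c → ∃[ y ] Packed y c′ p
      pack c′ m with ih c′ m p
      ... | q , g₁ , d₁ , t₁ with ih c′ m q
      ... | h , g₂ , d₂ , t₂ = upair (⋃ (upair g₁ g₂)) q ∪ upair h h ,
        packed {g = ⋃ (upair g₁ g₂)} {q} {h} (∪-ˡ upair-ˡ) (∪-ˡ upair-ʳ) (∪-ʳ upair-ˡ)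
          (glue both) (∪-ˡ t₁ , ∪-ʳ t₂)
        where
        both : ∀ g → g ∈ upair g₁ g₂ → Derivation g
        both g m with ∈-upair m
        ... | inj₁ refl = d₁
        ... | inj₂ refl = d₂
    -- Besides the desired derivations, `⋃ B` may contain anything; only derivations may enter the
    -- union.
    ... | B , packs with separateDerivations (⋃ B)
    ... | G , spec = finish (baseFrom gDer twice)
      where
      gDer : Derivation (⋃ G)
      gDer = glue λ g m → proj₂ (Equivalence.to (spec g) m)
      twice : ∀ c′ → c′ ∈ c → ∃[ q ] q ∈ ⋃ B × ∃[ h ] h ∈ ⋃ B × Twice (⋃ G) c′ p q h
      twice c′ m with packs c′ m
      ... | y , y∈ , packed {g′} {q} {h} g∈ q∈ h∈ d (t₁ , t₂) = q , ⋃-∈ y∈ q∈ , h , ⋃-∈ y∈ h∈ , sub _ t₁ , sub _ t₂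
        where
        sub : g′ ⊆ ⋃ G
        sub _ = ⋃-∈ (Equivalence.from (spec g′) (⋃-∈ y∈ g∈ , d))
      finish : ∃[ C ] Base (⋃ G) c p C → ∃[ h ] Derivable c p h
      finish (C , b) with next C
      ... | h , nx = h , adjoin (⋃ G) ⟨ c , ⟨ p , h ⟩ ⟩ , extend gDer (justified C b nx) , adjoin-ʳ

  opaque
    derive : ∀ c p → ∃[ h ] Derivable c p h
    derive c p = to c p (∈-induction (∀̇ (∃̇ (∃̇ (derivationF zero ∧̇ tripleF zero 3# 2# 1#)))) []
      (λ c ih p → from c p (derive-step c p λ c′ m p → to c′ p (ih c′ m p))) c p)
      where
      Raw : A → A → Set
      Raw c p = ∃[ h ] ∃[ g ] M ⊨ derivationF zero ∧̇ tripleF zero 3# 2# 1# [ g ∷ h ∷ p ∷ c ∷ [] ]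
      to : ∀ c p → Raw c p → ∃[ h ] Derivable c p h
      to c p (h , g , d , t) = h , g , toDerivation (g ∷ h ∷ p ∷ c ∷ []) zero d ,
        toTriple (g ∷ h ∷ p ∷ c ∷ []) zero 3# 2# 1# t
      from : ∀ c p → ∃[ h ] Derivable c p h → Raw c p
      from c p (h , g , d , t) = h , g , fromDerivation (g ∷ h ∷ p ∷ c ∷ []) zero d ,
        fromTriple (g ∷ h ∷ p ∷ c ∷ []) zero 3# 2# 1# t

  opaque
    H : A → A → A
    H c p = proj₁ (derive c p)

    justH : ∀ c p → ∃[ g ] Derivation g × Justified g c p (H c p)
    justH c p with derive c p
    ... | h , g , d , t = g , d , derivation-justified d t

    H-unique : ∀ {c p h g} → Derivation g → ⟨ c , ⟨ p , h ⟩ ⟩ ∈ g → h ≡ H c p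
    H-unique {c} {p} {h} {g} d t with derive c p
    ... | h′ , g′ , d′ , t′ = determined c p h h′ g g′ d d′ t t′

    K : A → A → A
    K c p = Justified.C (proj₂ (proj₂ (justH c p)))

    derK : ∀ c p → Derivation (proj₁ (justH c p))
    derK c p = proj₁ (proj₂ (justH c p))

    baseK : ∀ c p → Base (proj₁ (justH c p)) c p (K c p)
    baseK c p = Justified.isBase (proj₂ (proj₂ (justH c p)))

    nextK : ∀ c p → Next (K c p) (H c p)
    nextK c p = Justified.isNext (proj₂ (proj₂ (justH c p)))

    p∈K : ∀ {c p} → p ∈ K c p
    p∈K {c} {p} = Base.start∈ (baseK c p)

    p⊆K : ∀ {c p} → p ⊆ K c p
    p⊆K {c} {p} = Base.start⊆ (baseK c p)

    HH∈K : ∀ {c c′ p} → c′ ∈ c → H c′ (H c′ p) ∈ K c p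
    HH∈K {c} {c′} {p} m with Base.total (baseK c p) c′ m
    ... | q , _ , h , h∈ , (t₁ , t₂) , _ with H-unique (derK c p) t₁
    ... | refl with H-unique (derK c p) t₂
    ... | refl = h∈

    HH⊆K : ∀ {c c′ p} → c′ ∈ c → H c′ (H c′ p) ⊆ K c p
    HH⊆K {c} {c′} {p} m with Base.total (baseK c p) c′ m
    ... | q , _ , h , _ , (t₁ , t₂) , s with H-unique (derK c p) t₁
    ... | refl with H-unique (derK c p) t₂
    ... | refl = s

    ∈-K : ∀ {c p z} → z ∈ K c p →
      z ≡ p ⊎ z ∈ p ⊎ ∃[ c′ ] c′ ∈ c × (z ≡ H c′ (H c′ p) ⊎ z ∈ H c′ (H c′ p))
    ∈-K {c} {p} {z} m with Base.exact (baseK c p) z m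
    ... | inj₁ e = inj₁ e
    ... | inj₂ (inj₁ e) = inj₂ (inj₁ e)
    ... | inj₂ (inj₂ (c′ , c′∈c , q , _ , h , _ , (t₁ , t₂) , e)) with H-unique (derK c p) t₁
    ... | refl with H-unique (derK c p) t₂
    ... | refl = inj₂ (inj₂ (c′ , c′∈c , e))

    K⊆H : ∀ {c p} → K c p ⊆ H c p
    K⊆H z m = Equivalence.from (nextK _ _ z) (inj₁ m)

    K∈H : ∀ {c p} → K c p ∈ H c p
    K∈H = Equivalence.from (nextK _ _ _) (inj₂ (inj₁ refl))

    cut∈H : ∀ {c p k} → k ∈ K c p → cut (K c p) k ∈ H c p
    cut∈H m = Equivalence.from (nextK _ _ _) (inj₂ (inj₂ (inj₁ (_ , m , refl))))

    adjoin∈H : ∀ {c p x y} → x ∈ K c p → y ∈ K c p → adjoin x y ∈ H c p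
    adjoin∈H m m′ = Equivalence.from (nextK _ _ _) (inj₂ (inj₂ (inj₂ (_ , m , _ , m′ , refl))))

    H-cong : ∀ {c c′ p p′} → K c p ≡ K c′ p′ → H c p ≡ H c′ p′
    H-cong {c} {c′} {p} {p′} e = next-unique (nextK c p) (subst (λ C → Next C (H c′ p′)) (sym e) (nextK c′ p′))

-- Depth of an index, room above a level, reserved sets

module Levels {M : Structure} (kp : IsModelOfKP M) where
  open Structure M renaming (Carrier to A)
  open KP kp public

  H⊆HH : ∀ {c p} → H c p ⊆ H c (H c p)
  H⊆HH z m = K⊆H z (p⊆K z m)

  H⊆K : ∀ {c c′ p} → c′ ∈ c → H c′ p ⊆ K c p
  H⊆K m z z∈ = HH⊆K m z (H⊆HH z z∈)

  K⊆K : ∀ {c c′ p} → c′ ∈ c → K c′ p ⊆ K c p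
  K⊆K m z z∈ = H⊆K m z (K⊆H z z∈)

  -- The number is external: `∀ n → Deep n c` says that c has infinite rank or lies in the
  -- ill-founded part.
  Deep : ℕ → A → Set
  Deep zero c = ⊤
  Deep (suc n) c = ∃[ c′ ] c′ ∈ c × Deep n c′

  data Built (p : A) : ℕ → A → Set where
    here : ∀ {n z} → z ∈ p → Built p n z
    adj  : ∀ {n x y} → Built p n x → Built p n y → Built p (suc n) (adjoin x y)

  -- Each nested adjunction costs one step down from the index.
  built∈K : ∀ n {c p z} → Deep n c → Built p n z → z ∈ K c p
  built∈K n d (here m) = p⊆K _ m
  built∈K (suc n) (c′ , m , d) (adj b b′) = H⊆K m _ (adjoin∈H (built∈K n d b) (built∈K n d b′))

  infix 4 _◁_

  -- As `n` is arbitrary, Q has room for every finite construction over P and one cut of it, which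
  -- is what an image is.
  _◁_ : A → A → Set
  P ◁ Q = ∀ {k n z} → k ∈ P → Built (adjoin P (cut P k)) n z → z ∈ Q

  -- The cut already appears in `H c′ p`; the depth of `c` above this new start then pays for the
  -- adjunctions.
  ◁-intro : ∀ {c c′ p Q} → (∀ n → Deep n c) → K c (H c′ p) ⊆ Q → K c′ p ◁ Q
  ◁-intro {c} {c′} {p} deep sub {k} {n} m b = sub _ (built∈K n (deep n) (up b))
    where
    up : ∀ {n z} → Built (adjoin (K c′ p) (cut (K c′ p) k)) n z → Built (H c′ p) n z
    up (here m′) with ∈-adjoin m′
    ... | inj₁ m″ = here (K⊆H _ m″)
    ... | inj₂ refl = here (cut∈H m)
    up (adj b b′) = adj (up b) (up b′)

  zermelo : ℕ → A
  zermelo zero = ∅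
  zermelo (suc n) = adjoin ∅ (zermelo n)

  ∈-zermelo-suc : ∀ n {x} → x ∈ zermelo (suc n) → x ≡ zermelo n
  ∈-zermelo-suc n m with ∈-adjoin m
  ... | inj₁ m′ = ⊥-elim (∉∅ m′)
  ... | inj₂ e = e

  zermelo-suc≢∅ : ∀ n → zermelo (suc n) ≢ ∅
  zermelo-suc≢∅ n e = ∉∅ (subst (zermelo n ∈_) e adjoin-ʳ)

  zermelo-injective : ∀ m n → zermelo m ≡ zermelo n → m ≡ n
  zermelo-injective zero zero e = refl
  zermelo-injective zero (suc n) e = ⊥-elim (zermelo-suc≢∅ n (sym e))
  zermelo-injective (suc m) zero e = ⊥-elim (zermelo-suc≢∅ m e)
  zermelo-injective (suc m) (suc n) e =
    cong suc (zermelo-injective m n (∈-zermelo-suc n (subst (zermelo m ∈_) e adjoin-ʳ)))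

  built-zermelo : ∀ {p} n → ∅ ∈ p → Built p n (zermelo n)
  built-zermelo zero m = here m
  built-zermelo (suc n) m = adj (here m) (built-zermelo n m)

  opaque
    -- Any infinite family of sets none of which belongs to another would do.
    κ : ℕ → A
    κ n = adjoin (zermelo 1) (zermelo (suc (suc n)))

    ∅∈κ : ∀ n → ∅ ∈ κ n
    ∅∈κ n = adjoin-ˡ adjoin-ʳ

    ∈-κ : ∀ n {x} → x ∈ κ n → x ≡ ∅ ⊎ x ≡ zermelo (suc (suc n))
    ∈-κ n m with ∈-adjoin m
    ... | inj₁ m′ = inj₁ (∈-zermelo-suc 0 m′)
    ... | inj₂ e = inj₂ e

    κ-injective : ∀ {m n} → κ m ≡ κ n → m ≡ n
    κ-injective {m} {n} e with ∈-κ n (subst (zermelo (suc (suc m)) ∈_) e adjoin-ʳ)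
    ... | inj₁ e′ = ⊥-elim (zermelo-suc≢∅ (suc m) e′)
    ... | inj₂ e′ = ℕ.suc-injective (ℕ.suc-injective (zermelo-injective _ _ e′))

    -- Every `κ m` contains ∅, but no element of `κ n` does: owing to the shift by two, the numeral
    -- in it is the singleton of a nonempty set.
    κ∉κ : ∀ {m n} → ¬ κ m ∈ κ n
    κ∉κ {m} {n} p with ∈-κ n p
    ... | inj₁ e = ∉∅ (subst (∅ ∈_) e (∅∈κ m))
    ... | inj₂ e = zermelo-suc≢∅ n (sym (∈-zermelo-suc (suc n) (subst (∅ ∈_) e (∅∈κ m))))

    κ∈K : ∀ {c p} → (∀ n → Deep n c) → ∅ ∈ p → ∀ n → κ n ∈ K c p
    κ∈K {c} deep m n = built∈K (suc (suc (suc n))) (deep _)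
      (adj (adj (here m) (here m)) (built-zermelo (suc (suc n)) m))

-- The embedding obtained from an assignment of levels

-- v x consists of the elements of S x containing κ (e x), of κ (e x) itself and, for the finitely many y
-- numbered before x, of κ (e y) if x ∈ˣ y and of v y if y ∈ˣ x.  For y numbered after x, v y ∈ v x thus
-- holds if and only if κ (e x) ∈ v y, that is, y ∈ˣ x.
module Embedding (em : ∀ {ℓ} → ExcludedMiddle ℓ) {M : Structure} (kp : IsModelOfKP M)
  {X : Set} (_∈ˣ_ : Rel X 0ℓ) (∈ˣ-irrefl : ∀ x → ¬ x ∈ˣ x)
  (e : X → ℕ) (e-injective : ∀ {x y} → e x ≡ e y → x ≡ y) where

  open Structure M renaming (Carrier to A)
  open Levels kp

  module _ (S : X → A) (κ∈S : ∀ x n → κ n ∈ S x) (S◁S : ∀ {x y} → x ∈ˣ y → S x ◁ S y) where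

    private
      addIf : Set → A → A → A
      addIf P a s with em {P = P}
      ... | yes _ = adjoin s a
      ... | no _ = s

      ∈-addIf : ∀ {P a s z} → z ∈ addIf P a s → z ∈ s ⊎ P × z ≡ a
      ∈-addIf {P} m with em {P = P}
      ... | no _ = inj₁ m
      ... | yes p with ∈-adjoin m
      ... | inj₁ m′ = inj₁ m′
      ... | inj₂ q = inj₂ (p , q)

      addIf-ˡ : ∀ {P a s z} → z ∈ s → z ∈ addIf P a s
      addIf-ˡ {P} m with em {P = P}
      ... | no _ = m
      ... | yes p = adjoin-ˡ m

      addIf-ʳ : ∀ {P a s} → P → a ∈ addIf P a s
      addIf-ʳ {P} p with em {P = P}
      ... | no ¬p = ⊥-elim (¬p p)
      ... | yes _ = adjoin-ʳ

      FinBuilt : A → A → Set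
      FinBuilt p z = ∃[ n ] Built p n z

      built-addIf : ∀ {P p a s} → (P → a ∈ p) → FinBuilt p s → FinBuilt p (addIf P a s)
      built-addIf {P} m (n , b) with em {P = P}
      ... | no _ = n , b
      ... | yes q = suc n , adj b (here (m q))

      fill : X → (X → A) → A → ℕ → A
      fill x f s zero = s
      fill x f s (suc n) with em {P = ∃[ y ] e y ≡ n}
      ... | yes (y , _) = addIf (y ∈ˣ x) (f y) (addIf (x ∈ˣ y) (κ n) (fill x f s n))
      ... | no _ = fill x f s n

      Added : X → (X → A) → A → X → Set
      Added x f z y = x ∈ˣ y × z ≡ κ (e y) ⊎ y ∈ˣ x × z ≡ f y

      ∈-fill : ∀ {x f s z} n → z ∈ fill x f s n → z ∈ s ⊎ ∃[ y ] e y ℕ.< n × Added x f z y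
      weaken : ∀ {x f s z n} → z ∈ s ⊎ (∃[ y ] e y ℕ.< n × Added x f z y) →
        z ∈ s ⊎ ∃[ y ] e y ℕ.< suc n × Added x f z y
      weaken (inj₁ m) = inj₁ m
      weaken (inj₂ (y , lt , a)) = inj₂ (y , ℕ.m<n⇒m<1+n lt , a)
      ∈-fill zero m = inj₁ m
      ∈-fill (suc n) m with em {P = ∃[ y ] e y ≡ n}
      ... | no _ = weaken (∈-fill n m)
      ... | yes (y , r) with ∈-addIf m
      ... | inj₂ (y∈x , q) = inj₂ (y , s≤s (ℕ.≤-reflexive r) , inj₂ (y∈x , q))
      ... | inj₁ m′ with ∈-addIf m′
      ... | inj₂ (x∈y , q) = inj₂ (y , s≤s (ℕ.≤-reflexive r) , inj₁ (x∈y , trans q (cong κ (sym r))))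
      ... | inj₁ m″ = weaken (∈-fill n m″)

      fill-⊇ : ∀ {x f s z} n → z ∈ s → z ∈ fill x f s n
      fill-⊇ zero m = m
      fill-⊇ (suc n) m with em {P = ∃[ y ] e y ≡ n}
      ... | no _ = fill-⊇ n m
      ... | yes (y , _) = addIf-ˡ (addIf-ˡ (fill-⊇ n m))

      fill-∈ : ∀ {x f s z} n y → e y ℕ.< n → Added x f z y → z ∈ fill x f s n
      fill-∈ {x} {f} (suc n) y (s≤s le) a with em {P = ∃[ y ] e y ≡ n} | e y ℕ.≟ n
      ... | no _ | no ne = fill-∈ n y (ℕ.≤∧≢⇒< le ne) a
      ... | no ¬∃ | yes q = ⊥-elim (¬∃ (y , q))
      ... | yes (y′ , _) | no ne = addIf-ˡ (addIf-ˡ (fill-∈ n y (ℕ.≤∧≢⇒< le ne) a))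
      ... | yes (y′ , q) | yes refl with e-injective q | a
      ... | refl | inj₁ (x∈y , refl) = addIf-ˡ (addIf-ʳ x∈y)
      ... | refl | inj₂ (y∈x , refl) = addIf-ʳ y∈x

      built-fill : ∀ {x f s p} n → FinBuilt p s → (∀ n → κ n ∈ p) →
        (∀ y → e y ℕ.< n → y ∈ˣ x → f y ∈ p) → FinBuilt p (fill x f s n)
      built-fill zero b _ _ = b
      built-fill (suc n) b k h with em {P = ∃[ y ] e y ≡ n}
      ... | no _ = built-fill n b k λ y lt → h y (ℕ.m<n⇒m<1+n lt)
      ... | yes (y , r) = built-addIf (h y (s≤s (ℕ.≤-reflexive r)))
        (built-addIf (λ _ → k n) (built-fill n b k λ y lt → h y (ℕ.m<n⇒m<1+n lt)))

      start : X → A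
      start x = adjoin (cut (S x) (κ (e x))) (κ (e x))

      value : (X → A) → X → A
      value f x = fill x f (start x) (e x)

      -- Course-of-values recursion along the numbering: `table n` is final at the elements numbered
      -- below `n`, and ∅ is a dummy elsewhere.
      table : ℕ → X → A
      table zero x = ∅
      table (suc n) x with e x ℕ.≟ n
      ... | yes _ = value (table n) x
      ... | no _ = table n x

      table-new : ∀ {n} x → e x ≡ n → table (suc n) x ≡ value (table n) x
      table-new {n} x q with e x ℕ.≟ n
      ... | yes _ = refl
      ... | no ne = ⊥-elim (ne q)

    v : X → A
    v x = table (suc (e x)) x

    private
      table-v : ∀ {n} x → e x ℕ.< n → table n x ≡ v x
      table-v {suc n} x (s≤s le) with e x ℕ.≟ n
      ... | yes refl = sym (table-new x refl)
      ... | no ne = table-v x (ℕ.≤∧≢⇒< le ne)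

      data In (x : X) (z : A) : Set where
        cutᵢ  : z ∈ S x → κ (e x) ∈ z → In x z
        selfᵢ : z ≡ κ (e x) → In x z
        markᵢ : ∀ y → e y ℕ.< e x → x ∈ˣ y → z ≡ κ (e y) → In x z
        elemᵢ : ∀ y → e y ℕ.< e x → y ∈ˣ x → z ≡ v y → In x z

      ∈-v : ∀ {x z} → z ∈ v x → In x z
      ∈-v {x} {z} m with ∈-fill (e x) (subst (z ∈_) (table-new x refl) m)
      ... | inj₂ (y , lt , inj₁ (x∈y , q)) = markᵢ y lt x∈y q
      ... | inj₂ (y , lt , inj₂ (y∈x , q)) = elemᵢ y lt y∈x (trans q (table-v y lt))
      ... | inj₁ m′ with ∈-adjoin m′
      ... | inj₂ q = selfᵢ q
      ... | inj₁ m″ = cutᵢ (proj₁ (∈-cut m″)) (proj₂ (∈-cut m″))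

      v-∈ : ∀ {x z} → In x z → z ∈ v x
      v-∈ {x} {z} i = subst (z ∈_) (sym (table-new x refl)) (go i)
        where
        go : In x z → z ∈ value (table (e x)) x
        go (cutᵢ m m′) = fill-⊇ (e x) (adjoin-ˡ (cut-∈ m m′))
        go (selfᵢ refl) = fill-⊇ (e x) adjoin-ʳ
        go (markᵢ y lt x∈y q) = fill-∈ (e x) y lt (inj₁ (x∈y , q))
        go (elemᵢ y lt y∈x q) = fill-∈ (e x) y lt (inj₂ (y∈x , trans q (sym (table-v y lt))))

      -- Induction on the number of x: the images adjoined to `v x` belong to elements of x, hence
      -- lie in `S x`, and so `v x` is finitely built over `S x` and its cut.
      v∈S : ∀ {x y} → x ∈ˣ y → v x ∈ S y
      v∈S {x} = go x (<-wellFounded (e x))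
        where
        go : ∀ x {y} → Acc ℕ._<_ (e x) → x ∈ˣ y → v x ∈ S y
        go x {y} (acc rs) x∈y = subst (_∈ S y) (sym (table-new x refl)) (S◁S x∈y (κ∈S x (e x)) (proj₂ built))
          where
          built : FinBuilt (adjoin (S x) (cut (S x) (κ (e x)))) (value (table (e x)) x)
          built = built-fill (e x) (1 , adj (here adjoin-ʳ) (here (adjoin-ˡ (κ∈S x (e x))))) (λ n → adjoin-ˡ (κ∈S x n))
            λ y lt y∈x → adjoin-ˡ (subst (_∈ S x) (sym (table-v y lt)) (go y (rs lt) y∈x))

      v≢κ : ∀ {x n} → v x ≢ κ n
      v≢κ {x} q = κ∉κ (subst (κ (e x) ∈_) q (v-∈ (selfᵢ refl)))

      -- Members of the cut contain `κ (e x)`, and every image contains its own reserved set,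
      -- whereas no reserved set contains another. So only those adjoined on purpose occur.
      κ∈v : ∀ {x n} → κ n ∈ v x → n ≡ e x ⊎ ∃[ y ] e y ≡ n × e y ℕ.< e x × x ∈ˣ y
      κ∈v m with ∈-v m
      ... | cutᵢ _ m′ = ⊥-elim (κ∉κ m′)
      ... | selfᵢ q = inj₁ (κ-injective q)
      ... | markᵢ y lt x∈y q = inj₂ (y , sym (κ-injective q) , lt , x∈y)
      ... | elemᵢ y _ _ q = ⊥-elim (v≢κ (sym q))

    -- For different numbers, each image could contain the reserved set of the other only as a mark.
    -- Marks have smaller numbers, which cannot be true both ways.
    v-injective : ∀ {x y} → v x ≡ v y → x ≡ y
    v-injective {x} {y} q with κ∈v (subst (κ (e x) ∈_) q (v-∈ (selfᵢ refl)))
      | κ∈v (subst (κ (e y) ∈_) (sym q) (v-∈ (selfᵢ refl)))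
    ... | inj₁ r | _ = e-injective r
    ... | _ | inj₁ r = e-injective (sym r)
    ... | inj₂ (_ , r , lt , _) | inj₂ (_ , r′ , lt′ , _) =
      ⊥-elim (ℕ.<-asym (subst (ℕ._< e y) r lt) (subst (ℕ._< e x) r′ lt′))

    v-mono : ∀ {x y} → x ∈ˣ y → v x ∈ v y
    v-mono {x} {y} x∈y with ℕ.<-cmp (e x) (e y)
    ... | tri< lt _ _ = v-∈ (elemᵢ x lt x∈y refl)
    ... | tri≈ _ q _ = ⊥-elim (∈ˣ-irrefl x (subst (x ∈ˣ_) (sym (e-injective q)) x∈y))
    ... | tri> _ _ gt = v-∈ (cutᵢ (v∈S x∈y) (v-∈ (markᵢ y gt x∈y refl)))

    v-cancel : ∀ {x y} → v x ∈ v y → x ∈ˣ y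
    v-cancel {x} {y} m with ∈-v m
    ... | selfᵢ q = ⊥-elim (v≢κ q)
    ... | markᵢ _ _ _ q = ⊥-elim (v≢κ q)
    ... | elemᵢ w _ w∈y q = subst (_∈ˣ y) (sym (v-injective q)) w∈y
    ... | cutᵢ _ m′ with κ∈v m′
    ... | inj₁ q = ⊥-elim (∈-irrefl (v x) (subst (v x ∈_) (cong v (e-injective q)) m))
    ... | inj₂ (w , q , _ , x∈w) = subst (x ∈ˣ_) (e-injective q) x∈w

-- Embedding into an ill-founded model

module Precedence {M : Structure} (kp : IsModelOfKP M) where
  open Structure M
  open Levels kp using (_⊆_; H; K; ∅; ∈-irrefl; H⊆K; K⊆H; K∈H)

  infix 4 _≺_

  -- Replaces the comparison of ranks when M may be ill-founded. The splitting of intervals requires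
  -- transitivity, which membership lacks.
  _≺_ : Rel Carrier 0ℓ
  x ≺ y = H x ∅ ⊆ K y ∅

  ∈⇒≺ : ∀ {x y} → x ∈ y → x ≺ y
  ∈⇒≺ = H⊆K

  ≺-trans : ∀ {x y z} → x ≺ y → y ≺ z → x ≺ z
  ≺-trans p q u m = q u (K⊆H u (p u m))

  ≺-irrefl : ∀ x → ¬ x ≺ x
  ≺-irrefl x p = ∈-irrefl (K x ∅) (p (K x ∅) K∈H)

-- Every x receives an interval of the chain of levels: stage j splits the current interval in two,
-- and x goes to the left part when x precedes the element with code j.
module IllFounded (em : ∀ {ℓ} → ExcludedMiddle ℓ) {M : Structure} (kp : IsModelOfKP M)
  (c : ℕ → Structure.Carrier M) (c-descends : ∀ n → Structure._∈_ M (c (suc n)) (c n))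
  {X : Set} (_∈ˣ_ _≺ˣ_ : Rel X 0ℓ) (∈⇒≺ˣ : ∀ {x y} → x ∈ˣ y → x ≺ˣ y)
  (≺ˣ-trans : ∀ {x y z} → x ≺ˣ y → y ≺ˣ z → x ≺ˣ z) (≺ˣ-irrefl : ∀ x → ¬ x ≺ˣ x)
  (e : X → ℕ) (e-injective : ∀ {x y} → e x ≡ e y → x ≡ y) where

  open Structure M renaming (Carrier to A)
  open Levels kp

  private
    deep-c : ∀ n j → Deep n (c j)
    deep-c zero j = tt
    deep-c (suc n) j = c (suc j) , c-descends j , deep-c n (suc j)

    double : ℕ → ℕ
    double zero = zero
    double (suc j) = suc (suc (double j))

    -- A stage uses two indices: `b j` splits the interval governed by `a j`, and `a (suc j)`
    -- governs the halves.
    a b : ℕ → A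
    a j = c (double j)
    b j = c (suc (double j))

    b∈a : ∀ j → b j ∈ a j
    b∈a j = c-descends (double j)

    a∈b : ∀ j → a (suc j) ∈ b j
    a∈b j = c-descends (suc (double j))

    Left : X → ℕ → Set
    Left x j = ∃[ y ] e y ≡ j × x ≺ˣ y

    interval : X → ℕ → A × A
    -- The start {∅} ensures that every level contains ∅, from which the reserved sets are built.
    interval x zero = adjoin ∅ ∅ , K (a 0) (adjoin ∅ ∅)
    interval x (suc j) with em {P = Left x j}
    ... | yes _ = proj₁ (interval x j) , K (a (suc j)) (proj₁ (interval x j))
    ... | no _ = H (b j) (proj₁ (interval x j)) , proj₂ (interval x j)

    p q : X → ℕ → A
    p x j = proj₁ (interval x j)
    q x j = proj₂ (interval x j)

    left : ∀ {x j} → Left x j → interval x (suc j) ≡ (p x j , K (a (suc j)) (p x j))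
    left {x} {j} l with em {P = Left x j}
    ... | yes _ = refl
    ... | no ¬l = ⊥-elim (¬l l)

    right : ∀ {x j} → ¬ Left x j → interval x (suc j) ≡ (H (b j) (p x j) , q x j)
    right {x} {j} ¬l with em {P = Left x j}
    ... | yes l = ⊥-elim (¬l l)
    ... | no _ = refl

    ⊆-trans : ∀ {x y z} → x ⊆ y → y ⊆ z → x ⊆ z
    ⊆-trans s t u m = t u (s u m)

    p⊆H : ∀ {d r} → r ⊆ H d r
    p⊆H = ⊆-trans p⊆K K⊆H

    ∅∈p : ∀ x j → ∅ ∈ p x j
    ∅∈p x zero = adjoin-ʳ
    ∅∈p x (suc j) with em {P = Left x j}
    ... | yes _ = ∅∈p x j
    ... | no _ = p⊆H ∅ (∅∈p x j)

    -- The invariant that keeps intervals long enough: after a move to the right, the second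
    -- application of `H (b j)` is still available.
    gap : ∀ x j → K (a j) (p x j) ⊆ q x j
    gap x zero u m = m
    gap x (suc j) with em {P = Left x j}
    ... | yes _ = λ u m → m
    ... | no _ = ⊆-trans (K⊆K (a∈b j)) (⊆-trans K⊆H (⊆-trans (HH⊆K (b∈a j)) (gap x j)))

    p-step : ∀ x j → p x j ⊆ p x (suc j)
    p-step x j with em {P = Left x j}
    ... | yes _ = λ u m → m
    ... | no _ = p⊆H

    q-step : ∀ x j → q x (suc j) ⊆ q x j
    q-step x j with em {P = Left x j}
    ... | yes _ = ⊆-trans (K⊆K (a∈b j)) (⊆-trans (K⊆K (b∈a j)) (gap x j))
    ... | no _ = λ u m → m

    p-mono : ∀ x {j k} → j ℕ.≤′ k → p x j ⊆ p x k
    p-mono x ℕ.≤′-refl u m = m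
    p-mono x (ℕ.≤′-step le) = ⊆-trans (p-mono x le) (p-step x _)

    q-mono : ∀ x {j k} → j ℕ.≤′ k → q x k ⊆ q x j
    q-mono x ℕ.≤′-refl u m = m
    q-mono x (ℕ.≤′-step le) = ⊆-trans (q-step x _) (q-mono x le)

    Separated : X → X → ℕ → Set
    Separated x y j = interval x j ≡ interval y j ⊎ q x j ⊆ p y j

    -- The interval is shared until x goes left and y goes right. The opposite is excluded: if y
    -- precedes the tested element, so does x.
    separated : ∀ {x y} → x ≺ˣ y → ∀ j → Separated x y j
    separated x≺y zero = inj₁ refl
    separated {x} {y} x≺y (suc j) with separated x≺y j
    ... | inj₂ s = inj₂ (⊆-trans (q-step x j) (⊆-trans s (p-step y j)))
    ... | inj₁ same with em {P = Left x j} | em {P = Left y j}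
    ... | yes _ | yes _ = inj₁ (cong (λ (p , q) → p , K (a (suc j)) p) same)
    ... | no _ | no _ = inj₁ (cong (λ (p , q) → H (b j) p , q) same)
    ... | no ¬l | yes (w , ew , y≺w) = ⊥-elim (¬l (w , ew , ≺ˣ-trans x≺y y≺w))
    ... | yes _ | no _ = inj₂ (subst (λ r → K (a (suc j)) (p x j) ⊆ H (b j) r) (cong proj₁ same)
      (⊆-trans (K⊆K (a∈b j)) K⊆H))

    -- The right end of the left half at stage `e x`. Predecessors of x that still share its
    -- interval go left and stay below it; successors go right, starting at `H (b (e x))` of the
    -- common start.
    S : X → A
    S x = K (a (suc (e x))) (p x (e x))

    κ∈S : ∀ x n → κ n ∈ S x
    κ∈S x = κ∈K (λ n → deep-c n _) (∅∈p x (e x))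

    S◁ : ∀ {x Q} → K (b (e x)) (p x (e x)) ⊆ Q → S x ◁ Q
    S◁ {x} s = ◁-intro (λ n → deep-c n _) (⊆-trans K⊆H (⊆-trans (HH⊆K (a∈b (e x))) s))

    S◁′ : ∀ {x Q} → q x (e x) ⊆ Q → S x ◁ Q
    S◁′ {x} s = S◁ (⊆-trans (K⊆K (b∈a (e x))) (⊆-trans (gap x (e x)) s))

    S◁S : ∀ {x y} → x ∈ˣ y → S x ◁ S y
    S◁S {x} {y} x∈y with ℕ.<-cmp (e x) (e y)
    S◁S {x} {y} x∈y | tri≈ _ r _ = ⊥-elim (≺ˣ-irrefl x (subst (x ≺ˣ_) (sym (e-injective r)) (∈⇒≺ˣ x∈y)))
    S◁S {x} {y} x∈y | tri< lt _ _ with separated (∈⇒≺ˣ x∈y) (e x)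
    ... | inj₂ s = S◁′ (⊆-trans s (⊆-trans (p-mono y (ℕ.≤⇒≤′ (ℕ.<⇒≤ lt))) p⊆K))
    ... | inj₁ same = S◁ (⊆-trans
        (subst (λ r → K (b (e x)) (p x (e x)) ⊆ r) (sym (trans (cong proj₁ (right ¬l)) (cong (H _ ∘ proj₁) (sym same)))) K⊆H)
        (⊆-trans (p-mono y (ℕ.≤⇒≤′ lt)) p⊆K))
      where
      ¬l : ¬ Left y (e x)
      ¬l (w , ew , y≺w) = ≺ˣ-irrefl x (≺ˣ-trans (∈⇒≺ˣ x∈y) (subst (y ≺ˣ_) (e-injective ew) y≺w))
    S◁S {x} {y} x∈y | tri> _ _ gt with separated (∈⇒≺ˣ x∈y) (e y)
    ... | inj₂ s = S◁′ (⊆-trans (q-mono x (ℕ.≤⇒≤′ (ℕ.<⇒≤ gt))) (⊆-trans s p⊆K))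
    ... | inj₁ same = S◁′ (⊆-trans (q-mono x (ℕ.≤⇒≤′ gt))
        (subst (q x (suc (e y)) ⊆_) (trans (cong proj₂ (left (y , refl , ∈⇒≺ˣ x∈y))) (cong (K _ ∘ proj₁) same)) λ u m → m))

  open Embedding em kp _∈ˣ_ (λ x m → ≺ˣ-irrefl x (∈⇒≺ˣ m)) e e-injective

  embedding : X → A
  embedding = v S κ∈S S◁S

  embedding-injective : ∀ {x y} → embedding x ≡ embedding y → x ≡ y
  embedding-injective = v-injective S κ∈S S◁S

  embedding-∈ : ∀ x y → x ∈ˣ y ⇔ embedding x ∈ embedding y
  embedding-∈ x y = mk⇔ (v-mono S κ∈S S◁S) (v-cancel S κ∈S S◁S)

-- Embedding between well-founded models of infinite rank

-- H c p depends on c only through its rank, and increases with it.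
module WellFoundedLevels (em : ∀ {ℓ} → ExcludedMiddle ℓ) {M : Structure} (kp : IsModelOfKP M)
  (wf : WellFounded (Structure._∈_ M)) where

  open Structure M renaming (Carrier to A)
  open Levels kp
  open TreeOrder em
  open Rank

  rk : A → Tree
  rk = rank wf

  -- Some y′ ∈ y has rank at least that of x. If it is larger, recur below y′; if it is equal, `H x`
  -- and `H y′` coincide. The bound `o` is the measure of the mutual recursion and shrinks here,
  -- while `K-≃ᵗ` preserves it.
  HH-<ᵗ : ∀ o {x y p z} → rk x <ᵗ rk y → rk y ≤ᵗ o → z ≡ H x (H x p) ⊎ z ∈ H x (H x p) → z ∈ K y p
  K-≃ᵗ : ∀ o {x y p} → rk x ≃ᵗ rk y → rk y ≤ᵗ o → K x p ≡ K y p

  HH-<ᵗ (sup _ f) {x} {y} {p} {z} x<y y≤o z∈ with rank-below wf y x<y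
  ... | y′ , y′∈y , x≤y′ with <-≤ᵗ-trans (rank-mono wf y′∈y) y≤o | ≤ᵗ-total (rk y′) (rk x)
  ... | i , y′≤fi | inj₂ x<y′ = K⊆K y′∈y z (HH-<ᵗ (f i) x<y′ y′≤fi z∈)
  ... | i , y′≤fi | inj₁ y′≤x = into (subst (λ h → z ≡ h ⊎ z ∈ h) hh≡ z∈)
    where
    H≡ : ∀ {r} → H x r ≡ H y′ r
    H≡ = H-cong (K-≃ᵗ (f i) (x≤y′ , y′≤x) y′≤fi)
    hh≡ : H x (H x p) ≡ H y′ (H y′ p)
    hh≡ = trans H≡ (cong (H y′) H≡)
    into : z ≡ H y′ (H y′ p) ⊎ z ∈ H y′ (H y′ p) → z ∈ K y p
    into (inj₁ refl) = HH∈K y′∈y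
    into (inj₂ m) = HH⊆K y′∈y z m

  K-≃ᵗ o {x} {y} {p} (x≤y , y≤x) y≤o = ext (sub x≤y y≤o) (sub y≤x (≤ᵗ-trans x≤y y≤o))
    where
    sub : ∀ {x y} → rk x ≤ᵗ rk y → rk y ≤ᵗ o → K x p ⊆ K y p
    sub x≤y y≤o z m with ∈-K m
    ... | inj₁ refl = p∈K
    ... | inj₂ (inj₁ m′) = p⊆K z m′
    ... | inj₂ (inj₂ (x′ , x′∈x , z∈)) = HH-<ᵗ o (<-≤ᵗ-trans (rank-mono wf x′∈x) x≤y) y≤o z∈

  HH⊆K-<ᵗ : ∀ {x y p} → rk x <ᵗ rk y → H x (H x p) ⊆ K y p
  HH⊆K-<ᵗ {y = y} x<y z m = HH-<ᵗ (rk y) x<y (≤ᵗ-refl _) (inj₂ m)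

module _ {M N : Structure} (kpM : IsModelOfKP M) (kpN : IsModelOfKP N)
  (wfM : WellFounded (Structure._∈_ M)) (wfN : WellFounded (Structure._∈_ N)) where

  private
    module M = Levels kpM
    module N = Levels kpN
  open Rank

  deep-transfer : ∀ n {x y} → M.Deep n x → rank wfM x ≤ᵗ rank wfN y → N.Deep n y
  deep-transfer zero _ _ = tt
  deep-transfer (suc n) {y = y} (x′ , x′∈x , d) x≤y
    with rank-below wfN y (<-≤ᵗ-trans (rank-mono wfM x′∈x) x≤y)
  ... | y′ , y′∈y , x′≤y′ = y′ , y′∈y , deep-transfer n d x′≤y′

module Transfinite (em : ∀ {ℓ} → ExcludedMiddle ℓ) {M : Structure} (kp : IsModelOfKP M)
  (wf : WellFounded (Structure._∈_ M))
  (w : Structure.Carrier M) (w-deep : ∀ n → Levels.Deep kp n w)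
  {X : Set} (_∈ˣ_ : Rel X 0ℓ) (e : X → ℕ) (e-injective : ∀ {x y} → e x ≡ e y → x ≡ y)
  (r : X → Structure.Carrier M) (r-mono : ∀ {x y} → x ∈ˣ y → Rank.rank wf (r x) <ᵗ Rank.rank wf (r y)) where

  open Structure M renaming (Carrier to A)
  open Levels kp
  open WellFoundedLevels em kp wf using (HH⊆K-<ᵗ)

  private
    -- The sets `r x` are comparable only by rank. Applying H turns this into genuine membership of
    -- the indices, and the start `w` makes all of them infinitely deep.
    c S : X → A
    c x = H (r x) w
    S x = K (c x) (adjoin ∅ ∅)

    c∈c : ∀ {x y} → x ∈ˣ y → c x ∈ c y
    c∈c x∈y = K⊆H _ (HH⊆K-<ᵗ (r-mono x∈y) _ (K⊆H _ p∈K))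

    deep-c : ∀ x n → Deep n (c x)
    deep-c x zero = tt
    deep-c x (suc n) = w , K⊆H _ p∈K , w-deep n

    κ∈S : ∀ x n → κ n ∈ S x
    κ∈S x = κ∈K (deep-c x) adjoin-ʳ

    S◁S : ∀ {x y} → x ∈ˣ y → S x ◁ S y
    S◁S {x} x∈y = ◁-intro (deep-c x) λ z m → HH⊆K (c∈c x∈y) z (K⊆H z m)

  open Embedding em kp _∈ˣ_ (λ x m → <ᵗ-irrefl (r-mono m)) e e-injective

  embedding : X → A
  embedding = v S κ∈S S◁S

  embedding-injective : ∀ {x y} → embedding x ≡ embedding y → x ≡ y
  embedding-injective = v-injective S κ∈S S◁S

  embedding-∈ : ∀ x y → x ∈ˣ y ⇔ embedding x ∈ embedding y
  embedding-∈ x y = mk⇔ (v-mono S κ∈S S◁S) (v-cancel S κ∈S S◁S)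

-- Models all of whose sets are hereditarily finite

module HereditarilyFinite (em : ∀ {ℓ} → ExcludedMiddle ℓ) {M N : Structure}
  (kpM : IsModelOfKP M) (kpN : IsModelOfKP N)
  (shallow : ∀ x → ∃[ n ] ¬ Levels.Deep kpM n x) where

  open Structure M renaming (Carrier to A)
  open Structure N renaming (Carrier to B; _∈_ to _∈ᴺ_)
  open Levels kpM using (Deep; ext)
  module N = Levels kpN

  private
    -- Each entry of L is either moved into P or dropped; once L is exhausted, extensionality leaves
    -- at most one candidate.
    subsets : (L : List A) (P : A → Set) → ∃[ L′ ] ∀ x →
      (∀ y → y ∈ x → P y ⊎ y ∈ₗ L) → (∀ y → P y → y ∈ x) → x ∈ₗ L′
    subsets [] P with em {P = ∃[ x ] ∀ y → (y ∈ x → P y) × (P y → y ∈ x)}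
    ... | no ¬∃ = [] , λ x h h′ → ⊥-elim (¬∃ (x , λ y → (λ m → [ id , (λ ()) ]′ (h y m)) , h′ y))
    ... | yes (x₀ , s) = x₀ ∷ [] , λ x h h′ →
      here (ext (λ y m → proj₂ (s y) ([ id , (λ ()) ]′ (h y m))) (λ y m → h′ y (proj₁ (s y) m)))
    subsets (l ∷ L) P with subsets L (λ y → P y ⊎ y ≡ l) | subsets L P
    ... | L₁ , s₁ | L₂ , s₂ = L₁ ++ L₂ , all
      where
      all : ∀ x → (∀ y → y ∈ x → P y ⊎ y ∈ₗ l ∷ L) → (∀ y → P y → y ∈ x) → x ∈ₗ L₁ ++ L₂
      all x h h′ with em {P = l ∈ x}
      ... | yes l∈x = ∈-++⁺ˡ (s₁ x (λ y m → old (h y m)) λ { y (inj₁ py) → h′ y py ; y (inj₂ refl) → l∈x })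
        where
        old : ∀ {y} → P y ⊎ y ∈ₗ l ∷ L → (P y ⊎ y ≡ l) ⊎ y ∈ₗ L
        old (inj₁ py) = inj₁ (inj₁ py)
        old (inj₂ (here q)) = inj₁ (inj₂ q)
        old (inj₂ (there m)) = inj₂ m
      ... | no l∉x = ∈-++⁺ʳ L₁ (s₂ x (λ y m → old m (h y m)) h′)
        where
        old : ∀ {y} → y ∈ x → P y ⊎ y ∈ₗ l ∷ L → P y ⊎ y ∈ₗ L
        old _ (inj₁ py) = inj₁ py
        old m (inj₂ (here refl)) = ⊥-elim (l∉x m)
        old _ (inj₂ (there m)) = inj₂ m

    shallows : ∀ n → ∃[ L ] ∀ x → ¬ Deep n x → x ∈ₗ L
    shallows zero = [] , λ x ¬d → ⊥-elim (¬d tt)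
    shallows (suc n) with shallows n
    ... | L , s with subsets L (λ _ → ⊥)
    ... | L′ , s′ = L′ , λ x ¬d → s′ x (λ y y∈x → inj₂ (s y λ d → ¬d (y , y∈x , d))) λ _ ()

    members : (L : List A) (x : A) → ∃[ L′ ] ∀ y → y ∈ₗ L′ ⇔ (y ∈ x × y ∈ₗ L)
    members [] x = [] , λ y → mk⇔ (λ ()) λ ()
    members (l ∷ L) x with members L x | em {P = l ∈ x}
    ... | L′ , s | yes l∈x = l ∷ L′ , λ y → mk⇔
      (λ { (here refl) → l∈x , here refl ; (there m) → let (p , q) = Equivalence.to (s y) m in p , there q })
      λ { (_ , here refl) → here refl ; (p , there q) → there (Equivalence.from (s y) (p , q)) }
    ... | L′ , s | no l∉x = L′ , λ y → mk⇔
      (λ m → let (p , q) = Equivalence.to (s y) m in p , there q)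
      λ { (p , here refl) → ⊥-elim (l∉x p) ; (p , there q) → Equivalence.from (s y) (p , q) }

    elements : ∀ x → ∃[ L ] ∀ y → y ∈ₗ L ⇔ y ∈ x
    elements x with shallow x
    ... | zero , ¬d = ⊥-elim (¬d tt)
    ... | suc n , ¬d with shallows n
    ... | L , s with members L x
    ... | L′ , s′ = L′ , λ y → mk⇔ (λ m → proj₁ (Equivalence.to (s′ y) m))
      λ m → Equivalence.from (s′ y) (m , s y λ d → ¬d (y , m , d))

    setOf : List B → B
    setOf = foldr (λ b s → N.adjoin s b) N.∅

    ∈-setOf : ∀ {z} L → z ∈ᴺ setOf L → z ∈ₗ L
    ∈-setOf [] m = ⊥-elim (N.∉∅ m)
    ∈-setOf (b ∷ L) m with N.∈-adjoin m
    ... | inj₁ m′ = there (∈-setOf L m′)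
    ... | inj₂ q = here q

    setOf-∈ : ∀ {z} L → z ∈ₗ L → z ∈ᴺ setOf L
    setOf-∈ (b ∷ L) (here refl) = N.adjoin-ʳ
    setOf-∈ (b ∷ L) (there m) = N.adjoin-ˡ (setOf-∈ L m)

    -- The number is fuel; by `stage-irrelevant` its amount does not matter once it exceeds the
    -- depth.
    stage : ℕ → A → B
    stage zero x = N.∅
    stage (suc n) x = setOf (map (stage n) (proj₁ (elements x)))

    stage-∈ : ∀ n {x y} → y ∈ x → stage n y ∈ᴺ stage (suc n) x
    stage-∈ n {x} m = setOf-∈ _ (∈-map⁺ (stage n) (Equivalence.from (proj₂ (elements x) _) m))

    ∈-stage : ∀ n {x z} → z ∈ᴺ stage (suc n) x → ∃[ y ] y ∈ x × z ≡ stage n y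
    ∈-stage n {x} m with ∈-map⁻ (stage n) (∈-setOf _ m)
    ... | y , y∈ , q = y , Equivalence.to (proj₂ (elements x) y) y∈ , q

    stage-irrelevant : ∀ m n {x} → ¬ Deep m x → ¬ Deep n x → stage m x ≡ stage n x
    stage-irrelevant zero n d _ = ⊥-elim (d tt)
    stage-irrelevant (suc m) zero _ d = ⊥-elim (d tt)
    stage-irrelevant (suc m) (suc n) {x} d d′ = N.ext half λ z z∈ → other (∈-stage n z∈)
      where
      same : ∀ {y} → y ∈ x → stage m y ≡ stage n y
      same {y} m∈ = stage-irrelevant m n (λ e → d (y , m∈ , e)) λ e → d′ (y , m∈ , e)
      half : stage (suc m) x N.⊆ stage (suc n) x
      half z z∈ with ∈-stage m z∈
      ... | y , y∈x , refl = subst (_∈ᴺ stage (suc n) x) (sym (same y∈x)) (stage-∈ n y∈x)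
      other : ∀ {z} → ∃[ y ] y ∈ x × z ≡ stage n y → z ∈ᴺ stage (suc m) x
      other (y , y∈x , refl) = subst (_∈ᴺ stage (suc m) x) (same y∈x) (stage-∈ m y∈x)

  embedding : A → B
  embedding x = stage (proj₁ (shallow x)) x

  private
    unfold : ∀ x → ∃[ n ] embedding x ≡ stage (suc n) x × (∀ {y} → y ∈ x → stage n y ≡ embedding y)
    unfold x = go (proj₁ (shallow x)) (proj₂ (shallow x))
      where
      go : ∀ k → ¬ Deep k x → ∃[ n ] stage k x ≡ stage (suc n) x × (∀ {y} → y ∈ x → stage n y ≡ embedding y)
      go zero ¬d = ⊥-elim (¬d tt)
      go (suc n) ¬d = n , refl , λ {y} m →
        stage-irrelevant n (proj₁ (shallow y)) (λ d → ¬d (y , m , d)) (proj₂ (shallow y))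

  embedding-mono : ∀ {x y} → x ∈ y → embedding x ∈ᴺ embedding y
  embedding-mono {x} {y} m with unfold y
  ... | n , q , h = subst (embedding x ∈ᴺ_) (sym q) (subst (_∈ᴺ stage (suc n) y) (h m) (stage-∈ n m))

  ∈-embedding : ∀ {z y} → z ∈ᴺ embedding y → ∃[ x ] x ∈ y × z ≡ embedding x
  ∈-embedding {z} {y} m with unfold y
  ... | n , q , h with ∈-stage n (subst (z ∈ᴺ_) q m)
  ... | x , x∈y , refl = x , x∈y , h x∈y

  embedding-injective : ∀ {x y} → embedding x ≡ embedding y → x ≡ y
  embedding-injective {x} {y} = go _ (proj₂ (shallow x)) (proj₂ (shallow y))
    where
    go : ∀ n {m x y} → ¬ Deep n x → ¬ Deep m y → embedding x ≡ embedding y → x ≡ y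
    go zero d _ _ = ⊥-elim (d tt)
    go (suc n) {zero} _ d _ = ⊥-elim (d tt)
    go (suc n) {suc m} {x} {y} d d′ q = ext to from
      where
      to : ∀ z → z ∈ x → z ∈ y
      to z z∈x with ∈-embedding (subst (embedding z ∈ᴺ_) q (embedding-mono z∈x))
      ... | w , w∈y , q′ = subst (_∈ y) (sym (go n (λ e → d (z , z∈x , e)) (λ e → d′ (w , w∈y , e)) q′)) w∈y
      from : ∀ z → z ∈ y → z ∈ x
      from z z∈y with ∈-embedding (subst (embedding z ∈ᴺ_) (sym q) (embedding-mono z∈y))
      ... | w , w∈x , q′ = subst (_∈ x) (go n (λ e → d (w , w∈x , e)) (λ e → d′ (z , z∈y , e)) (sym q′)) w∈x

  embedding-∈ : ∀ x y → x ∈ y ⇔ embedding x ∈ᴺ embedding y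
  embedding-∈ x y = mk⇔ embedding-mono λ m → cancel (∈-embedding m)
    where
    cancel : ∃[ w ] w ∈ y × embedding x ≡ embedding w → x ∈ y
    cancel (w , w∈y , q) = subst (_∈ y) (sym (embedding-injective q)) w∈y

-- Comparison of models by height

WF : CountableModel → Set
WF M = WellFounded (CountableModel._∈_ M)

code : (M : CountableModel) → CountableModel.Carrier M → ℕ
code M = Injection.to (CountableModel.countable M)

code-injective : (M : CountableModel) → ∀ {x y} → code M x ≡ code M y → x ≡ y
code-injective M = Injection.injective (CountableModel.countable M)

height : (M : CountableModel) → WF M → Tree
height M wf = sup (CountableModel.Carrier M) (Rank.rank wf)

≲-refl : ∀ {M} → M ≲ M
≲-refl = record { embed = id ; injective = id ; ∈⇔∈ = λ x y → mk⇔ id id }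

≲-trans : ∀ {M N P} → M ≲ N → N ≲ P → M ≲ P
≲-trans f g = record
  { embed = g.embed ∘ f.embed
  ; injective = f.injective ∘ g.injective
  ; ∈⇔∈ = λ x y → mk⇔
      (Equivalence.to (g.∈⇔∈ _ _) ∘ Equivalence.to (f.∈⇔∈ x y))
      (Equivalence.from (f.∈⇔∈ x y) ∘ Equivalence.from (g.∈⇔∈ _ _))
  }
  where
  module f = _≲_ f
  module g = _≲_ g

module _ {M N : CountableModel} (f : M ≲ N) where
  open _≲_ f

  ≲-WF : WF N → WF M
  ≲-WF wf x = go (wf (embed x))
    where
    go : ∀ {x} → Acc (CountableModel._∈_ N) (embed x) → Acc (CountableModel._∈_ M) x
    go {x} (acc rs) = acc λ {y} y∈x → go (rs (Equivalence.to (∈⇔∈ y x) y∈x))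

  ≲-height : (wfM : WF M) (wfN : WF N) → height M wfM ≤ᵗ height N wfN
  ≲-height wfM wfN x = embed x , go (wfM x)
    where
    go : ∀ {x} → Acc (CountableModel._∈_ M) x → Rank.rank wfM x ≤ᵗ Rank.rank wfN (embed x)
    go {x} (acc rs) = Rank.rank-least wfM x λ {y} y∈x →
      ≤-<ᵗ-trans (go (rs y∈x)) (Rank.rank-mono wfN (Equivalence.to (∈⇔∈ y x) y∈x))

module Comparison (em : ∀ {ℓ} → ExcludedMiddle ℓ) where
  open Classical em
  open TreeOrder em
  open CountableModel using (structure; isModelOfKP; Carrier; countable)
  open Rank

  ill-founded-≲ : ∀ M {N} → ¬ WF N → M ≲ N
  ill-founded-≲ M {N} ¬wf = record
    { embed = embedding ; injective = embedding-injective ; ∈⇔∈ = embedding-∈ }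
    where
    descending = ill-founded⇒descending ¬wf
    open Precedence (isModelOfKP M)
    open IllFounded em (isModelOfKP N) (proj₁ descending) (proj₂ descending)
      (CountableModel._∈_ M) _≺_ ∈⇒≺ (λ {x} {y} {z} → ≺-trans {x} {y} {z}) ≺-irrefl (code M) (code-injective M)

  height-≲ : ∀ {M N} (wfM : WF M) (wfN : WF N) → height M wfM ≤ᵗ height N wfN → M ≲ N
  height-≲ {M} {N} wfM wfN h with em {P = ∃[ w ] ∀ n → Levels.Deep (isModelOfKP N) n w}
  ... | yes (w , deep) = record
    { embed = embedding ; injective = embedding-injective ; ∈⇔∈ = embedding-∈ }
    where
    same : ∀ x → ∃[ y ] rank wfN y ≃ᵗ rank wfM x
    same x = rank-attains wfN em (proj₁ (h x)) (proj₂ (h x))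
    same-mono : ∀ {x y} → CountableModel._∈_ M x y → rank wfN (proj₁ (same x)) <ᵗ rank wfN (proj₁ (same y))
    same-mono {x} {y} m = ≤-<ᵗ-trans (proj₁ (proj₂ (same x))) (<-≤ᵗ-trans (rank-mono wfM m) (proj₂ (proj₂ (same y))))
    open Transfinite em (isModelOfKP N) wfN w deep (CountableModel._∈_ M) (code M) (code-injective M)
      (proj₁ ∘ same) same-mono
  -- The rank of each set of M is bounded by that of a set of N, hence finite.
  ... | no ¬deep = record
    { embed = embedding ; injective = embedding-injective ; ∈⇔∈ = embedding-∈ }
    where
    shallow : ∀ x → ∃[ n ] ¬ Levels.Deep (isModelOfKP M) n x
    shallow x with ¬∀⟶∃¬ (λ all → ¬deep (proj₁ (h x) , all))
    ... | n , ¬d = n , λ d → ¬d (deep-transfer (isModelOfKP M) (isModelOfKP N) wfM wfN n d (proj₂ (h x)))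
    open HereditarilyFinite em (isModelOfKP M) (isModelOfKP N) shallow

  ≲-total : ∀ M N → M ≲ N ⊎ N ≲ M
  ≲-total M N with em {P = WF M} | em {P = WF N}
  ... | no ¬wf | _ = inj₂ (ill-founded-≲ N ¬wf)
  ... | yes _ | no ¬wf = inj₁ (ill-founded-≲ M ¬wf)
  ... | yes wfM | yes wfN with ≤ᵗ-total (height M wfM) (height N wfN)
  ... | inj₁ p = inj₁ (height-≲ wfM wfN p)
  ... | inj₂ p = inj₂ (height-≲ wfN wfM (<ᵗ⇒≤ᵗ p))

  ≲-isTotalOrder : IsTotalOrder _≋_ _≲_
  ≲-isTotalOrder = record
    { isPartialOrder = record
      { isPreorder = record
        { isEquivalence = record
          { refl = ≲-refl ,, ≲-refl
          ; sym = λ (p ,, q) → q ,, p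
          ; trans = λ (p ,, q) (p′ ,, q′) → ≲-trans p p′ ,, ≲-trans q′ q
          }
        ; reflexive = lhs≤rhs
        ; trans = ≲-trans
        }
      ; antisym = _,,_
      }
    ; total = ≲-total
    }

  ⋦-height : ∀ {M N} (wfM : WF M) (wfN : WF N) → M ⋦ N → height M wfM <ᵗ height N wfN
  ⋦-height {M} {N} wfM wfN (M≲N , M≄N) with <ᵗ⊎≥ᵗ (height M wfM) (height N wfN)
  ... | inj₁ p = p
  ... | inj₂ p = ⊥-elim (M≄N (M≲N ,, height-≲ wfN wfM p))

  WF⇒acc : ∀ {N} (wfN : WF N) → Acc _<ᵗ_ (height N wfN) → Acc _⋦_ N
  WF⇒acc wfN (acc rs) = acc λ M⋦N →
    let wfM = ≲-WF (proj₁ M⋦N) wfN in WF⇒acc wfM (rs (⋦-height wfM wfN M⋦N))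

  -- All ill-founded models are bi-embeddable, so whatever lies strictly below a model is
  -- well-founded, and from there on heights decrease.
  ⋦-wellFounded : WellFounded _⋦_
  ⋦-wellFounded N = acc below
    where
    below : ∀ {M} → M ⋦ N → Acc _⋦_ M
    below {M} (M≲N , M≄N) with em {P = WF M} | em {P = WF N}
    ... | yes wfM | _ = WF⇒acc wfM (<ᵗ-wellFounded (height M wfM))
    ... | no ¬wfM | yes wfN = ⊥-elim (¬wfM (≲-WF M≲N wfN))
    ... | no ¬wfM | no _ = ⊥-elim (M≄N (M≲N ,, ill-founded-≲ N ¬wfM))

-- Order types of countable well-orders

module OrderTypes (em : ∀ {ℓ} → ExcludedMiddle ℓ) where
  open TreeOrder em
  open Rank
  open CountableWellOrder using (Carrier; wellFounded)

  orderRank : (α : CountableWellOrder) → Carrier α → Tree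
  orderRank α = rank (wellFounded α)

  orderType : CountableWellOrder → Tree
  orderType α = sup (Carrier α) (orderRank α)

  module _ (α : CountableWellOrder) where
    open CountableWellOrder α using (_<_; isStrictTotalOrder)
    open IsStrictTotalOrder isStrictTotalOrder using (compare)

    orderRank-cancel : ∀ {x y} → orderRank α x <ᵗ orderRank α y → x < y
    orderRank-cancel {x} {y} p with compare x y
    ... | tri< q _ _ = q
    ... | tri≈ _ refl _ = ⊥-elim (<ᵗ-irrefl p)
    ... | tri> _ _ q = ⊥-elim (<ᵗ-irrefl (<ᵗ-trans p (rank-mono (wellFounded α) q)))

    orderRank-injective : ∀ {x y} → orderRank α x ≃ᵗ orderRank α y → x ≡ y
    orderRank-injective {x} {y} (p , p′) with compare x y
    ... | tri≈ _ q _ = q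
    ... | tri< q _ _ = ⊥-elim (<ᵗ-irrefl (<-≤ᵗ-trans (rank-mono (wellFounded α) q) p′))
    ... | tri> _ _ q = ⊥-elim (<ᵗ-irrefl (<-≤ᵗ-trans (rank-mono (wellFounded α) q) p))

  module _ {α β : CountableWellOrder} where
    private
      module α = CountableWellOrder α
      module β = CountableWellOrder β

    orderRank-mono : (f : α.Carrier → β.Carrier) → (∀ {x y} → x α.< y → f x β.< f y) →
      ∀ x → orderRank α x ≤ᵗ orderRank β (f x)
    orderRank-mono f f-mono x = go (α.wellFounded x)
      where
      go : ∀ {x} → Acc α._<_ x → orderRank α x ≤ᵗ orderRank β (f x)
      go {x} (acc rs) = rank-least α.wellFounded x λ y<x →
        ≤-<ᵗ-trans (go (rs y<x)) (rank-mono β.wellFounded (f-mono y<x))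

    ≤⇒orderType : α ≤ β → orderType α ≤ᵗ orderType β
    ≤⇒orderType f x = embed x , orderRank-mono embed monotone x
      where open _≤_ f

    ≅⇒orderType : α ≅ β → orderType α ≃ᵗ orderType β
    ≅⇒orderType (f , iso) = (λ x → f x , orderRank-mono f mono x) , back
      where
      open IsOrderIsomorphism iso
      go : ∀ {x} → Acc α._<_ x → orderRank β (f x) ≤ᵗ orderRank α x
      go {x} (acc rs) = rank-least β.wellFounded (f x) λ {b} b<fx → step b<fx (surjective b)
        where
        step : ∀ {b} → b β.< f x → ∃[ y ] (∀ {z} → z ≡ y → f z ≡ b) → orderRank β b <ᵗ orderRank α x
        step b<fx (y , h) with h refl
        ... | refl = ≤-<ᵗ-trans (go (rs (cancel b<fx))) (rank-mono α.wellFounded (cancel b<fx))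
      back : orderType β ≤ᵗ orderType α
      back b with surjective b
      ... | x , h with h refl
      ... | refl = x , go (α.wellFounded x)

    module _ (p : orderType α ≤ᵗ orderType β) where

      private
        same : ∀ x → ∃[ y ] orderRank β y ≃ᵗ orderRank α x
        same x = rank-attains β.wellFounded em (proj₁ (p x)) (proj₂ (p x))

      match : α.Carrier → β.Carrier
      match x = proj₁ (same x)

      match-≃ᵗ : ∀ x → orderRank β (match x) ≃ᵗ orderRank α x
      match-≃ᵗ x = proj₂ (same x)

      match-mono : ∀ {x y} → x α.< y → match x β.< match y
      match-mono {x} {y} x<y = orderRank-cancel β
        (≤-<ᵗ-trans (proj₁ (match-≃ᵗ x)) (<-≤ᵗ-trans (rank-mono α.wellFounded x<y) (proj₂ (match-≃ᵗ y))))

      match-≡ : ∀ {x b} → orderRank α x ≃ᵗ orderRank β b → match x ≡ b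
      match-≡ q = orderRank-injective β (≃ᵗ-trans (match-≃ᵗ _) q)

      orderType⇒≤ : α ≤ β
      orderType⇒≤ = record { embed = match ; monotone = match-mono ; initialSegment = initial }
        where
        initial : ∀ x {b} → b β.< match x → ∃[ a ] match a ≡ b
        initial x {b} b< with rank-attains α.wellFounded em x
          (≤ᵗ-trans (<ᵗ⇒≤ᵗ (rank-mono β.wellFounded b<)) (proj₁ (match-≃ᵗ x)))
        ... | a , q = a , match-≡ q

    orderType⇒≅ : orderType α ≃ᵗ orderType β → α ≅ β
    orderType⇒≅ (p , p′) = match p , record
      { isOrderMonomorphism = record
        { isOrderHomomorphism = record { cong = cong (match p) ; mono = match-mono p }
        ; injective = λ {x} {y} q → orderRank-injective α
            (≃ᵗ-trans (≃ᵗ-sym (match-≃ᵗ p x)) (subst (λ b → orderRank β b ≃ᵗ orderRank α y) (sym q) (match-≃ᵗ p y)))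
        ; cancel = λ {x} {y} q → orderRank-cancel α
            (≤-<ᵗ-trans (proj₂ (match-≃ᵗ p x)) (<-≤ᵗ-trans (rank-mono β.wellFounded q) (proj₁ (match-≃ᵗ p y))))
        }
      ; surjective = λ b → let (a , q) = rank-attains α.wellFounded em (proj₁ (p′ b)) (proj₂ (p′ b))
                           in a , λ { refl → match-≡ p q }
      }

-- The order of heights below a model

-- The ordinal assigned to M is the order type of the set of heights below that of M.  It is realized on those
-- x in M whose rank is the height of some model and which have the least number among the elements of that rank.
module HeightOrder (em : ∀ {ℓ} → ExcludedMiddle ℓ) where
  open Classical em
  open TreeOrder em
  open OrderTypes em
  open Rank
  open CountableModel using (Carrier)

  module _ (M : CountableModel) (wf : WF M) where

    IsHeight : Tree → Set₁
    IsHeight v = ∃[ N ] Σ (WF N) λ wfN → v ≃ᵗ height N wfN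

    Marks : Carrier M → Set₁
    Marks x = (∀ y → rank wf y ≃ᵗ rank wf x → code M x ℕ.≤ code M y) × IsHeight (rank wf x)

    heightOrder : CountableWellOrder
    heightOrder = record
      { Carrier = Σ (Carrier M) λ x → ∥ Marks x ∥
      ; _<_ = λ (x , _) (y , _) → rank wf x <ᵗ rank wf y
      ; isStrictTotalOrder = record
        { isStrictPartialOrder = record
          { isEquivalence = isEquivalence
          ; irrefl = λ { refl → <ᵗ-irrefl }
          ; trans = <ᵗ-trans
          ; <-resp-≈ = (λ { refl p → p }) , λ { refl p → p }
          }
        ; compare = compare
        }
      ; wellFounded = λ (x , _) → go (<ᵗ-wellFounded (rank wf x))
      ; countable = record
        { to = code M ∘ proj₁
        ; cong = cong (code M ∘ proj₁)
        ; injective = λ q → squashed-≡ {P = Marks} (code-injective M q)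
        }
      }
      where
      compare : ∀ x y → _
      compare (x , p) (y , q) with ≤ᵗ-total (rank wf x) (rank wf y) | ≤ᵗ-total (rank wf y) (rank wf x)
      ... | inj₂ y<x | _ = tri> (λ x<y → <ᵗ-irrefl (<ᵗ-trans x<y y<x)) (λ { refl → <ᵗ-irrefl y<x }) y<x
      ... | inj₁ _ | inj₂ x<y = tri< x<y (λ { refl → <ᵗ-irrefl x<y }) (λ y<x → <ᵗ-irrefl (<ᵗ-trans x<y y<x))
      ... | inj₁ x≤y | inj₁ y≤x = tri≈ (λ x<y → <ᵗ-irrefl (<-≤ᵗ-trans x<y y≤x))
        (squashed-≡ (code-injective M (ℕ.≤-antisym (proj₁ (unsquash p) y (y≤x , x≤y)) (proj₁ (unsquash q) x (x≤y , y≤x)))))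
        (λ y<x → <ᵗ-irrefl (<-≤ᵗ-trans y<x x≤y))
      go : ∀ {x} → Acc _<ᵗ_ (rank wf (proj₁ x)) → Acc _ x
      go (acc rs) = acc λ y<x → go (rs y<x)

    markedRank : CountableWellOrder.Carrier heightOrder → Tree
    markedRank (x , _) = rank wf x

    marked : ∀ {v} x → v ≤ᵗ rank wf x → IsHeight v → ∃[ m ] markedRank m ≃ᵗ v
    marked {v} x v≤x (N , wfN , h) with rank-attains wf em x v≤x
    ... | y , y≃v with least-of (code M) (λ z → rank wf z ≃ᵗ v) (y , y≃v)
    ... | z , z≃v , min =
      (z , squash ((λ u u≃z → min u (≃ᵗ-trans u≃z z≃v)) , N , wfN , ≃ᵗ-trans z≃v h)) , z≃v

    marked-isHeight : ∀ m → IsHeight (markedRank m)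
    marked-isHeight (x , p) = proj₂ (unsquash p)

  module _ {M N : CountableModel} (wfM : WF M) (wfN : WF N) where
    private
      α = heightOrder M wfM
      β = heightOrder N wfN
      module α = CountableWellOrder α
      module β = CountableWellOrder β

    -- Being a height does not refer to the model in which the rank occurs, so marked ranks recur in
    -- every model that is high enough.
    transfer : ∀ {a} y → markedRank M wfM a ≤ᵗ rank wfN y →
      ∃[ b ] markedRank N wfN b ≃ᵗ markedRank M wfM a
    transfer {a} y p = marked N wfN y p (marked-isHeight M wfM a)

    orderRank-≤ᵗ : ∀ {a b} → markedRank M wfM a ≤ᵗ markedRank N wfN b → orderRank α a ≤ᵗ orderRank β b
    orderRank-≤ᵗ {a} = go (α.wellFounded a)
      where
      go : ∀ {a b} → Acc α._<_ a → markedRank M wfM a ≤ᵗ markedRank N wfN b → orderRank α a ≤ᵗ orderRank β b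
      go {a} {b} (acc rs) a≤b = rank-least α.wellFounded a λ {a′} a′<a →
        let (b′ , q) = transfer {a′} (proj₁ b) (≤ᵗ-trans (<ᵗ⇒≤ᵗ a′<a) a≤b)
        in ≤-<ᵗ-trans (go {a′} {b′} (rs {a′} a′<a) (proj₂ q))
             (rank-mono β.wellFounded {b′} {b} (≤-<ᵗ-trans (proj₁ q) (<-≤ᵗ-trans a′<a a≤b)))

    height⇒orderType : height M wfM ≤ᵗ height N wfN → orderType α ≤ᵗ orderType β
    height⇒orderType h a with h (proj₁ a)
    ... | y , a≤y with transfer {a} y a≤y
    ... | b , q = b , orderRank-≤ᵗ {a} {b} (proj₂ q)

  module _ {M N : CountableModel} (wfM : WF M) (wfN : WF N) where
    private
      α = heightOrder M wfM
      β = heightOrder N wfN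
      module α = CountableWellOrder α
      module β = CountableWellOrder β

    orderRank-≥ᵗ : ∀ {a} → height N wfN ≤ᵗ markedRank M wfM a → orderType β ≤ᵗ orderRank α a
    orderRank-≥ᵗ {a} h b = below (back (≤ᵗ-trans (<ᵗ⇒≤ᵗ b<) h))
      where
      b< : markedRank N wfN b <ᵗ height N wfN
      b< = proj₁ b , ≤ᵗ-refl _
      back : markedRank N wfN b ≤ᵗ rank wfM (proj₁ a) → ∃[ a′ ] markedRank M wfM a′ ≃ᵗ markedRank N wfN b
      back p = marked M wfM (proj₁ a) p (marked-isHeight N wfN b)
      below : ∃[ a′ ] markedRank M wfM a′ ≃ᵗ markedRank N wfN b → orderRank β b <ᵗ orderRank α a
      below (a′ , q) = ≤-<ᵗ-trans
        (orderRank-≤ᵗ wfN wfM {b} {a′} (proj₂ q)) (rank-mono α.wellFounded {a′} {a} (≤-<ᵗ-trans (proj₁ q) (<-≤ᵗ-trans b< h)))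

    -- The marked ranks below `height N` are the same in both models.
    orderRank-height : ∀ {a} → markedRank M wfM a ≃ᵗ height N wfN → orderRank α a ≃ᵗ orderType β
    orderRank-height {a} (p , p′) = rank-least α.wellFounded a below , orderRank-≥ᵗ {a} p′
      where
      below : ∀ {a′} → a′ α.< a → orderRank α a′ <ᵗ orderType β
      below {a′} a′<a with <-≤ᵗ-trans a′<a p
      ... | y , a′≤y with transfer {M} {N} wfM wfN {a′} y a′≤y
      ... | b , q = b , orderRank-≤ᵗ wfM wfN {a′} {b} (proj₂ q)

    -- If N were lower than M, its height would itself be marked in M and make the order type of M
    -- strictly larger.
    orderType⇒height : orderType α ≤ᵗ orderType β → height M wfM ≤ᵗ height N wfN
    orderType⇒height p with ≤ᵗ-total (height M wfM) (height N wfN)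
    ... | inj₁ q = q
    ... | inj₂ (x , q) with marked M wfM x q (N , wfN , ≃ᵗ-refl)
    ... | a , a≃ = ⊥-elim (<ᵗ-irrefl (<-≤ᵗ-trans (a , ≤ᵗ-refl _) (≤ᵗ-trans p (orderRank-≥ᵗ {a} (proj₂ a≃)))))

-- Trees as sets

infix 4 _≈_ _ε_

-- Bisimilarity, and membership up to it: Aczel's interpretation of sets as well-founded trees.
_≈_ _ε_ : Tree → Tree → Set
sup A f ≈ sup B g = (∀ a → ∃[ b ] f a ≈ g b) × (∀ b → ∃[ a ] f a ≈ g b)
u ε sup B g = ∃[ b ] u ≈ g b

≈-refl : ∀ {u} → u ≈ u
≈-refl {sup A f} = (λ a → a , ≈-refl) , λ a → a , ≈-refl

≈-sym : ∀ {u v} → u ≈ v → v ≈ u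
≈-sym {sup A f} {sup B g} (p , q) =
  (λ b → proj₁ (q b) , ≈-sym (proj₂ (q b))) , λ a → proj₁ (p a) , ≈-sym (proj₂ (p a))

≈-trans : ∀ {u v w} → u ≈ v → v ≈ w → u ≈ w
≈-trans {sup A f} {sup B g} {sup C h} (p , q) (p′ , q′) =
  (λ a → let (b , r) = p a ; (c , s) = p′ b in c , ≈-trans r s) ,
  λ c → let (b , s) = q′ c ; (a , r) = q b in a , ≈-trans r s

ε-respˡ : ∀ {u v w} → u ≈ v → u ε w → v ε w
ε-respˡ {w = sup C h} p (c , q) = c , ≈-trans (≈-sym p) q

ε-respʳ : ∀ {u v w} → v ≈ w → u ε v → u ε w
ε-respʳ {v = sup B g} {sup C h} (p , _) (b , q) = proj₁ (p b) , ≈-trans q (proj₂ (p b))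

ε-ext : ∀ {v w} → (∀ u → u ε v → u ε w) → (∀ u → u ε w → u ε v) → v ≈ w
ε-ext {sup B g} {sup C h} p q =
  (λ b → p (g b) (b , ≈-refl)) , λ c → let (b , r) = q (h c) (c , ≈-refl) in b , ≈-sym r

ε-wellFounded : WellFounded _ε_
ε-wellFounded u = go u ≈-refl
  where
  go : ∀ u {v} → v ≈ u → Acc _ε_ v
  go (sup A f) v≈u = acc λ w∈v → go _ (proj₂ (ε-respʳ v≈u w∈v))

infix 3 _⟦_⟧

_⟦_⟧ : ∀ {n} → Formula n → Vec Tree n → Set₁
x ∈̇ y ⟦ ρ ⟧ = Lift _ (lookup ρ x ε lookup ρ y)
x ≐ y ⟦ ρ ⟧ = Lift _ (lookup ρ x ≈ lookup ρ y)
⊥̇ ⟦ ρ ⟧ = Lift _ ⊥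
φ ∧̇ ψ ⟦ ρ ⟧ = (φ ⟦ ρ ⟧) × (ψ ⟦ ρ ⟧)
φ ∨̇ ψ ⟦ ρ ⟧ = (φ ⟦ ρ ⟧) ⊎ (ψ ⟦ ρ ⟧)
φ ⇒̇ ψ ⟦ ρ ⟧ = φ ⟦ ρ ⟧ → ψ ⟦ ρ ⟧
∀̇ φ ⟦ ρ ⟧ = ∀ a → φ ⟦ a ∷ ρ ⟧
∃̇ φ ⟦ ρ ⟧ = Σ Tree λ a → φ ⟦ a ∷ ρ ⟧

infix 4 _≈ᵛ_

record _≈ᵛ_ {n : ℕ} (ρ σ : Vec Tree n) : Set where
  constructor pointwise
  field at : ∀ i → lookup ρ i ≈ lookup σ i

open _≈ᵛ_

≈ᵛ-sym : ∀ {n} {ρ σ : Vec Tree n} → ρ ≈ᵛ σ → σ ≈ᵛ ρ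
≈ᵛ-sym e .at i = ≈-sym (at e i)

≈ᵛ-refl : ∀ {n} {ρ : Vec Tree n} → ρ ≈ᵛ ρ
≈ᵛ-refl .at i = ≈-refl

≈ᵛ-cons : ∀ {n u v} {ρ σ : Vec Tree n} → u ≈ v → ρ ≈ᵛ σ → u ∷ ρ ≈ᵛ v ∷ σ
≈ᵛ-cons p e .at zero = p
≈ᵛ-cons p e .at (suc i) = at e i

⟦⟧-resp : ∀ {n} (φ : Formula n) {ρ σ} → ρ ≈ᵛ σ → φ ⟦ ρ ⟧ → φ ⟦ σ ⟧
⟦⟧-resp (x ∈̇ y) e (lift p) = lift (ε-respˡ (at e x) (ε-respʳ (at e y) p))
⟦⟧-resp (x ≐ y) e (lift p) = lift (≈-trans (≈-sym (at e x)) (≈-trans p (at e y)))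
⟦⟧-resp (φ ∧̇ ψ) e (p , q) = ⟦⟧-resp φ e p , ⟦⟧-resp ψ e q
⟦⟧-resp (φ ∨̇ ψ) e (inj₁ p) = inj₁ (⟦⟧-resp φ e p)
⟦⟧-resp (φ ∨̇ ψ) e (inj₂ q) = inj₂ (⟦⟧-resp ψ e q)
⟦⟧-resp (φ ⇒̇ ψ) e f p = ⟦⟧-resp ψ e (f (⟦⟧-resp φ (≈ᵛ-sym e) p))
⟦⟧-resp (∀̇ φ) e f a = ⟦⟧-resp φ (≈ᵛ-cons ≈-refl e) (f a)
⟦⟧-resp (∃̇ φ) e (a , p) = a , ⟦⟧-resp φ (≈ᵛ-cons ≈-refl e) p

-- Skolem terms and their numbering

-- The operations under which the universe of trees is closed in order to obtain a submodel:
-- Skolem functions, separation, collection and the choices by which Łoś's theorem yields the schemes.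
data Operation : Set where
  witness separator collector counterexample choice minimal : Operation

formulaArity argumentArity : Operation → ℕ → ℕ
formulaArity witness n = suc n
formulaArity separator n = suc n
formulaArity collector n = suc (suc n)
formulaArity counterexample n = suc (suc n)
formulaArity choice n = suc (suc n)
formulaArity minimal n = suc n
argumentArity witness n = n
argumentArity separator n = suc n
argumentArity collector n = suc n
argumentArity counterexample n = suc n
argumentArity choice n = suc (suc n)
argumentArity minimal n = n

-- `counterexample` picks an element that spoils the hypothesis of collection, `minimal` an
-- ∈-minimal failure of φ: failures of the schemes are thus named by terms.
Specification : ∀ o n → Formula (formulaArity o n) → Vec Tree (argumentArity o n) → Tree → Set₁
Specification witness n φ ρ a = φ ⟦ a ∷ ρ ⟧
Specification separator n φ (b ∷ ρ) a = ∀ x → (x ε a → x ε b × (φ ⟦ x ∷ ρ ⟧)) × (x ε b → φ ⟦ x ∷ ρ ⟧ → x ε a)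
Specification collector n φ (b ∷ ρ) a = ∀ x → x ε b → Σ Tree λ y → y ε a × (φ ⟦ y ∷ x ∷ ρ ⟧)
Specification counterexample n φ (b ∷ ρ) a = a ε b × ¬ (Σ Tree λ y → φ ⟦ y ∷ a ∷ ρ ⟧)
Specification choice n φ (b ∷ x ∷ ρ) a = a ε b × (φ ⟦ a ∷ x ∷ ρ ⟧)
Specification minimal n φ ρ a = ¬ (φ ⟦ a ∷ ρ ⟧) × (∀ y → y ε a → φ ⟦ y ∷ ρ ⟧)

data Term : Set where
  generator : ℕ → Term
  operation : ∀ o n → Formula (formulaArity o n) → Vec Term (argumentArity o n) → Term

data Code : Set where
  leaf : ℕ → Code
  node : Code → Code → Code

module Coding where

  unary : ℕ → ℕᵇ → ℕᵇ
  unary zero k = 2[1+ k ]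
  unary (suc n) k = 1+[2 unary n k ]

  -- A prefix code
  bits : Code → ℕᵇ → ℕᵇ
  bits (leaf n) k = 2[1+ unary n k ]
  bits (node c d) k = 1+[2 bits c (bits d k) ]

  unary-injective : ∀ m n {k l} → unary m k ≡ unary n l → m ≡ n × k ≡ l
  unary-injective zero zero refl = refl , refl
  unary-injective (suc m) (suc n) e with unary-injective m n (ℕᵇ.1+[2_]-injective e)
  ... | refl , e′ = refl , e′

  bits-injective : ∀ c d {k l} → bits c k ≡ bits d l → c ≡ d × k ≡ l
  bits-injective (leaf m) (leaf n) e with unary-injective m n (ℕᵇ.2[1+_]-injective e)
  ... | refl , e′ = refl , e′
  bits-injective (node c c′) (node d d′) e with bits-injective c d (ℕᵇ.1+[2_]-injective e)
  ... | refl , e′ with bits-injective c′ d′ e′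
  ... | refl , e″ = refl , e″

  toNumber : Code → ℕ
  toNumber c = ℕᵇ.toℕ (bits c ℕᵇ.zero)

  toNumber-injective : ∀ {c d} → toNumber c ≡ toNumber d → c ≡ d
  toNumber-injective {c} {d} e = proj₁ (bits-injective c d (ℕᵇ.toℕ-injective e))

  decodeFin : ∀ n → ℕ → Maybe (Fin n)
  decodeFin zero _ = nothing
  decodeFin (suc n) zero = just zero
  decodeFin (suc n) (suc k) = Maybe.map suc (decodeFin n k)

  decodeFin-toℕ : ∀ {n} (i : Fin n) → decodeFin n (toℕ i) ≡ just i
  decodeFin-toℕ zero = refl
  decodeFin-toℕ (suc i) = cong (Maybe.map suc) (decodeFin-toℕ i)

  encodeFormula : ∀ {n} → Formula n → Code
  encodeFormula (x ∈̇ y) = node (leaf 0) (node (leaf (toℕ x)) (leaf (toℕ y)))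
  encodeFormula (x ≐ y) = node (leaf 1) (node (leaf (toℕ x)) (leaf (toℕ y)))
  encodeFormula ⊥̇ = leaf 0
  encodeFormula (φ ∧̇ ψ) = node (leaf 2) (node (encodeFormula φ) (encodeFormula ψ))
  encodeFormula (φ ∨̇ ψ) = node (leaf 3) (node (encodeFormula φ) (encodeFormula ψ))
  encodeFormula (φ ⇒̇ ψ) = node (leaf 4) (node (encodeFormula φ) (encodeFormula ψ))
  encodeFormula (∀̇ φ) = node (leaf 5) (encodeFormula φ)
  encodeFormula (∃̇ φ) = node (leaf 6) (encodeFormula φ)

  atom : ∀ {n} → (Fin n → Fin n → Formula n) → Maybe (Fin n) → Maybe (Fin n) → Formula n
  atom R (just x) (just y) = R x y
  atom R _ _ = ⊥̇

  decodeFormula : ∀ n → Code → Formula n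
  decodeFormula n (node (leaf 0) (node (leaf x) (leaf y))) = atom _∈̇_ (decodeFin n x) (decodeFin n y)
  decodeFormula n (node (leaf 1) (node (leaf x) (leaf y))) = atom _≐_ (decodeFin n x) (decodeFin n y)
  decodeFormula n (node (leaf 2) (node c d)) = decodeFormula n c ∧̇ decodeFormula n d
  decodeFormula n (node (leaf 3) (node c d)) = decodeFormula n c ∨̇ decodeFormula n d
  decodeFormula n (node (leaf 4) (node c d)) = decodeFormula n c ⇒̇ decodeFormula n d
  decodeFormula n (node (leaf 5) c) = ∀̇ (decodeFormula (suc n) c)
  decodeFormula n (node (leaf 6) c) = ∃̇ (decodeFormula (suc n) c)
  decodeFormula n _ = ⊥̇

  decode-encodeFormula : ∀ {n} (φ : Formula n) → decodeFormula n (encodeFormula φ) ≡ φ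
  decode-encodeFormula (x ∈̇ y) = cong₂ (atom _∈̇_) (decodeFin-toℕ x) (decodeFin-toℕ y)
  decode-encodeFormula (x ≐ y) = cong₂ (atom _≐_) (decodeFin-toℕ x) (decodeFin-toℕ y)
  decode-encodeFormula ⊥̇ = refl
  decode-encodeFormula (φ ∧̇ ψ) = cong₂ _∧̇_ (decode-encodeFormula φ) (decode-encodeFormula ψ)
  decode-encodeFormula (φ ∨̇ ψ) = cong₂ _∨̇_ (decode-encodeFormula φ) (decode-encodeFormula ψ)
  decode-encodeFormula (φ ⇒̇ ψ) = cong₂ _⇒̇_ (decode-encodeFormula φ) (decode-encodeFormula ψ)
  decode-encodeFormula (∀̇ φ) = cong ∀̇ (decode-encodeFormula φ)
  decode-encodeFormula (∃̇ φ) = cong ∃̇ (decode-encodeFormula φ)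

  encodeOperation : Operation → ℕ
  encodeOperation witness = 0
  encodeOperation separator = 1
  encodeOperation collector = 2
  encodeOperation counterexample = 3
  encodeOperation choice = 4
  encodeOperation minimal = 5

  decodeOperation : ℕ → Operation
  decodeOperation 0 = witness
  decodeOperation 1 = separator
  decodeOperation 2 = collector
  decodeOperation 3 = counterexample
  decodeOperation 4 = choice
  decodeOperation _ = minimal

  encodeTerm : Term → Code
  encodeTerms : ∀ {n} → Vec Term n → Code
  encodeTerm (generator k) = leaf k
  encodeTerm (operation o n φ ts) =
    node (leaf (encodeOperation o)) (node (leaf n) (node (encodeFormula φ) (encodeTerms ts)))
  encodeTerms [] = leaf 0
  encodeTerms (t ∷ ts) = node (encodeTerm t) (encodeTerms ts)

  decodeTerm : Code → Term
  decodeTerms : ∀ n → Code → Vec Term n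
  decodeTerm (node (leaf o) (node (leaf n) (node c d))) =
    operation (decodeOperation o) n (decodeFormula _ c) (decodeTerms _ d)
  decodeTerm (leaf k) = generator k
  decodeTerm _ = generator 0
  decodeTerms zero _ = []
  decodeTerms (suc n) (node c d) = decodeTerm c ∷ decodeTerms n d
  decodeTerms (suc n) _ = Vec.replicate (suc n) (generator 0)

  decode-encodeTerm : ∀ t → decodeTerm (encodeTerm t) ≡ t
  decode-encodeTerms : ∀ {n} (ts : Vec Term n) → decodeTerms n (encodeTerms ts) ≡ ts
  decode-encodeTerm (generator k) = refl
  decode-encodeTerm (operation witness n φ ts) = cong₂ (operation witness n) (decode-encodeFormula φ) (decode-encodeTerms ts)
  decode-encodeTerm (operation separator n φ ts) = cong₂ (operation separator n) (decode-encodeFormula φ) (decode-encodeTerms ts)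
  decode-encodeTerm (operation collector n φ ts) = cong₂ (operation collector n) (decode-encodeFormula φ) (decode-encodeTerms ts)
  decode-encodeTerm (operation counterexample n φ ts) = cong₂ (operation counterexample n) (decode-encodeFormula φ) (decode-encodeTerms ts)
  decode-encodeTerm (operation choice n φ ts) = cong₂ (operation choice n) (decode-encodeFormula φ) (decode-encodeTerms ts)
  decode-encodeTerm (operation minimal n φ ts) = cong₂ (operation minimal n) (decode-encodeFormula φ) (decode-encodeTerms ts)
  decode-encodeTerms [] = refl
  decode-encodeTerms (t ∷ ts) = cong₂ _∷_ (decode-encodeTerm t) (decode-encodeTerms ts)

  termNumber : Term → ℕ
  termNumber t = toNumber (encodeTerm t)

  termNumber-injective : ∀ {s t} → termNumber s ≡ termNumber t → s ≡ t
  termNumber-injective {s} {t} e =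
    trans (sym (decode-encodeTerm s)) (trans (cong decodeTerm (toNumber-injective {encodeTerm s} {encodeTerm t} e)) (decode-encodeTerm t))

  -- Indexes the countably many sets that the ultrafilter has to decide.
  Instance : Set
  Instance = ∃[ n ] Formula n × Vec Term n

  encodeInstance : Instance → Code
  encodeInstance (n , φ , ts) = node (leaf n) (node (encodeFormula φ) (encodeTerms ts))

  decodeInstance : Code → Instance
  decodeInstance (node (leaf n) (node c d)) = n , decodeFormula n c , decodeTerms n d
  decodeInstance _ = 0 , ⊥̇ , []

  decode-encodeInstance : ∀ p → decodeInstance (encodeInstance p) ≡ p
  decode-encodeInstance (n , φ , ts) = cong₂ (λ φ ts → n , φ , ts) (decode-encodeFormula φ) (decode-encodeTerms ts)

  instanceNumber : Instance → ℕ
  instanceNumber p = toNumber (encodeInstance p)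

  instanceNumber-injective : ∀ {p q} → instanceNumber p ≡ instanceNumber q → p ≡ q
  instanceNumber-injective {p} {q} e =
    trans (sym (decode-encodeInstance p)) (trans (cong decodeInstance (toNumber-injective {encodeInstance p} {encodeInstance q} e)) (decode-encodeInstance q))
open Coding

-- Truth of the axioms in the universe of trees

module Universe (em : ∀ {ℓ} → ExcludedMiddle ℓ) where
  open Classical em

  choose : (Tree → Set₁) → Tree
  choose P with em {P = Σ Tree P}
  ... | yes (a , _) = a
  ... | no _ = sup ⊥ λ ()

  choose-spec : (P : Tree → Set₁) → Σ Tree P → P (choose P)
  choose-spec P p with em {P = Σ Tree P}
  ... | yes (_ , q) = q
  ... | no ¬p = ⊥-elim (¬p p)

  pairingF : Formula 2
  pairingF = ∃̇ (∀̇ ((zero ∈̇ 1# ⇒̇ zero ≐ 2# ∨̇ zero ≐ 3#) ∧̇ (zero ≐ 2# ∨̇ zero ≐ 3# ⇒̇ zero ∈̇ 1#)))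

  pairing-valid : ∀ x y → pairingF ⟦ x ∷ y ∷ [] ⟧
  pairing-valid x y = sup Bool (λ { true → x ; false → y }) , λ z →
    (λ { (lift (true , p)) → inj₁ (lift p) ; (lift (false , p)) → inj₂ (lift p) }) ,
    λ { (inj₁ (lift p)) → lift (true , p) ; (inj₂ (lift p)) → lift (false , p) }

  unionF : Formula 1
  unionF = ∃̇ (∀̇ ((zero ∈̇ 1# ⇒̇ ∃̇ (zero ∈̇ 3# ∧̇ 1# ∈̇ zero)) ∧̇ (∃̇ (zero ∈̇ 3# ∧̇ 1# ∈̇ zero) ⇒̇ zero ∈̇ 1#)))

  union-valid : ∀ x → unionF ⟦ x ∷ [] ⟧
  union-valid (sup A f) = sup (Σ A (Index ∘ f)) (λ (a , b) → branch (f a) b) , λ z →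
    (λ { (lift ((a , b) , p)) → f a , lift (a , ≈-refl) , lift (ε-branch (f a) b p) }) ,
    λ { (y , lift (a , y≈fa) , lift z∈y) → let (b , q) = branch-ε (f a) (ε-respʳ y≈fa z∈y) in lift ((a , b) , q) }
    where
    Index : Tree → Set
    Index (sup B g) = B
    branch : ∀ u → Index u → Tree
    branch (sup B g) = g
    ε-branch : ∀ u b {z} → z ≈ branch u b → z ε u
    ε-branch (sup B g) b p = b , p
    branch-ε : ∀ u {z} → z ε u → ∃[ b ] z ≈ branch u b
    branch-ε (sup B g) p = p

  extensionalityF : Formula 2
  extensionalityF = (∀̇ ((zero ∈̇ 1# ⇒̇ zero ∈̇ 2#) ∧̇ (zero ∈̇ 2# ⇒̇ zero ∈̇ 1#))) ⇒̇ zero ≐ 1#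

  extensionality-valid : ∀ x y → extensionalityF ⟦ x ∷ y ∷ [] ⟧
  extensionality-valid x y h = lift (ε-ext (λ u m → lower (proj₁ (h u) (lift m))) λ u m → lower (proj₂ (h u) (lift m)))

  module _ {n : ℕ} where

    -- Truth of φ lies one universe above the index types of trees; squashing brings it down.
    separator-exists : (φ : Formula (suc n)) (ρ : Vec Tree (suc n)) → Σ Tree (Specification separator n φ ρ)
    separator-exists φ (sup A f ∷ ρ) = sup (Σ A λ a → ∥ φ ⟦ f a ∷ ρ ⟧ ∥) (f ∘ proj₁) , λ x →
      (λ { ((a , p) , q) → (a , q) , ⟦⟧-resp φ (≈ᵛ-cons (≈-sym q) ≈ᵛ-refl) (unsquash p) }) ,
      λ { (a , q) p → (a , squash (⟦⟧-resp φ (≈ᵛ-cons q ≈ᵛ-refl) p)) , q }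

    collector-exists : (φ : Formula (suc (suc n))) (b : Tree) (ρ : Vec Tree n) →
      (∀ x → x ε b → Σ Tree λ y → φ ⟦ y ∷ x ∷ ρ ⟧) → Σ Tree (Specification collector n φ (b ∷ ρ))
    collector-exists φ (sup A f) ρ h = sup A (λ a → proj₁ (h (f a) (a , ≈-refl))) , λ { x (a , q) →
      _ , (a , ≈-refl) , ⟦⟧-resp φ (≈ᵛ-cons ≈-refl (≈ᵛ-cons (≈-sym q) ≈ᵛ-refl)) (proj₂ (h (f a) (a , ≈-refl))) }

    minimal-exists : (φ : Formula (suc n)) (ρ : Vec Tree n) (a : Tree) → ¬ (φ ⟦ a ∷ ρ ⟧) →
      Σ Tree (Specification minimal n φ ρ)
    minimal-exists φ ρ (sup A f) ¬p with em {P = ∃[ a ] ¬ (φ ⟦ f a ∷ ρ ⟧)}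
    ... | yes (a , ¬q) = minimal-exists φ ρ (f a) ¬q
    ... | no ¬∃ = sup A f , ¬p , λ { y (a , q) → ⟦⟧-resp φ (≈ᵛ-cons (≈-sym q) ≈ᵛ-refl)
      (decidable-stable λ ¬q → ¬∃ (a , ¬q)) }

-- Term models and Łoś's theorem

-- In this ultrapower only the countably many functions given by terms are used, so that the filter need only
-- decide a countable family of sets and exists without choice.
module Evaluation (em : ∀ {ℓ} → ExcludedMiddle ℓ) {I : Set} (g : ℕ → I → Tree) where
  open Universe em

  eval : Term → I → Tree
  evals : ∀ {n} → Vec Term n → I → Vec Tree n
  eval (generator k) i = g k i
  eval (operation o n φ ts) i = choose (Specification o n φ (evals ts i))
  evals [] i = []
  evals (t ∷ ts) i = eval t i ∷ evals ts i

  record Ultrafilter : Set₂ where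
    field
      U          : (I → Set₁) → Set₁
      mono       : ∀ {P Q : I → Set₁} → (∀ i → P i → Q i) → U P → U Q
      meet       : ∀ {P Q : I → Set₁} → U P → U Q → U (λ i → P i × Q i)
      consistent : ∀ {P : I → Set₁} → U P → ∃[ i ] P i
      decides    : ∀ {n} (φ : Formula n) (ts : Vec Term n) →
        U (λ i → φ ⟦ evals ts i ⟧) ⊎ U (λ i → ¬ (φ ⟦ evals ts i ⟧))

module TermModel (em : ∀ {ℓ} → ExcludedMiddle ℓ) {I : Set} (g : ℕ → I → Tree)
  (ultrafilter : Evaluation.Ultrafilter em g) where
  open Classical em
  open Universe em
  open Evaluation em g
  open Ultrafilter ultrafilter

  -- Whichever way `⊥̇` is decided, some set lies in `U`, and monotonicity enlarges it.
  everywhere : {P : I → Set₁} → (∀ i → P i) → U P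
  everywhere h with decides ⊥̇ []
  ... | inj₁ p = mono (λ i _ → h i) p
  ... | inj₂ p = mono (λ i _ → h i) p

  refute : {P : I → Set₁} → (∀ i → ¬ P i) → ¬ U P
  refute h p = let (i , q) = consistent p in h i q

  infix 4 _~_

  _~_ : Term → Term → Set₁
  s ~ t = U λ i → Lift _ (eval s i ≈ eval t i)

  ~-sym : ∀ s t → s ~ t → t ~ s
  ~-sym s t = mono λ { i (lift p) → lift (≈-sym p) }

  ~-trans : ∀ s t u → s ~ t → t ~ u → s ~ u
  ~-trans s t u p q = mono (λ { i (lift p , lift q) → lift (≈-trans p q) }) (meet p q)

  -- A class of terms is represented by its member of least number.
  Element : Set
  Element = Σ Term λ t → ∥ (∀ s → s ~ t → termNumber t ℕ.≤ termNumber s) ∥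

  model : Structure
  model = record
    { Carrier = Element
    ; _∈_ = λ (s , _) (t , _) → ∥ U (λ i → Lift _ (eval s i ε eval t i)) ∥
    }

  open Structure model using (_∈_)

  private
    representative : (t : Term) → ∃[ s ] s ~ t × (∀ u → u ~ t → termNumber s ℕ.≤ termNumber u)
    representative t = least-of termNumber (_~ t) (t , everywhere λ i → lift ≈-refl)

  class : Term → Element
  class t with representative t
  ... | s , s~t , min = s , squash λ u u~s → min u (~-trans u s t u~s s~t)

  class-~ : ∀ t → proj₁ (class t) ~ t
  class-~ t with representative t
  ... | s , s~t , _ = s~t

  ~⇒≡ : ∀ {x y : Element} → proj₁ x ~ proj₁ y → x ≡ y
  ~⇒≡ {s , p} {t , q} s~t = squashed-≡ {P = λ t → ∀ s → s ~ t → termNumber t ℕ.≤ termNumber s} (termNumber-injective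
    (ℕ.≤-antisym (unsquash p t (~-sym s t s~t)) (unsquash q s s~t)))

  terms : ∀ {n} → Vec Element n → Vec Term n
  terms = Vec.map proj₁

  env : ∀ {n} → Vec Element n → I → Vec Tree n
  env ρ = evals (terms ρ)

  lookup-env : ∀ {n} (ρ : Vec Element n) x i → lookup (env ρ i) x ≡ eval (proj₁ (lookup ρ x)) i
  lookup-env (a ∷ ρ) zero i = refl
  lookup-env (a ∷ ρ) (suc x) i = lookup-env ρ x i

  private
    witnessTerm : ∀ {n} → Formula (suc n) → Vec Element n → Term
    witnessTerm φ ρ = operation witness _ φ (terms ρ)

  -- Proved together with the converse, because an implication sends its premise in the opposite
  -- direction.
  Łoś⇒ : ∀ {n} (φ : Formula n) ρ → model ⊨ φ [ ρ ] → U λ i → φ ⟦ env ρ i ⟧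
  Łoś⇐ : ∀ {n} (φ : Formula n) ρ → U (λ i → φ ⟦ env ρ i ⟧) → model ⊨ φ [ ρ ]

  Łoś⇒ (x ∈̇ y) ρ p = mono (λ { i (lift q) → lift (subst (_ε _) (sym (lookup-env ρ x i)) (subst (_ ε_) (sym (lookup-env ρ y i)) q)) }) (unsquash p)
  Łoś⇒ (x ≐ y) ρ p = everywhere λ i → lift
    (subst (lookup (env ρ i) x ≈_) (trans (lookup-env ρ x i) (trans (cong (λ m → eval (proj₁ m) i) p) (sym (lookup-env ρ y i)))) ≈-refl)
  Łoś⇒ (φ ∧̇ ψ) ρ (p , q) = meet (Łoś⇒ φ ρ p) (Łoś⇒ ψ ρ q)
  Łoś⇒ (φ ∨̇ ψ) ρ (inj₁ p) = mono (λ _ → inj₁) (Łoś⇒ φ ρ p)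
  Łoś⇒ (φ ∨̇ ψ) ρ (inj₂ q) = mono (λ _ → inj₂) (Łoś⇒ ψ ρ q)
  Łoś⇒ (φ ⇒̇ ψ) ρ f with decides φ (terms ρ)
  ... | inj₁ p = mono (λ i q _ → q) (Łoś⇒ ψ ρ (f (Łoś⇐ φ ρ p)))
  ... | inj₂ ¬p = mono (λ i ¬p p → ⊥-elim (¬p p)) ¬p
  Łoś⇒ (∃̇ φ) ρ (a , p) = mono (λ i q → _ , q) (Łoś⇒ φ (a ∷ ρ) p)
  Łoś⇒ (∀̇ φ) ρ f with decides (∀̇ φ) (terms ρ)
  ... | inj₁ p = p
  -- The witness term for the negation of φ names a counterexample wherever there is one, yet its
  -- class satisfies φ by hypothesis.
  ... | inj₂ ¬p = ⊥-elim (refute contradictory (meet ¬p (meet (class-~ t) (Łoś⇒ φ (class t ∷ ρ) (f (class t))))))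
    where
    t : Term
    t = witnessTerm (φ ⇒̇ ⊥̇) ρ
    contradictory : ∀ i → ¬ (¬ (∀ a → φ ⟦ a ∷ env ρ i ⟧) × Lift _ (eval (proj₁ (class t)) i ≈ eval t i) ×
      (φ ⟦ eval (proj₁ (class t)) i ∷ env ρ i ⟧))
    contradictory i (¬∀ , lift e , p) with ¬∀⟶∃¬ ¬∀
    ... | a , ¬q = lower (choose-spec (λ a → φ ⇒̇ ⊥̇ ⟦ a ∷ env ρ i ⟧) (a , λ q → ⊥-elim (¬q q))
      (⟦⟧-resp φ (≈ᵛ-cons e ≈ᵛ-refl) p))
  Łoś⇒ ⊥̇ ρ ()

  Łoś⇐ (x ∈̇ y) ρ p = squash (mono (λ { i (lift q) → lift (subst (_ε _) (lookup-env ρ x i) (subst (_ ε_) (lookup-env ρ y i) q)) }) p)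
  Łoś⇐ (x ≐ y) ρ p = ~⇒≡ (mono (λ { i (lift q) → lift (subst (_≈ _) (lookup-env ρ x i) (subst (_ ≈_) (lookup-env ρ y i) q)) }) p)
  Łoś⇐ ⊥̇ ρ p = lower (proj₂ (consistent p))
  Łoś⇐ (φ ∧̇ ψ) ρ p = Łoś⇐ φ ρ (mono (λ _ → proj₁) p) , Łoś⇐ ψ ρ (mono (λ _ → proj₂) p)
  Łoś⇐ (φ ∨̇ ψ) ρ p with decides φ (terms ρ)
  ... | inj₁ q = inj₁ (Łoś⇐ φ ρ q)
  ... | inj₂ ¬q = inj₂ (Łoś⇐ ψ ρ (mono (λ { i (inj₁ r , ¬r) → ⊥-elim (¬r r) ; i (inj₂ r , _) → r }) (meet p ¬q)))
  Łoś⇐ (φ ⇒̇ ψ) ρ p q = Łoś⇐ ψ ρ (mono (λ i (f , x) → f x) (meet p (Łoś⇒ φ ρ q)))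
  Łoś⇐ (∀̇ φ) ρ p a = Łoś⇐ φ (a ∷ ρ) (mono (λ i f → f _) p)
  Łoś⇐ (∃̇ φ) ρ p = class t , Łoś⇐ φ (class t ∷ ρ) (mono transport (meet p (class-~ t)))
    where
    t : Term
    t = witnessTerm φ ρ
    transport : ∀ i → (∃̇ φ ⟦ env ρ i ⟧) × Lift _ (eval (proj₁ (class t)) i ≈ eval t i) →
      φ ⟦ eval (proj₁ (class t)) i ∷ env ρ i ⟧
    transport i (q , lift e) = ⟦⟧-resp φ (≈ᵛ-cons (≈-sym e) ≈ᵛ-refl) (choose-spec (λ a → φ ⟦ a ∷ env ρ i ⟧) q)

  ∈⇒ε : ∀ {x y} → x ∈ y → U λ i → Lift _ (eval (proj₁ x) i ε eval (proj₁ y) i)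
  ∈⇒ε = unsquash

  class-∈ : ∀ {s t} → U (λ i → Lift _ (eval s i ε eval t i)) → class s ∈ class t
  class-∈ {s} {t} p = squash (mono (λ { i (lift m , lift e , lift e′) → lift (ε-respˡ (≈-sym e) (ε-respʳ (≈-sym e′) m)) })
    (meet p (meet (class-~ s) (class-~ t))))

  ∈-class : ∀ {x t} → U (λ i → Lift _ (eval (proj₁ x) i ε eval t i)) → x ∈ class t
  ∈-class {x} {t} p = squash (mono (λ { i (lift m , lift e) → lift (ε-respʳ (≈-sym e) m) }) (meet p (class-~ t)))

  ∈-class⁻ : ∀ {x t} → x ∈ class t → U (λ i → Lift _ (eval (proj₁ x) i ε eval t i))
  ∈-class⁻ {x} {t} p = mono (λ { i (lift m , lift e) → lift (ε-respʳ e m) }) (meet (∈⇒ε {x} {class t} p) (class-~ t))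

  private
    separation : ∀ {n} (φ : Formula (suc n)) (ρ : Vec Element n) a →
      ∃[ b ] ∀ x → (x ∈ b) ⇔ (x ∈ a × model ⊨ φ [ x ∷ ρ ])
    separation φ ρ a = class t , λ x → mk⇔
      (λ m → let p = mono (λ { i (lift m) → proj₁ (spec i (eval (proj₁ x) i)) m }) (∈-class⁻ {x} {t} m)
             in squash (mono (λ i q → lift (proj₁ q)) p) , Łoś⇐ φ (x ∷ ρ) (mono (λ i → proj₂) p))
      λ (m , p) → ∈-class {x} {t}
        (mono (λ { i (lift m , p) → lift (proj₂ (spec i (eval (proj₁ x) i)) m p) }) (meet (∈⇒ε {x} {a} m) (Łoś⇒ φ (x ∷ ρ) p)))
      where
      t : Term
      t = operation separator _ φ (terms (a ∷ ρ))
      spec : ∀ i → Specification separator _ φ (env (a ∷ ρ) i) (eval t i)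
      spec i = choose-spec _ (separator-exists φ (env (a ∷ ρ) i))

    -- The hypothesis speaks of elements of the model and not of the members at each index. Applied
    -- to the class of the `counterexample` term, it yields totality at almost all indices, where
    -- `collector` and `choice` then work.
    collection : ∀ {n} (φ : Formula (suc (suc n))) (ρ : Vec Element n) a →
      (∀ x → x ∈ a → ∃[ y ] model ⊨ φ [ y ∷ x ∷ ρ ]) →
      ∃[ b ] ∀ x → x ∈ a → ∃[ y ] y ∈ b × model ⊨ φ [ y ∷ x ∷ ρ ]
    collection {n} φ ρ a h = class t , λ x m → class (s x) , class-∈ {s x} {t} (mono (λ i p → lift (proj₁ p)) (picks x m)) ,
      Łoś⇐ φ (class (s x) ∷ x ∷ ρ)
        (mono (λ { i ((_ , p) , lift e) → ⟦⟧-resp φ (≈ᵛ-cons (≈-sym e) ≈ᵛ-refl) p }) (meet (picks x m) (class-~ (s x))))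
      where
      Total : I → Set₁
      Total i = ∀ x → x ε eval (proj₁ a) i → Σ Tree λ y → φ ⟦ y ∷ x ∷ env ρ i ⟧
      t c : Term
      t = operation collector n φ (terms (a ∷ ρ))
      c = operation counterexample n φ (terms (a ∷ ρ))
      counter : ∀ i → ¬ Total i → Specification counterexample n φ (env (a ∷ ρ) i) (eval c i)
      counter i ¬total with ¬∀⟶∃¬ ¬total
      ... | x , ¬q = choose-spec (Specification counterexample n φ (env (a ∷ ρ) i)) (x , decidable-stable (λ ¬m → ¬q λ m → ⊥-elim (¬m m)) ,
        λ y → ¬q λ _ → y)
      total-∈ : ∃[ y ] model ⊨ φ [ y ∷ class c ∷ ρ ] → U Total
      total-∈ (y , p) = mono
        (λ { i (q , lift e) → decidable-stable λ ¬total → proj₂ (counter i ¬total)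
          (eval (proj₁ y) i , ⟦⟧-resp φ (≈ᵛ-cons ≈-refl (≈ᵛ-cons e ≈ᵛ-refl)) q) })
        (meet (Łoś⇒ φ (y ∷ class c ∷ ρ) p) (class-~ c))
      class-∈a : U (λ i → Lift _ (eval c i ε eval (proj₁ a) i)) → class c ∈ a
      class-∈a m = squash (mono (λ { i (lift m , lift e) → lift (ε-respˡ (≈-sym e) m) }) (meet m (class-~ c)))
      total : U Total
      total = [ (λ ∈a → total-∈ (h (class c) (class-∈a ∈a))) ,
        mono (λ i ¬m → decidable-stable λ ¬q → ¬m (lift (proj₁ (counter i ¬q)))) ]′
        (decides (zero ∈̇ 1#) (c ∷ proj₁ a ∷ []))
      s : Element → Term
      s x = operation choice n φ (t ∷ terms (x ∷ ρ))
      collects : ∀ i → Total i → Specification collector n φ (env (a ∷ ρ) i) (eval t i)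
      collects i h = choose-spec (Specification collector n φ (env (a ∷ ρ) i)) (collector-exists φ (eval (proj₁ a) i) (env ρ i) h)
      picks : ∀ x → x ∈ a → U λ i → Specification choice n φ (eval t i ∷ env (x ∷ ρ) i) (eval (s x) i)
      picks x m = mono (λ { i (lift m , total) →
          choose-spec (Specification choice n φ (eval t i ∷ env (x ∷ ρ) i))
            (collects i total (eval (proj₁ x) i) m) })
        (meet (∈⇒ε {x} {a} m) total)

    -- The model may be ill-founded, so the induction takes place at each index: the class of the
    -- term for an ∈-minimal failure violates the hypothesis.
    induction : ∀ {n} (φ : Formula (suc n)) (ρ : Vec Element n) →
      (∀ x → (∀ y → y ∈ x → model ⊨ φ [ y ∷ ρ ]) → model ⊨ φ [ x ∷ ρ ]) → ∀ x → model ⊨ φ [ x ∷ ρ ]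
    induction {n} φ ρ h x with decides φ (terms (x ∷ ρ))
    ... | inj₁ p = Łoś⇐ φ (x ∷ ρ) p
    ... | inj₂ ¬p = ⊥-elim (refute (λ { i (q , lift e , (¬q , _)) → ¬q (⟦⟧-resp φ (≈ᵛ-cons e ≈ᵛ-refl) q) })
        (meet (Łoś⇒ φ (class t ∷ ρ) (h (class t) below)) (meet (class-~ t) least-t)))
      where
      t : Term
      t = operation minimal n φ (terms ρ)
      least-t : U λ i → Specification minimal n φ (env ρ i) (eval t i)
      least-t = mono (λ i ¬q → choose-spec (Specification minimal n φ (env ρ i)) (minimal-exists φ (env ρ i) _ ¬q)) ¬p
      below : ∀ y → y ∈ class t → model ⊨ φ [ y ∷ ρ ]
      below y m = Łoś⇐ φ (y ∷ ρ) (mono (λ { i (lift m , (_ , q)) → q _ m }) (meet (∈-class⁻ {y} {t} m) least-t))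

  isModelOfKP : IsModelOfKP model
  isModelOfKP = record
    { inhabitant = class (generator 0)
    ; extensionality = λ x y h → Łoś⇐ extensionalityF (x ∷ y ∷ []) (everywhere λ i → extensionality-valid _ _)
        λ z → Equivalence.to (h z) , Equivalence.from (h z)
    ; pairing = λ x y → let (p , h) = Łoś⇐ pairingF (x ∷ y ∷ []) (everywhere λ i → pairing-valid _ _)
                        in p , λ z → mk⇔ (proj₁ (h z)) (proj₂ (h z))
    ; union = λ x → let (u , h) = Łoś⇐ unionF (x ∷ []) (everywhere λ i → union-valid _)
                    in u , λ z → mk⇔ (proj₁ (h z)) (proj₂ (h z))
    ; ∈-induction = induction
    ; Δ₀-separation = λ φ _ → separation φ
    ; Δ₀-collection = λ φ _ → collection φ
    }

  countableModel : CountableModel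
  countableModel = record
    { structure = model
    ; isModelOfKP = isModelOfKP
    ; countable = record
      { to = termNumber ∘ proj₁
      ; cong = cong (termNumber ∘ proj₁)
      ; injective = λ e → squashed-≡ {P = λ t → ∀ s → s ~ t → termNumber t ℕ.≤ termNumber s} (termNumber-injective e)
      }
    }

-- High well-founded models and an ill-founded model

rankAcc-≈ : {A : Set} {_<_ : Rel A 0ℓ} → ∀ {x} (p q : Acc _<_ x) → Rank.rankAcc p ≈ Rank.rankAcc q
rankAcc-≈ (acc rs) (acc rs′) =
  (λ (y , y<x) → (y , y<x) , rankAcc-≈ (rs y<x) (rs′ y<x)) , λ (y , y<x) → (y , y<x) , rankAcc-≈ (rs y<x) (rs′ y<x)

-- Read as a set, the tree `rank wf x` is the Mostowski collapse of x.
rank-ε : {A : Set} {_<_ : Rel A 0ℓ} (wf : WellFounded _<_) → ∀ {x y} → x < y → Rank.rank wf x ε Rank.rank wf y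
rank-ε wf {x} {y} x<y with wf y
... | acc rs = (x , x<y) , rankAcc-≈ (wf x) (rs x<y)

module Hull (em : ∀ {ℓ} → ExcludedMiddle ℓ) {G : Set} (number : G → ℕ)
  (number-injective : ∀ {x y} → number x ≡ number y → x ≡ y) (value : G → Tree) where
  open Classical em

  private
    generate : ℕ → ⊤ → Tree
    generate k _ with em {P = ∃[ x ] number x ≡ k}
    ... | yes (x , _) = value x
    ... | no _ = sup ⊥ λ ()

    generate-value : ∀ x → generate (number x) tt ≡ value x
    generate-value x with em {P = ∃[ y ] number y ≡ number x}
    ... | yes (y , e) = cong value (number-injective e)
    ... | no ¬∃ = ⊥-elim (¬∃ (x , refl))

  open Evaluation em generate

  -- With a single index, the term model is a Skolem hull in the universe of trees.
  principal : Ultrafilter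
  principal = record
    { U = λ P → P tt
    ; mono = λ h → h tt
    ; meet = _,_
    ; consistent = tt ,_
    ; decides = λ φ ts → decide
    }
    where
    decide : {P : Set₁} → P ⊎ ¬ P
    decide {P} with em {P = P}
    ... | yes p = inj₁ p
    ... | no ¬p = inj₂ ¬p

  open TermModel em generate principal

  hull : CountableModel
  hull = countableModel

  open CountableModel hull using (_∈_)

  hull-WF : WF hull
  hull-WF x = go (ε-wellFounded (eval (proj₁ x) tt))
    where
    go : ∀ {x} → Acc _ε_ (eval (proj₁ x) tt) → Acc _∈_ x
    go {x} (acc rs) = acc λ {y} m → go (rs (lower (∈⇒ε {y} {x} m)))

  name : G → CountableModel.Carrier hull
  name x = class (generator (number x))

  name-∈ : ∀ {x y} → value x ε value y → name x ∈ name y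
  name-∈ {x} {y} m = class-∈ {generator (number x)} {generator (number y)}
    (lift (subst (_ε _) (sym (generate-value x)) (subst (_ ε_) (sym (generate-value y)) m)))

module Existence (em : ∀ {ℓ} → ExcludedMiddle ℓ) where
  open Classical em
  open Rank

  module _ {J : Set} (number : J → ℕ) (number-injective : ∀ {i j} → number i ≡ number j → i ≡ j)
    (M : J → CountableModel) (wf : ∀ j → WF (M j)) where

    private
      -- `nothing` stands for the collapse of the whole model `M j`, so that the hull has a set
      -- above all ranks of `M j`.
      G : Set
      G = ∃[ j ] Maybe (CountableModel.Carrier (M j))

      encode : G → Code
      encode (j , nothing) = leaf (number j)
      encode (j , just x) = node (leaf (number j)) (leaf (code (M j) x))

      encode-injective : ∀ {x y} → encode x ≡ encode y → x ≡ y
      encode-injective {i , nothing} {j , nothing} e with number-injective (leaf-injective e)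
        where
        leaf-injective : ∀ {m n} → leaf m ≡ leaf n → m ≡ n
        leaf-injective refl = refl
      ... | refl = refl
      encode-injective {i , just x} {j , just y} e with node-injective e
        where
        node-injective : ∀ {m n k l} → node (leaf m) (leaf k) ≡ node (leaf n) (leaf l) → m ≡ n × k ≡ l
        node-injective refl = refl , refl
      ... | p , q with number-injective p
      ... | refl = cong (λ z → i , just z) (code-injective (M i) q)

      value : G → Tree
      value (j , nothing) = height (M j) (wf j)
      value (j , just x) = rank (wf j) x

      open Hull em (toNumber ∘ encode) (λ {x} {y} e → encode-injective (toNumber-injective {encode x} {encode y} e)) value

      rank-≤ : ∀ j x → rank (wf j) x ≤ᵗ rank hull-WF (name (j , just x))
      rank-≤ j x = go (wf j x)
        where
        go : ∀ {x} → Acc (CountableModel._∈_ (M j)) x → rank (wf j) x ≤ᵗ rank hull-WF (name (j , just x))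
        go {x} (acc rs) = rank-least (wf j) x λ {y} y∈x →
          ≤-<ᵗ-trans (go (rs y∈x)) (rank-mono hull-WF (name-∈ {j , just y} {j , just x} (rank-ε (wf j) y∈x)))

      height-≤ : ∀ j → height (M j) (wf j) ≤ᵗ rank hull-WF (name (j , nothing))
      height-≤ j x = ≤-<ᵗ-trans (rank-≤ j x)
        (rank-mono hull-WF (name-∈ {j , just x} {j , nothing} (x , ≈-refl)))

    bound : ∃[ N ] Σ (WF N) λ wfN → ∀ j → ∃[ x ] rank wfN x ≃ᵗ height (M j) (wf j)
    -- A lower bound for the rank of the name is enough, because ranks have no gaps.
    bound = hull , hull-WF , λ j → rank-attains hull-WF em (name (j , nothing)) (height-≤ j)

  private
    numeral : ℕ → Tree
    numeral zero = sup ⊥ λ ()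
    numeral (suc n) = sup ⊤ λ _ → numeral n

    -- descent (suc k) i ε descent k i at all indices i > k
    descent : ℕ → ℕ → Tree
    descent k i = numeral (i ℕ.∸ k)

    descends : ∀ {k i} → k ℕ.< i → descent (suc k) i ε descent k i
    descends {zero} {suc i} _ = tt , ≈-refl
    descends {suc k} {suc i} (s≤s lt) = descends {k} {i} lt

    open Evaluation em descent

    Infinite : (ℕ → Set₁) → Set₁
    Infinite P = ∀ m → ∃[ i ] m ℕ.≤ i × P i

    infinite-split : ∀ (P Q : ℕ → Set₁) → Infinite P → ¬ Infinite (λ i → P i × Q i) → Infinite (λ i → P i × ¬ Q i)
    infinite-split P Q inf ¬inf m with ¬∀⟶∃¬ ¬inf
    ... | n , ¬∃ with inf (m ℕ.+ n)
    ... | i , le , p = i , ℕ.≤-trans (ℕ.m≤m+n m n) le , p ,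
      λ q → ¬∃ (i , ℕ.≤-trans (ℕ.m≤n+m n m) le , p , q)

    Family : ℕ → ℕ → Set₁
    Family k i = Σ Instance λ (n , φ , ts) → instanceNumber (n , φ , ts) ≡ k × (φ ⟦ evals ts i ⟧)

    family : ∀ {n} {φ : Formula n} {ts : Vec Term n} {i} → Family (instanceNumber (n , φ , ts)) i → φ ⟦ evals ts i ⟧
    family {n} {φ} {ts} ((m , ψ , ss) , e , p) with instanceNumber-injective {m , ψ , ss} {n , φ , ts} e
    ... | refl = p

    -- Decides the sets of the family one after the other, keeping the intersection infinite.
    Stage : ℕ → ℕ → Set₁
    Stage zero i = Lift _ ⊤
    Stage (suc k) with em {P = Infinite (λ i → Stage k i × Family k i)}
    ... | yes _ = λ i → Stage k i × Family k i
    ... | no _ = λ i → Stage k i × ¬ Family k i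

    stage-infinite : ∀ k → Infinite (Stage k)
    stage-infinite zero m = m , ℕ.≤-refl , lift tt
    stage-infinite (suc k) with em {P = Infinite (λ i → Stage k i × Family k i)}
    ... | yes inf = inf
    ... | no ¬inf = infinite-split (Stage k) (Family k) (stage-infinite k) ¬inf

    stage-step : ∀ k {i} → Stage (suc k) i → Stage k i
    stage-step k s with em {P = Infinite (λ i → Stage k i × Family k i)}
    ... | yes _ = proj₁ s
    ... | no _ = proj₁ s

    stage-antitone : ∀ {k l i} → k ℕ.≤′ l → Stage l i → Stage k i
    stage-antitone ℕ.≤′-refl s = s
    stage-antitone (ℕ.≤′-step le) s = stage-antitone le (stage-step _ s)

    stage-decides : ∀ k → (∀ i → Stage (suc k) i → Family k i) ⊎ (∀ i → Stage (suc k) i → ¬ Family k i)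
    stage-decides k with em {P = Infinite (λ i → Stage k i × Family k i)}
    ... | yes _ = inj₁ λ i → proj₂
    ... | no _ = inj₂ λ i → proj₂

    U : (ℕ → Set₁) → Set₁
    U P = ∃[ k ] ∀ i → Stage k i → P i

    nonprincipal : Ultrafilter
    nonprincipal = record
      { U = U
      ; mono = λ h (k , f) → k , λ i s → h i (f i s)
      ; meet = λ (k , f) (l , f′) → k ℕ.⊔ l , λ i s →
          f i (stage-antitone (ℕ.≤⇒≤′ (ℕ.m≤m⊔n k l)) s) , f′ i (stage-antitone (ℕ.≤⇒≤′ (ℕ.m≤n⊔m k l)) s)
      ; consistent = λ (k , f) → let (i , _ , s) = stage-infinite k 0 in i , f i s
      ; decides = decides
      }
      where
      decides : ∀ {n} (φ : Formula n) (ts : Vec Term n) →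
        U (λ i → φ ⟦ evals ts i ⟧) ⊎ U (λ i → ¬ (φ ⟦ evals ts i ⟧))
      decides {n} φ ts with stage-decides (instanceNumber (n , φ , ts))
      ... | inj₁ h = inj₁ (suc (instanceNumber (n , φ , ts)) , λ i s → family {φ = φ} {ts} (h i s))
      ... | inj₂ h = inj₂ (suc (instanceNumber (n , φ , ts)) , λ i s p → h i s ((n , φ , ts) , refl , p))

    open TermModel em descent nonprincipal

  ill-founded : CountableModel
  ill-founded = countableModel

  ill-founded-¬WF : ¬ WF ill-founded
  ill-founded-¬WF wf = go 0 (wf (class (generator 0)))
    where
    -- Every stage contains indices beyond `k`, where the membership holds, so its negation cannot
    -- be in the filter.
    descends-U : ∀ k → U λ i → Lift _ (descent (suc k) i ε descent k i)
    descends-U k = [ id , (λ (l , f) → let (i , lt , s) = stage-infinite l (suc k) in ⊥-elim (f i s (lift (descends lt)))) ]′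
      (Ultrafilter.decides nonprincipal (zero ∈̇ 1#) (generator (suc k) ∷ generator k ∷ []))
    go : ∀ k → Acc (CountableModel._∈_ ill-founded) (class (generator k)) → ⊥
    go k (acc rs) = go (suc k) (rs (class-∈ {generator (suc k)} {generator k} (descends-U k)))

-- Every countable ordinal is realized

module Surjectivity (em : ∀ {ℓ} → ExcludedMiddle ℓ) where
  open Classical em
  open TreeOrder em
  open OrderTypes em
  open HeightOrder em
  open Existence em
  open Rank

  Realized : Tree → Set₁
  Realized v = ∃[ M ] Σ (WF M) λ wf → orderType (heightOrder M wf) ≃ᵗ v

  -- A model whose ranks attain the heights of all `M j` has an order type above all of theirs,
  -- hence at least `v`. If it exceeds `v`, then `v` is the order rank of a marked element, and the
  -- model whose height marks it has order type `v`.
  realize-sup : {J : Set} (number : J → ℕ) → (∀ {i j} → number i ≡ number j → i ≡ j) →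
    (M : J → CountableModel) (wf : ∀ j → WF (M j)) → ∀ v →
    (∀ u → u <ᵗ v → ∃[ j ] u ≤ᵗ orderType (heightOrder (M j) (wf j))) → Realized v
  realize-sup number number-injective M wf v cofinal with bound number number-injective M wf
  ... | N , wfN , attained = conclude (≤ᵗ-total v (orderType β))
    where
    β = heightOrder N wfN
    below : ∀ j → orderType (heightOrder (M j) (wf j)) <ᵗ orderType β
    below j = let (x , h) = attained j
                  (b , q) = marked N wfN x (proj₂ h) (M j , wf j , ≃ᵗ-refl)
              in b , proj₂ (orderRank-height wfN (wf j) {b} q)
    conclude : v ≤ᵗ orderType β ⊎ orderType β <ᵗ v → Realized v
    conclude (inj₂ p) = let (j , q) = cofinal _ p in ⊥-elim (<ᵗ-irrefl (≤-<ᵗ-trans q (below j)))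
    conclude (inj₁ p) with ≤ᵗ-total (orderType β) v
    ... | inj₁ q = N , wfN , q , p
    ... | inj₂ (b , q) with rank-attains (CountableWellOrder.wellFounded β) em b q
    ... | b′ , r with marked-isHeight N wfN b′
    ... | N′ , wfN′ , h = N′ , wfN′ , ≃ᵗ-trans (≃ᵗ-sym (orderRank-height wfN wfN′ {b′} h)) r

  module _ (α : CountableWellOrder) where
    open CountableWellOrder α
    private
      number : Carrier → ℕ
      number = Injection.to countable
      number-injective : ∀ {x y} → number x ≡ number y → x ≡ y
      number-injective = Injection.injective countable

    realize-rank : ∀ a → Realized (orderRank α a)
    realize-rank a = go (wellFounded a)
      where
      go : ∀ {a} → Acc _<_ a → Realized (orderRank α a)
      -- Squashing `b < a` keeps the numbering of the index set injective.
      go {a} (acc rs) = realize-sup {Σ Carrier λ b → ∥ b < a ∥} (number ∘ proj₁)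
        (λ e → squashed-≡ {P = _< a} (number-injective e))
        (λ (b , p) → proj₁ (ih b p)) (λ (b , p) → proj₁ (proj₂ (ih b p))) (orderRank α a)
        λ u u<a → let (b , b<a , u≤b) = rank-below wellFounded a u<a
                  in (b , squash b<a) , ≤ᵗ-trans u≤b (proj₂ (proj₂ (proj₂ (ih b (squash b<a)))))
        where
        ih : ∀ b → ∥ b < a ∥ → Realized (orderRank α b)
        ih b p = go (rs (unsquash p))

    realize : Realized (orderType α)
    realize = realize-sup number number-injective (proj₁ ∘ realize-rank) (proj₁ ∘ proj₂ ∘ realize-rank) (orderType α)
      λ u (a , u≤a) → a , ≤ᵗ-trans u≤a (proj₂ (proj₂ (proj₂ (realize-rank a))))

-- The order isomorphism with ω₁ + 1

module OrderIsomorphism (em : ∀ {ℓ} → ExcludedMiddle ℓ) where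
  open Comparison em
  open OrderTypes em
  open HeightOrder em
  open Existence em using (ill-founded; ill-founded-¬WF)
  open Surjectivity em using (realize)

  private
    -- The decision is an argument so that the lemmas can distinguish its cases; `classify` supplies
    -- it by excluded middle.
    assign : (M : CountableModel) → Dec (WF M) → ω₁+1
    assign M (yes wf) = [ heightOrder M wf ]
    assign M (no _) = ⊤⁺

    assign-mono : ∀ {M N} d d′ → M ≲ N → assign M d ≤⁺ assign N d′
    assign-mono (yes wf) (yes wf′) f = [ orderType⇒≤ (height⇒orderType wf wf′ (≲-height f wf wf′)) ]
    assign-mono (no ¬wf) (yes wf′) f = ⊥-elim (¬wf (≲-WF f wf′))
    assign-mono d (no _) f = _ ≤⊤⁺

    assign-cancel : ∀ {M N} d d′ → assign M d ≤⁺ assign N d′ → M ≲ N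
    assign-cancel (yes wf) (yes wf′) [ p ] = height-≲ wf wf′ (orderType⇒height wf wf′ (≤⇒orderType p))
    assign-cancel (no _) (yes _) ()
    assign-cancel {M} d (no ¬wf′) _ = ill-founded-≲ M ¬wf′

    assign-cong : ∀ {M N} d d′ → M ≋ N → assign M d ≈⁺ assign N d′
    assign-cong {M} {N} (yes wf) (yes wf′) (f ,, g) = [ orderType⇒≅ {heightOrder M wf} {heightOrder N wf′}
      (height⇒orderType wf wf′ (≲-height f wf wf′) , height⇒orderType wf′ wf (≲-height g wf′ wf)) ]
    assign-cong (yes wf) (no ¬wf′) (_ ,, g) = ⊥-elim (¬wf′ (≲-WF g wf))
    assign-cong (no ¬wf) (yes wf′) (f ,, _) = ⊥-elim (¬wf (≲-WF f wf′))
    assign-cong (no _) (no _) _ = ⊤⁺≈⊤⁺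

    assign-injective : ∀ {M N} d d′ → assign M d ≈⁺ assign N d′ → M ≋ N
    assign-injective {M} {N} (yes wf) (yes wf′) [ p ] =
      height-≲ wf wf′ (orderType⇒height wf wf′ (proj₁ e)) ,, height-≲ wf′ wf (orderType⇒height wf′ wf (proj₂ e))
      where
      e : orderType (heightOrder M wf) ≃ᵗ orderType (heightOrder N wf′)
      e = ≅⇒orderType {heightOrder M wf} {heightOrder N wf′} p
    assign-injective {M} {N} (no ¬wf) (no ¬wf′) _ = ill-founded-≲ M ¬wf′ ,, ill-founded-≲ N ¬wf

    assign-realized : ∀ {M α} (wf : WF M) → orderType (heightOrder M wf) ≃ᵗ orderType α →
      ∀ {N} (d : Dec (WF N)) → N ≋ M → assign N d ≈⁺ [ α ]
    assign-realized {M} {α} wf e {N} (yes wf′) (f ,, g) = [ orderType⇒≅ {heightOrder N wf′} {α} (≃ᵗ-trans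
      (height⇒orderType wf′ wf (≲-height f wf′ wf) , height⇒orderType wf wf′ (≲-height g wf wf′)) e) ]
    assign-realized wf e (no ¬wf′) (f ,, _) = ⊥-elim (¬wf′ (≲-WF f wf))

    assign-ill-founded : ∀ {N} (d : Dec (WF N)) → N ≋ ill-founded → assign N d ≈⁺ ⊤⁺
    assign-ill-founded (yes wf) (_ ,, g) = ⊥-elim (ill-founded-¬WF (≲-WF g wf))
    assign-ill-founded (no _) _ = ⊤⁺≈⊤⁺

  classify : CountableModel → ω₁+1
  classify M = assign M em

  classify-surjective : ∀ y → ∃[ M ] (∀ {N} → N ≋ M → classify N ≈⁺ y)
  classify-surjective ⊤⁺ = ill-founded , assign-ill-founded em
  classify-surjective [ α ] with realize α
  ... | M , wf , e = M , assign-realized wf e em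

  classify-isOrderIsomorphism : IsOrderIsomorphism _≋_ _≈⁺_ _≲_ _≤⁺_ classify
  classify-isOrderIsomorphism = record
    { isOrderMonomorphism = record
      { isOrderHomomorphism = record { cong = assign-cong em em ; mono = assign-mono em em }
      ; injective = assign-injective em em
      ; cancel = assign-cancel em em
      }
    ; surjective = classify-surjective
    }

theorem2 : (∀ {ℓ} → ExcludedMiddle ℓ) →
    ((M N : CountableModel) → M ≲ N ⊎ N ≲ M)
    × IsTotalOrder _≋_ _≲_
    × WellFounded _⋦_
    × Σ (CountableModel → ω₁+1) (IsOrderIsomorphism _≋_ _≈⁺_ _≲_ _≤⁺_)
theorem2 em = ≲-total , ≲-isTotalOrder , ⋦-wellFounded , classify , classify-isOrderIsomorphism
  where
  open Comparison em
  open OrderIsomorphism em
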